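{- Let $n\geq1$ be an integer, let $\ell$ be an odd prime and let $V$ be a $2n$-dimensional symplectic $\mathbf{F}_\ell$-space. Let $\pi_{\mathrm{vec}}$ be the natural action of $\mathrm{GSp}_{2n}(\mathbf{F}_\ell)=\mathrm{GSp}(V)$ on $V\setminus\{0\}$, and let $\pi_{\mathrm{proj}}$ be the natural action of $\mathrm{PGSp}_{2n}(\mathbf{F}_\ell)=\mathrm{PGSp}(V)$ on the set $\mathbf{P}(V)$ of lines of $V$. If $n\geq 2$, then $$a_{\pi_{\mathrm{vec}}}\bigl(\mathrm{GSp}_{2n}(\mathbf{F}_\ell)\bigr)=\frac{\ell^{2n-2}(\ell^2-1)}{2}\qquad\text{and}\qquad a_{\pi_{\mathrm{proj}}}\bigl(\mathrm{PGSp}_{2n}(\mathbf{F}_\ell)\bigr)=\frac{(\ell+1)(\ell^{2n-2}-1)}{2}.$$ For $n=1$, one has $a_{\pi_{\mathrm{vec}}}(\mathrm{GSp}_{2}(\mathbf{F}_\ell))=\ell(\ell-1)/2$ and $a_{\pi_{\mathrm{proj}}}(\mathrm{PGSp}_{2}(\mathbf{F}_\ell))=(\ell-1)/2$.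
   Context: $V$ carries a nondegenerate alternating form $\langle\ ,\ \rangle$. $\mathrm{GSp}(V)$ is the group of linear automorphisms $g$ of $V$ for which there is $\mu\in\mathbf{F}_\ell^\times$ with $\langle gx,gy\rangle=\mu\langle x,y\rangle$ for all $x,y$; $\mathrm{PGSp}(V)$ is its quotient by the subgroup of scalars. For a permutation $\sigma$ of a finite set $\Omega$, $\mathrm{ind}(\sigma)=|\Omega|-\#\{\text{orbits of }\sigma\text{ on }\Omega\}$. For a faithful transitive permutation representation $\pi$ of a finite group $G$, the Malle invariant is $a_\pi(G)=\min_{1\neq g\in G}\mathrm{ind}(\pi(g))$. -}

module Defs where

open import Algebra.Bundles using (CommutativeMonoid; CommutativeRing; Group; Ring)
open import Algebra.Module.Bundles using (LeftModule)
open import Algebra.Module.Morphism.Structures using (IsLeftModuleHomomorphism; IsLeftModuleIsomorphism)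
import Algebra.Module.Morphism.Construct.Composition as Composition
import Algebra.Module.Morphism.Construct.Identity as Identity
import Algebra.Properties.AbelianGroup as AbelianGroupProperties
import Algebra.Properties.CommutativeSemigroup as CommutativeSemigroupProperties
import Algebra.Properties.Group as GroupProperties
import Algebra.Properties.Monoid.Sum as MonoidSum
import Algebra.Properties.Ring as RingProperties
open import Data.Fin.Base using (Fin; zero; suc; toℕ)
open import Data.Fin.Properties using (toℕ<n; toℕ-fromℕ<; toℕ-injective; all?; ¬∀⟶∃¬)
import Data.Fin.Properties as Fin
open import Data.Integer.Base using (ℤ; -[1+_]) renaming (+_ to pos; -_ to -ℤ_; _+_ to _+ℤ_; suc to sucℤ; pred to predℤ)
import Data.Integer.Properties as ℤ
open import Data.Nat.Base using (ℕ; zero; suc; _∸_; _≤_; NonZero; nonTrivial⇒n>1; ≢-nonZero; >-nonZero⁻¹)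
open import Data.Nat.Coprimality using (prime⇒coprime; coprime-Bézout)
open import Data.Nat.DivMod using (_%_; _mod_; m%n<n; m<n⇒m%n≡m; %-distribˡ-+; %-distribˡ-*; n%n≡0; [m+kn]%n≡m%n)
open import Data.Nat.GCD using (module Bézout)
open import Data.Nat.Primality using (Prime; prime⇒nonZero; prime⇒nonTrivial)
import Data.Nat.Base as Nat
import Data.Nat.Properties as ℕ
open import Data.Product.Base using (∃-syntax; _×_; _,_; proj₁; proj₂)
open import Data.Vec.Functional using (Vector)
open import Function.Base using (_∘_; id)
open import Function.Bundles using (Inverse; _⇔_; mk⇔; Equivalence)
open import Level using (Level; _⊔_; 0ℓ) renaming (suc to lsuc)
open import Relation.Binary.Bundles using (Setoid)
open import Relation.Binary.PropositionalEquality using (_≡_; _≢_; refl; sym; trans; cong; cong₂; isEquivalence; module ≡-Reasoning)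
import Relation.Binary.PropositionalEquality as ≡
import Relation.Binary.Reasoning.Setoid as SetoidReasoning
open import Relation.Nullary using (¬_; Dec; yes; no)

private
  variable
    a b c e o : Level

-- Sets are setoids, so the orbit space of a permutation and PGSp are obtained by
-- coarsening an equality; elements are counted up to equality.

HasCardinality : Setoid o e → ℕ → Set (o ⊔ e)
HasCardinality Ω k = Inverse Ω (≡.setoid (Fin k))

Permutation : Setoid o e → Set (o ⊔ e)
Permutation Ω = Inverse Ω Ω

module _ {Ω : Setoid o e} (σ : Permutation Ω) where
  open Setoid Ω renaming (refl to ≈-refl; sym to ≈-sym; trans to ≈-trans)
  open Inverse σ using (to; from; to-cong; from-cong; strictlyInverseˡ; strictlyInverseʳ)

  power : ℤ → Carrier → Carrier
  power (pos zero)    x = x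
  power (pos (suc k)) x = to (power (pos k) x)
  power -[1+ zero ]   x = from x
  power -[1+ suc k ]  x = from (power -[1+ k ] x)

  power-cong : ∀ i {x y} → x ≈ y → power i x ≈ power i y
  power-cong (pos zero)     x≈y = x≈y
  power-cong (pos (suc k))    x≈y = to-cong (power-cong (pos k) x≈y)
  power-cong -[1+ zero ]  x≈y = from-cong x≈y
  power-cong -[1+ suc k ] x≈y = from-cong (power-cong -[1+ k ] x≈y)

  power-≡ : ∀ {i j} x → i ≡ j → power i x ≈ power j x
  power-≡ x refl = ≈-refl

  power-suc : ∀ i x → to (power i x) ≈ power (sucℤ i) x
  power-suc (pos k)        x = ≈-refl
  power-suc -[1+ zero ]  x = strictlyInverseˡ x
  power-suc -[1+ suc k ] x = strictlyInverseˡ _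

  power-pred : ∀ i x → from (power i x) ≈ power (predℤ i) x
  power-pred (pos zero)  x = ≈-refl
  power-pred (pos (suc k)) x = strictlyInverseʳ _
  power-pred -[1+ k ]  x = ≈-refl

  power-+ : ∀ i j x → power i (power j x) ≈ power (i +ℤ j) x
  power-+ (pos zero)     j x = power-≡ x (sym (ℤ.+-identityˡ j))
  power-+ (pos (suc k))    j x = ≈-trans (to-cong (power-+ (pos k) j x))
    (≈-trans (power-suc (pos k +ℤ j) x) (power-≡ x (sym (ℤ.suc-+ k j))))
  power-+ -[1+ zero ]  j x = power-pred j x
  power-+ -[1+ suc k ] j x = ≈-trans (from-cong (power-+ -[1+ k ] j x))
    (≈-trans (power-pred (-[1+ k ] +ℤ j) x) (power-≡ x (sym (ℤ.pred-+ -[1+ k ] j))))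

  SameOrbit : Carrier → Carrier → Set e
  SameOrbit x y = ∃[ i ] power i x ≈ y

  orbits : Setoid o e
  orbits = record
    { Carrier       = Carrier
    ; _≈_           = SameOrbit
    ; isEquivalence = record
      { refl  = pos 0 , ≈-refl
      ; sym   = λ {x} (i , p) → -ℤ i , ≈-trans (power-cong (-ℤ i) (≈-sym p))
                  (≈-trans (power-+ (-ℤ i) i x)
                    (power-≡ x (ℤ.+-inverseˡ i)))
      ; trans = λ {x} (i , p) (j , q) → j +ℤ i ,
                  ≈-trans (≈-sym (power-+ j i x)) (≈-trans (power-cong j p) q)
      }
    }

  -- Includes the finiteness of Ω.  There are at most |Ω| orbits, so _∸_ does
  -- not truncate.
  record HasIndex (i : ℕ) : Set (o ⊔ e) where
    field
      size        : ℕ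
      orbitCount  : ℕ
      Ω-size      : HasCardinality Ω size
      orbits-size : HasCardinality orbits orbitCount
      index       : i ≡ size ∸ orbitCount

record PermutationRepresentation (G : Group a b) (Ω : Setoid o e) : Set (a ⊔ b ⊔ o ⊔ e) where
  open Group G using (Carrier; _∙_) renaming (_≈_ to _≈ᴳ_)
  open Setoid Ω using (_≈_) renaming (Carrier to ∣Ω∣)
  field
    perm : Carrier → Permutation Ω

  infixr 8 _·_
  _·_ : Carrier → ∣Ω∣ → ∣Ω∣
  x · ω = Inverse.to (perm x) ω

  field
    perm-cong : ∀ {x y} → x ≈ᴳ y → ∀ ω → x · ω ≈ y · ω
    perm-homo : ∀ x y ω → (x ∙ y) · ω ≈ x · (y · ω)

module _ {G : Group a b} {Ω : Setoid o e} where
  open Group G using (Carrier; _∙_; ε; _⁻¹; inverseˡ; inverseʳ) renaming (_≈_ to _≈ᴳ_)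
  open Setoid Ω using (_≈_) renaming (Carrier to ∣Ω∣)

  fromAction : (act : Carrier → ∣Ω∣ → ∣Ω∣) →
               (∀ {x y} {ω τ} → x ≈ᴳ y → ω ≈ τ → act x ω ≈ act y τ) →
               (∀ ω → act ε ω ≈ ω) →
               (∀ x y ω → act (x ∙ y) ω ≈ act x (act y ω)) →
               PermutationRepresentation G Ω
  fromAction act act-cong act-ε act-∙ = record
    { perm      = λ x → record
      { to        = act x
      ; from      = act (x ⁻¹)
      ; to-cong   = act-cong (Group.refl G)
      ; from-cong = act-cong (Group.refl G)
      ; inverse   = (λ eq → ≈-trans (act-cong (Group.refl G) eq) (cancel (inverseʳ x)))
                  , (λ eq → ≈-trans (act-cong (Group.refl G) eq) (cancel (inverseˡ x)))
      }
    ; perm-cong = λ x≈y ω → act-cong x≈y ≈-refl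
    ; perm-homo = act-∙
    }
    where
    open Setoid Ω using () renaming (refl to ≈-refl; sym to ≈-sym; trans to ≈-trans)
    cancel : ∀ {x y ω} → x ∙ y ≈ᴳ ε → act x (act y ω) ≈ ω
    cancel {x} {y} {ω} p = ≈-trans (≈-sym (act-∙ x y ω)) (≈-trans (act-cong p ≈-refl) (act-ε ω))

  module _ (π : PermutationRepresentation G Ω) where
    open PermutationRepresentation π

    Faithful : Set (a ⊔ b ⊔ o ⊔ e)
    Faithful = ∀ x → (∀ ω → x · ω ≈ ω) → x ≈ᴳ ε

    Transitive : Set (a ⊔ o ⊔ e)
    Transitive = ∀ ω τ → ∃[ x ] x · ω ≈ τ

record FaithfulTransitiveRepresentation (G : Group a b) (Ω : Setoid o e) : Set (a ⊔ b ⊔ o ⊔ e) where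
  field
    representation : PermutationRepresentation G Ω
    faithful       : Faithful representation
    transitive     : Transitive representation

  open PermutationRepresentation representation public

-- The minimum over x ≠ 1 of ind(π(x)) equals m.  An index is unique when it
-- exists, so the ∃ in `minimal` only adds that every index does exist.
-- Finiteness of G is not recorded: it follows from that of Ω, as π is faithful.
record IsMalleInvariant {G : Group a b} {Ω : Setoid o e}
                        (π : FaithfulTransitiveRepresentation G Ω) (m : ℕ) : Set (a ⊔ b ⊔ o ⊔ e) where
  open Group G using (Carrier; ε; _≉_)
  open FaithfulTransitiveRepresentation π using (perm)
  field
    attained : ∃[ x ] x ≉ ε × HasIndex (perm x) m
    minimal  : ∀ x → x ≉ ε → ∃[ i ] HasIndex (perm x) i × m ≤ i

record NormalSubgroup (G : Group a b) (c : Level) : Set (a ⊔ b ⊔ lsuc c) where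
  open Group G
  field
    Member    : Carrier → Set c
    resp      : ∀ {x y} → x ≈ y → Member x → Member y
    ε-closed  : Member ε
    ∙-closed  : ∀ {x y} → Member x → Member y → Member (x ∙ y)
    ⁻¹-closed : ∀ {x} → Member x → Member (x ⁻¹)
    normal    : ∀ y {x} → Member x → Member (y ∙ x ∙ y ⁻¹)

_/ᴳ_ : (G : Group a b) → NormalSubgroup G c → Group a c
G /ᴳ N = record
  { Carrier = Carrier
  ; _≈_     = _∼_
  ; _∙_     = _∙_
  ; ε       = ε
  ; _⁻¹     = _⁻¹
  ; isGroup = record
    { isMonoid = record
      { isSemigroup = record
        { isMagma = record
          { isEquivalence = record { refl = ≈⇒∼ G.refl ; sym = ∼-sym ; trans = ∼-trans }
          ; ∙-cong        = ∼-∙-cong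
          }
        ; assoc = λ x y z → ≈⇒∼ (assoc x y z)
        }
      ; identity = (λ x → ≈⇒∼ (identityˡ x)) , (λ x → ≈⇒∼ (identityʳ x))
      }
    ; inverse = (λ x → ≈⇒∼ (inverseˡ x)) , (λ x → ≈⇒∼ (inverseʳ x))
    ; ⁻¹-cong = ∼-⁻¹-cong
    }
  }
  where
  module G = Group G
  open G using (Carrier; _≈_; _∙_; ε; _⁻¹; assoc; identityˡ; identityʳ; inverseˡ; inverseʳ; ∙-congˡ; ∙-congʳ; ∙-cong; ⁻¹-cong)
  open GroupProperties G
  open NormalSubgroup N
  open SetoidReasoning G.setoid

  _∼_ : Carrier → Carrier → Set _
  x ∼ y = Member (x ⁻¹ ∙ y)

  ≈⇒∼ : ∀ {x y} → x ≈ y → x ∼ y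
  ≈⇒∼ {x} x≈y = resp (G.trans (G.sym (inverseˡ x)) (∙-congˡ x≈y)) ε-closed

  ∼-sym : ∀ {x y} → x ∼ y → y ∼ x
  ∼-sym {x} {y} n = resp (⁻¹-anti-homo-\\ x y) (⁻¹-closed n)

  ∼-trans : ∀ {x y z} → x ∼ y → y ∼ z → x ∼ z
  ∼-trans {x} {y} {z} n n′ = resp eq (∙-closed n n′)
    where
    eq : (x ⁻¹ ∙ y) ∙ (y ⁻¹ ∙ z) ≈ x ⁻¹ ∙ z
    eq = begin
      (x ⁻¹ ∙ y) ∙ (y ⁻¹ ∙ z) ≈⟨ assoc _ _ _ ⟩
      x ⁻¹ ∙ (y ∙ (y ⁻¹ ∙ z)) ≈⟨ ∙-congˡ (\\-leftDividesˡ y z) ⟩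
      x ⁻¹ ∙ z                ∎

  ∼-∙-cong : ∀ {x y u v} → x ∼ y → u ∼ v → (x ∙ u) ∼ (y ∙ v)
  ∼-∙-cong {x} {y} {u} {v} n n′ = resp eq (∙-closed (normal (u ⁻¹) n) n′)
    where
    eq : ((u ⁻¹ ∙ (x ⁻¹ ∙ y)) ∙ u ⁻¹ ⁻¹) ∙ (u ⁻¹ ∙ v) ≈ (x ∙ u) ⁻¹ ∙ (y ∙ v)
    eq = begin
      ((u ⁻¹ ∙ (x ⁻¹ ∙ y)) ∙ u ⁻¹ ⁻¹) ∙ (u ⁻¹ ∙ v) ≈⟨ assoc _ _ _ ⟩
      (u ⁻¹ ∙ (x ⁻¹ ∙ y)) ∙ (u ⁻¹ ⁻¹ ∙ (u ⁻¹ ∙ v)) ≈⟨ ∙-congˡ (\\-leftDividesʳ (u ⁻¹) v) ⟩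
      (u ⁻¹ ∙ (x ⁻¹ ∙ y)) ∙ v                      ≈⟨ ∙-congʳ (assoc _ _ _) ⟨
      ((u ⁻¹ ∙ x ⁻¹) ∙ y) ∙ v                      ≈⟨ assoc _ _ _ ⟩
      (u ⁻¹ ∙ x ⁻¹) ∙ (y ∙ v)                      ≈⟨ ∙-congʳ (⁻¹-anti-homo-∙ x u) ⟨
      (x ∙ u) ⁻¹ ∙ (y ∙ v)                         ∎

  ∼-⁻¹-cong : ∀ {x y} → x ∼ y → (x ⁻¹) ∼ (y ⁻¹)
  ∼-⁻¹-cong {x} {y} n = resp eq (normal y (∼-sym n))
    where
    eq : (y ∙ (y ⁻¹ ∙ x)) ∙ y ⁻¹ ≈ x ⁻¹ ⁻¹ ∙ y ⁻¹
    eq = ∙-congʳ (G.trans (\\-leftDividesˡ y x) (G.sym (⁻¹-involutive x)))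

module ResidueRing (n : ℕ) .{{_ : NonZero n}} where
  open Nat using (_+_; _*_)

  infix  8 ⊖_
  infixl 6 _⊕_
  infixl 7 _⊗_

  _⊕_ _⊗_ : Fin n → Fin n → Fin n
  x ⊕ y = (toℕ x + toℕ y) mod n
  x ⊗ y = (toℕ x * toℕ y) mod n

  ⊖_ : Fin n → Fin n
  ⊖ x = (n ∸ toℕ x) mod n

  toℕ-mod : ∀ k → toℕ (k mod n) ≡ k % n
  toℕ-mod k = toℕ-fromℕ< (m%n<n k n)

  mod-toℕ : ∀ x → toℕ x mod n ≡ x
  mod-toℕ x = toℕ-injective (trans (toℕ-mod (toℕ x)) (m<n⇒m%n≡m (toℕ<n x)))

  mod-cong : ∀ {k m} → k % n ≡ m % n → k mod n ≡ m mod n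
  mod-cong {k} {m} eq = toℕ-injective (trans (toℕ-mod k) (trans eq (sym (toℕ-mod m))))

  mod-⊕ : ∀ k m → (k mod n) ⊕ (m mod n) ≡ (k + m) mod n
  mod-⊕ k m = trans (cong₂ (λ u v → (u + v) mod n) (toℕ-mod k) (toℕ-mod m))
                    (mod-cong (sym (%-distribˡ-+ k m n)))

  mod-⊗ : ∀ k m → (k mod n) ⊗ (m mod n) ≡ (k * m) mod n
  mod-⊗ k m = trans (cong₂ (λ u v → (u * v) mod n) (toℕ-mod k) (toℕ-mod m))
                    (mod-cong (sym (%-distribˡ-* k m n)))

  private
    open ≡-Reasoning

    ⊕ˡ : ∀ k x → (k mod n) ⊕ x ≡ (k + toℕ x) mod n
    ⊕ˡ k x = trans (cong ((k mod n) ⊕_) (sym (mod-toℕ x))) (mod-⊕ k (toℕ x))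

    ⊗ˡ : ∀ k x → (k mod n) ⊗ x ≡ (k * toℕ x) mod n
    ⊗ˡ k x = trans (cong ((k mod n) ⊗_) (sym (mod-toℕ x))) (mod-⊗ k (toℕ x))

    ⊕-comm : ∀ x y → x ⊕ y ≡ y ⊕ x
    ⊕-comm x y = cong (_mod n) (ℕ.+-comm (toℕ x) (toℕ y))

    ⊗-comm : ∀ x y → x ⊗ y ≡ y ⊗ x
    ⊗-comm x y = cong (_mod n) (ℕ.*-comm (toℕ x) (toℕ y))

    ⊕-assoc : ∀ x y z → (x ⊕ y) ⊕ z ≡ x ⊕ (y ⊕ z)
    ⊕-assoc x y z = begin
      (x ⊕ y) ⊕ z                     ≡⟨ ⊕ˡ (toℕ x + toℕ y) z ⟩
      (toℕ x + toℕ y + toℕ z) mod n   ≡⟨ cong (_mod n) (ℕ.+-assoc (toℕ x) (toℕ y) (toℕ z)) ⟩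
      (toℕ x + (toℕ y + toℕ z)) mod n ≡⟨ cong (_mod n) (ℕ.+-comm (toℕ x) _) ⟩
      (toℕ y + toℕ z + toℕ x) mod n   ≡⟨ ⊕ˡ (toℕ y + toℕ z) x ⟨
      (y ⊕ z) ⊕ x                     ≡⟨ ⊕-comm (y ⊕ z) x ⟩
      x ⊕ (y ⊕ z)                     ∎

    ⊗-assoc : ∀ x y z → (x ⊗ y) ⊗ z ≡ x ⊗ (y ⊗ z)
    ⊗-assoc x y z = begin
      (x ⊗ y) ⊗ z                     ≡⟨ ⊗ˡ (toℕ x * toℕ y) z ⟩
      (toℕ x * toℕ y * toℕ z) mod n   ≡⟨ cong (_mod n) (ℕ.*-assoc (toℕ x) (toℕ y) (toℕ z)) ⟩
      (toℕ x * (toℕ y * toℕ z)) mod n ≡⟨ cong (_mod n) (ℕ.*-comm (toℕ x) _) ⟩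
      (toℕ y * toℕ z * toℕ x) mod n   ≡⟨ ⊗ˡ (toℕ y * toℕ z) x ⟨
      (y ⊗ z) ⊗ x                     ≡⟨ ⊗-comm (y ⊗ z) x ⟩
      x ⊗ (y ⊗ z)                     ∎

    ⊕-identityˡ : ∀ x → 0 mod n ⊕ x ≡ x
    ⊕-identityˡ x = trans (⊕ˡ 0 x) (mod-toℕ x)

    ⊗-identityˡ : ∀ x → (1 mod n) ⊗ x ≡ x
    ⊗-identityˡ x = trans (⊗ˡ 1 x) (trans (cong (_mod n) (ℕ.*-identityˡ (toℕ x))) (mod-toℕ x))

    ⊖-inverseˡ : ∀ x → ⊖ x ⊕ x ≡ 0 mod n
    ⊖-inverseˡ x = begin
      ⊖ x ⊕ x                     ≡⟨ ⊕ˡ (n ∸ toℕ x) x ⟩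
      (n ∸ toℕ x + toℕ x) mod n   ≡⟨ cong (_mod n) (ℕ.m∸n+n≡m (ℕ.<⇒≤ (toℕ<n x))) ⟩
      n mod n                     ≡⟨ mod-cong (trans (n%n≡0 n) (sym (m<n⇒m%n≡m (>-nonZero⁻¹ n)))) ⟩
      0 mod n                     ∎

    ⊗-distribʳ : ∀ x y z → (y ⊕ z) ⊗ x ≡ y ⊗ x ⊕ z ⊗ x
    ⊗-distribʳ x y z = begin
      (y ⊕ z) ⊗ x                               ≡⟨ ⊗ˡ (toℕ y + toℕ z) x ⟩
      ((toℕ y + toℕ z) * toℕ x) mod n           ≡⟨ cong (_mod n) (ℕ.*-distribʳ-+ (toℕ x) (toℕ y) (toℕ z)) ⟩
      (toℕ y * toℕ x + toℕ z * toℕ x) mod n     ≡⟨ mod-⊕ (toℕ y * toℕ x) (toℕ z * toℕ x) ⟨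
      y ⊗ x ⊕ z ⊗ x                             ∎

    comm∧ˡ⇒ʳ : ∀ {_∙_ : Fin n → Fin n → Fin n} {u : Fin n → Fin n} {v : Fin n → Fin n} →
               (∀ x y → x ∙ y ≡ y ∙ x) → (∀ x → u x ∙ x ≡ v x) → ∀ x → x ∙ u x ≡ v x
    comm∧ˡ⇒ʳ comm eq x = trans (comm x _) (eq x)

  ring : CommutativeRing 0ℓ 0ℓ
  ring = record
    { Carrier = Fin n
    ; _≈_     = _≡_
    ; _+_     = _⊕_
    ; _*_     = _⊗_
    ; -_      = ⊖_
    ; 0#      = 0 mod n
    ; 1#      = 1 mod n
    ; isCommutativeRing = record
      { isRing = record
        { +-isAbelianGroup = record
          { isGroup = record
            { isMonoid = record
              { isSemigroup = record
                { isMagma = record { isEquivalence = isEquivalence ; ∙-cong = cong₂ _⊕_ }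
                ; assoc = ⊕-assoc
                }
              ; identity = ⊕-identityˡ , comm∧ˡ⇒ʳ ⊕-comm ⊕-identityˡ
              }
            ; inverse = ⊖-inverseˡ , comm∧ˡ⇒ʳ ⊕-comm ⊖-inverseˡ
            ; ⁻¹-cong = cong ⊖_
            }
          ; comm = ⊕-comm
          }
        ; *-cong = cong₂ _⊗_
        ; *-assoc = ⊗-assoc
        ; *-identity = ⊗-identityˡ , comm∧ˡ⇒ʳ ⊗-comm ⊗-identityˡ
        ; distrib = (λ x y z → trans (⊗-comm x (y ⊕ z))
                        (trans (⊗-distribʳ x y z) (cong₂ _⊕_ (⊗-comm y x) (⊗-comm z x))))
                  , ⊗-distribʳ
        }
      ; *-comm = ⊗-comm
      }
    }

𝔽 : ∀ {ℓ} → Prime ℓ → CommutativeRing 0ℓ 0ℓ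
𝔽 {ℓ} ℓ-prime = ResidueRing.ring ℓ {{prime⇒nonZero ℓ-prime}}

module _ {ℓ} (ℓ-prime : Prime ℓ) where
  private
    instance
      ℓ≢0 : NonZero ℓ
      ℓ≢0 = prime⇒nonZero ℓ-prime

  open CommutativeRing (𝔽 ℓ-prime) using (Carrier; 0#; 1#; *-identityˡ; *-assoc; zeroʳ) renaming (_*_ to _·_)
  open RingProperties (CommutativeRing.ring (𝔽 ℓ-prime)) using (-‿distribˡ-*)
  open GroupProperties (CommutativeRing.+-group (𝔽 ℓ-prime)) using (inverseˡ-unique)
  open ResidueRing ℓ
  open Nat using (_+_; _*_)
  open ≡-Reasoning

  -- Abstract so that conversion checking never unfolds Bézout's algorithm.
  abstract
    𝔽-inverse : ∀ x → x ≢ 0# → ∃[ y ] y · x ≡ 1#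
    𝔽-inverse x x≢0 = inv (coprime-Bézout (prime⇒coprime ℓ-prime {{≢-nonZero toℕx≢0}} (toℕ<n x)))
      where
      toℕx≢0 : toℕ x ≢ 0
      toℕx≢0 eq = x≢0 (trans (sym (mod-toℕ x)) (cong (_mod ℓ) eq))

      multiple : ∀ k → (k * ℓ) mod ℓ ≡ 0#
      multiple k = mod-cong ([m+kn]%n≡m%n 0 k ℓ)

      mod-· : ∀ k → (k * toℕ x) mod ℓ ≡ (k mod ℓ) · x
      mod-· k = trans (sym (mod-⊗ k (toℕ x))) (cong ((k mod ℓ) ⊗_) (mod-toℕ x))

      inv : Bézout.Identity 1 ℓ (toℕ x) → ∃[ y ] y · x ≡ 1#
      inv (Bézout.+- k m eq) = ⊖ (m mod ℓ) , (begin
        ⊖ (m mod ℓ) · x   ≡⟨ -‿distribˡ-* (m mod ℓ) x ⟨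
        ⊖ ((m mod ℓ) · x) ≡⟨ inverseˡ-unique 1# ((m mod ℓ) · x) (begin
          1# ⊕ (m mod ℓ) · x                ≡⟨ cong (1# ⊕_) (mod-· m) ⟨
          1# ⊕ (m * toℕ x) mod ℓ            ≡⟨ mod-⊕ 1 (m * toℕ x) ⟩
          (1 + m * toℕ x) mod ℓ             ≡⟨ cong (_mod ℓ) eq ⟩
          (k * ℓ) mod ℓ                     ≡⟨ multiple k ⟩
          0#                                ∎) ⟨
        1#                ∎)
      inv (Bézout.-+ k m eq) = m mod ℓ , (begin
        (m mod ℓ) · x         ≡⟨ mod-· m ⟨
        (m * toℕ x) mod ℓ     ≡⟨ cong (_mod ℓ) eq ⟨
        (1 + k * ℓ) mod ℓ     ≡⟨ mod-cong ([m+kn]%n≡m%n 1 k ℓ) ⟩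
        1#                    ∎)

  𝔽-noZeroDivisors : ∀ {x y} → x ≢ 0# → y ≢ 0# → x · y ≢ 0#
  𝔽-noZeroDivisors {x} {y} x≢0 y≢0 xy≡0 with 𝔽-inverse x x≢0
  ... | x⁻¹ , x⁻¹x≡1 = y≢0 (begin
    y               ≡⟨ *-identityˡ y ⟨
    1# · y          ≡⟨ cong (_· y) x⁻¹x≡1 ⟨
    (x⁻¹ · x) · y   ≡⟨ *-assoc x⁻¹ x y ⟩
    x⁻¹ · (x · y)   ≡⟨ cong (x⁻¹ ·_) xy≡0 ⟩
    x⁻¹ · 0#        ≡⟨ zeroʳ x⁻¹ ⟩
    0#              ∎)

  𝔽-1≢0 : 1# ≢ 0#
  𝔽-1≢0 1≡0 with () ← trans (sym (m<n⇒m%n≡m (nonTrivial⇒n>1 ℓ {{prime⇒nonTrivial ℓ-prime}})))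
    (trans (sym (toℕ-mod 1)) (trans (cong toℕ 1≡0) (trans (toℕ-mod 0) (m<n⇒m%n≡m (>-nonZero⁻¹ ℓ)))))

  VectorSpace : ∀ a b → Set (lsuc (a ⊔ b))
  VectorSpace = LeftModule (CommutativeRing.ring (𝔽 ℓ-prime))

module _ {R : Ring c e} (M : LeftModule R a b) where
  open Ring R using (Carrier; 0#) renaming (_≈_ to _≈ᴿ_)
  open LeftModule M
  open MonoidSum +ᴹ-monoid using (sum)

  linearCombination : ∀ {d} → Vector Carrier d → Vector Carrierᴹ d → Carrierᴹ
  linearCombination coeff v = sum (λ i → coeff i *ₗ v i)

  record IsBasis {d} (v : Vector Carrierᴹ d) : Set (a ⊔ b ⊔ c ⊔ e) where
    field
      independent : ∀ coeff → linearCombination coeff v ≈ᴹ 0ᴹ → ∀ i → coeff i ≈ᴿ 0#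
      spanning    : ∀ x → ∃[ coeff ] linearCombination coeff v ≈ᴹ x

-- The dimension is 2n; the choice of basis is data but nothing depends on it.
record SymplecticSpace {ℓ} (ℓ-prime : Prime ℓ) (n : ℕ) (a b : Level) : Set (lsuc (a ⊔ b)) where
  field
    vectorSpace : VectorSpace ℓ-prime a b

  open CommutativeRing (𝔽 ℓ-prime) public hiding (refl; sym; trans; isEquivalence; zero)
  open LeftModule vectorSpace public

  field
    basis   : Vector Carrierᴹ (2 Nat.* n)
    isBasis : IsBasis vectorSpace basis
    ⟪_,_⟫   : Carrierᴹ → Carrierᴹ → Carrier
    ⟪⟫-cong : ∀ {x x′ y y′} → x ≈ᴹ x′ → y ≈ᴹ y′ → ⟪ x , y ⟫ ≈ ⟪ x′ , y′ ⟫
    ⟪⟫-+ˡ   : ∀ x y z → ⟪ x +ᴹ y , z ⟫ ≈ ⟪ x , z ⟫ + ⟪ y , z ⟫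
    ⟪⟫-*ˡ   : ∀ k x y → ⟪ k *ₗ x , y ⟫ ≈ k * ⟪ x , y ⟫
    ⟪⟫-+ʳ   : ∀ x y z → ⟪ x , y +ᴹ z ⟫ ≈ ⟪ x , y ⟫ + ⟪ x , z ⟫
    ⟪⟫-*ʳ   : ∀ k x y → ⟪ x , k *ₗ y ⟫ ≈ k * ⟪ x , y ⟫
    alternating   : ∀ x → ⟪ x , x ⟫ ≈ 0#
    nondegenerate : ∀ x → (∀ y → ⟪ x , y ⟫ ≈ 0#) → x ≈ᴹ 0ᴹ

  open IsBasis isBasis public

module _ {ℓ} {ℓ-prime : Prime ℓ} {n} (V : SymplecticSpace ℓ-prime n a b) where
  open SymplecticSpace V

  record Similitude : Set (a ⊔ b) where
    field
      to                   : Carrierᴹ → Carrierᴹ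
      isLinearAutomorphism : IsLeftModuleIsomorphism rawLeftModule rawLeftModule to
      multiplier           : Carrier
      multiplier≉0         : multiplier ≉ 0#
      ⟪⟫-scaled            : ∀ x y → ⟪ to x , to y ⟫ ≈ multiplier * ⟪ x , y ⟫

    open IsLeftModuleIsomorphism isLinearAutomorphism public
      using (⟦⟧-cong; +ᴹ-homo; *ₗ-homo; 0ᴹ-homo; injective; surjective)

  open Similitude using (to)

  private
    module F = SetoidReasoning setoid
    module E = SetoidReasoning ≈ᴹ-setoid
    open RingProperties ring using (-‿distribʳ-*)
    open AbelianGroupProperties +-abelianGroup using (inverseˡ-unique)

    inverse* : ∀ k → k ≉ 0# → ∃[ k′ ] k′ * k ≈ 1#
    inverse* = 𝔽-inverse ℓ-prime

    noZeroDivisors : ∀ h k → h ≉ 0# → k ≉ 0# → h * k ≉ 0#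
    noZeroDivisors h k = 𝔽-noZeroDivisors ℓ-prime

    *-cancelˡ : ∀ h k → h * k ≈ 1# → ∀ r → h * (k * r) ≈ r
    *-cancelˡ h k hk≈1 r = trans (sym (*-assoc h k r)) (trans (cong (_* r) hk≈1) (*-identityˡ r))

    *ₗ-cancelˡ : ∀ h k → h * k ≈ 1# → ∀ x → h *ₗ (k *ₗ x) ≈ᴹ x
    *ₗ-cancelˡ h k hk≈1 x = ≈ᴹ-trans (≈ᴹ-sym (*ₗ-assoc h k x)) (≈ᴹ-trans (*ₗ-congʳ hk≈1) (*ₗ-identityˡ x))

    unit≉0 : ∀ h k → h * k ≈ 1# → h ≉ 0#
    unit≉0 h k hk≈1 h≈0 = 𝔽-1≢0 ℓ-prime (trans (sym hk≈1) (trans (cong (_* k) h≈0) (zeroˡ k)))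

    isHomomorphism : (f : Carrierᴹ → Carrierᴹ) → (∀ {x y} → x ≈ᴹ y → f x ≈ᴹ f y) →
                     (∀ x y → f (x +ᴹ y) ≈ᴹ f x +ᴹ f y) → (∀ k x → f (k *ₗ x) ≈ᴹ k *ₗ f x) →
                     IsLeftModuleHomomorphism rawLeftModule rawLeftModule f
    isHomomorphism f f-cong f-+ f-* = record
      { +ᴹ-isGroupHomomorphism = record
        { isMonoidHomomorphism = record
          { isMagmaHomomorphism = record
            { isRelHomomorphism = record { cong = f-cong }
            ; homo = f-+
            }
          ; ε-homo = f-0
          }
        ; ⁻¹-homo = λ x → AbelianGroupProperties.inverseˡ-unique +ᴹ-abelianGroup (f (-ᴹ x)) (f x)
            (≈ᴹ-trans (≈ᴹ-sym (f-+ (-ᴹ x) x)) (≈ᴹ-trans (f-cong (-ᴹ‿inverseˡ x)) f-0))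
        }
      ; *ₗ-homo = f-*
      }
      where
      f-0 : f 0ᴹ ≈ᴹ 0ᴹ
      f-0 = ≈ᴹ-trans (f-cong (≈ᴹ-sym (*ₗ-zeroˡ 0ᴹ))) (≈ᴹ-trans (f-* 0# 0ᴹ) (*ₗ-zeroˡ (f 0ᴹ)))

    isAutomorphism : (f f⁻¹ : Carrierᴹ → Carrierᴹ) → IsLeftModuleHomomorphism rawLeftModule rawLeftModule f →
                     (∀ {x y} → x ≈ᴹ y → f⁻¹ x ≈ᴹ f⁻¹ y) →
                     (∀ x → f (f⁻¹ x) ≈ᴹ x) → (∀ x → f⁻¹ (f x) ≈ᴹ x) →
                     IsLeftModuleIsomorphism rawLeftModule rawLeftModule f
    isAutomorphism f f⁻¹ f-homo f⁻¹-cong f∘f⁻¹ f⁻¹∘f = record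
      { isLeftModuleMonomorphism = record
        { isLeftModuleHomomorphism = f-homo
        ; injective = λ {x} {y} eq → ≈ᴹ-trans (≈ᴹ-sym (f⁻¹∘f x)) (≈ᴹ-trans (f⁻¹-cong eq) (f⁻¹∘f y))
        }
      ; surjective = λ y → f⁻¹ y , λ z≈ → ≈ᴹ-trans (IsLeftModuleHomomorphism.⟦⟧-cong f-homo z≈) (f∘f⁻¹ y)
      }

  module _ (f : Similitude) where
    open Similitude f renaming (to to f⟨_⟩)

    private
      f⁻¹ : Carrierᴹ → Carrierᴹ
      f⁻¹ y = proj₁ (surjective y)

      f∘f⁻¹ : ∀ y → f⟨ f⁻¹ y ⟩ ≈ᴹ y
      f∘f⁻¹ y = proj₂ (surjective y) ≈ᴹ-refl

      f⁻¹∘f : ∀ x → f⁻¹ f⟨ x ⟩ ≈ᴹ x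
      f⁻¹∘f x = injective (f∘f⁻¹ f⟨ x ⟩)

      f⁻¹-cong : ∀ {x y} → x ≈ᴹ y → f⁻¹ x ≈ᴹ f⁻¹ y
      f⁻¹-cong {x} {y} x≈y = injective (≈ᴹ-trans (f∘f⁻¹ x) (≈ᴹ-trans x≈y (≈ᴹ-sym (f∘f⁻¹ y))))

      μ⁻¹ : Carrier
      μ⁻¹ = proj₁ (inverse* multiplier multiplier≉0)

      μ⁻¹μ : μ⁻¹ * multiplier ≈ 1#
      μ⁻¹μ = proj₂ (inverse* multiplier multiplier≉0)

    inverse : Similitude
    inverse = record
      { to = f⁻¹
      ; isLinearAutomorphism = isAutomorphism f⁻¹ f⟨_⟩
          (isHomomorphism f⁻¹ f⁻¹-cong
            (λ x y → injective (≈ᴹ-trans (f∘f⁻¹ (x +ᴹ y)) (≈ᴹ-sym (≈ᴹ-trans (+ᴹ-homo (f⁻¹ x) (f⁻¹ y)) (+ᴹ-cong (f∘f⁻¹ x) (f∘f⁻¹ y))))))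
            (λ k x → injective (≈ᴹ-trans (f∘f⁻¹ (k *ₗ x)) (≈ᴹ-sym (≈ᴹ-trans (*ₗ-homo k (f⁻¹ x)) (*ₗ-congˡ (f∘f⁻¹ x)))))))
          ⟦⟧-cong f⁻¹∘f f∘f⁻¹
      ; multiplier = μ⁻¹
      ; multiplier≉0 = unit≉0 μ⁻¹ multiplier μ⁻¹μ
      ; ⟪⟫-scaled = λ x y → F.begin
          ⟪ f⁻¹ x , f⁻¹ y ⟫                           F.≈⟨ *-cancelˡ μ⁻¹ multiplier μ⁻¹μ _ ⟨
          μ⁻¹ * (multiplier * ⟪ f⁻¹ x , f⁻¹ y ⟫)      F.≈⟨ cong (μ⁻¹ *_) (⟪⟫-scaled (f⁻¹ x) (f⁻¹ y)) ⟨
          μ⁻¹ * ⟪ f⟨ f⁻¹ x ⟩ , f⟨ f⁻¹ y ⟩ ⟫           F.≈⟨ cong (μ⁻¹ *_) (⟪⟫-cong (f∘f⁻¹ x) (f∘f⁻¹ y)) ⟩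
          μ⁻¹ * ⟪ x , y ⟫                             F.∎
      }

    inverse-right : ∀ x → f⟨ to inverse x ⟩ ≈ᴹ x
    inverse-right = f∘f⁻¹

    inverse-left : ∀ x → to inverse f⟨ x ⟩ ≈ᴹ x
    inverse-left = f⁻¹∘f

  identity-similitude : Similitude
  identity-similitude = record
    { to = id
    ; isLinearAutomorphism = Identity.isLeftModuleIsomorphism rawLeftModule ≈ᴹ-refl
    ; multiplier = 1#
    ; multiplier≉0 = 𝔽-1≢0 ℓ-prime
    ; ⟪⟫-scaled = λ x y → sym (*-identityˡ ⟪ x , y ⟫)
    }

  _∘ˢ_ : Similitude → Similitude → Similitude
  f ∘ˢ h = record
    { to = to f ∘ to h
    ; isLinearAutomorphism = Composition.isLeftModuleIsomorphism ≈ᴹ-trans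
        (Similitude.isLinearAutomorphism h) (Similitude.isLinearAutomorphism f)
    ; multiplier = f.multiplier * h.multiplier
    ; multiplier≉0 = noZeroDivisors f.multiplier h.multiplier f.multiplier≉0 h.multiplier≉0
    ; ⟪⟫-scaled = λ x y → trans (f.⟪⟫-scaled (to h x) (to h y))
        (trans (cong (f.multiplier *_) (h.⟪⟫-scaled x y)) (sym (*-assoc f.multiplier h.multiplier ⟪ x , y ⟫)))
    }
    where
    module f = Similitude f
    module h = Similitude h

  -- Equality compares only the underlying maps, so the multiplier is a property
  -- of an element rather than extra data.
  GSp : Group (a ⊔ b) (a ⊔ b)
  GSp = record
    { Carrier = Similitude
    ; _≈_     = λ f h → ∀ x → to f x ≈ᴹ to h x
    ; _∙_     = _∘ˢ_
    ; ε       = identity-similitude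
    ; _⁻¹     = inverse
    ; isGroup = record
      { isMonoid = record
        { isSemigroup = record
          { isMagma = record
            { isEquivalence = record
              { refl  = λ x → ≈ᴹ-refl
              ; sym   = λ p x → ≈ᴹ-sym (p x)
              ; trans = λ p q x → ≈ᴹ-trans (p x) (q x)
              }
            ; ∙-cong = λ {f} {f′} {h} {h′} p q x → ≈ᴹ-trans (Similitude.⟦⟧-cong f (q x)) (p (to h′ x))
            }
          ; assoc = λ f h k x → ≈ᴹ-refl
          }
        ; identity = (λ f x → ≈ᴹ-refl) , (λ f x → ≈ᴹ-refl)
        }
      ; inverse = inverse-left , inverse-right
      ; ⁻¹-cong = λ {f} {h} p x → Similitude.injective f
          (≈ᴹ-trans (inverse-right f x) (≈ᴹ-trans (≈ᴹ-sym (inverse-right h x)) (≈ᴹ-sym (p (to (inverse h) x)))))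
      }
    }

  IsScalar : Similitude → Set (a ⊔ b)
  IsScalar f = ∃[ k ] k ≉ 0# × (∀ x → to f x ≈ᴹ k *ₗ x)

  scalars : NormalSubgroup GSp (a ⊔ b)
  scalars = record
    { Member    = IsScalar
    ; resp      = λ p (k , k≉0 , q) → k , k≉0 , λ x → ≈ᴹ-trans (≈ᴹ-sym (p x)) (q x)
    ; ε-closed  = 1# , 𝔽-1≢0 ℓ-prime , λ x → ≈ᴹ-sym (*ₗ-identityˡ x)
    ; ∙-closed  = λ {f} {h} (k , k≉0 , p) (r , r≉0 , q) → k * r , noZeroDivisors k r k≉0 r≉0 ,
        λ x → ≈ᴹ-trans (p (to h x)) (≈ᴹ-trans (*ₗ-congˡ (q x)) (≈ᴹ-sym (*ₗ-assoc k r x)))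
    ; ⁻¹-closed = λ {f} (k , k≉0 , p) → let (k⁻¹ , k⁻¹k≈1) = inverse* k k≉0 in
        k⁻¹ , unit≉0 k⁻¹ k k⁻¹k≈1 , λ x → ≈ᴹ-trans (≈ᴹ-sym (*ₗ-cancelˡ k⁻¹ k k⁻¹k≈1 (to (inverse f) x)))
          (*ₗ-congˡ (≈ᴹ-trans (≈ᴹ-sym (p (to (inverse f) x))) (inverse-right f x)))
    ; normal    = λ h {f} (k , k≉0 , p) → k , k≉0 , λ x →
        ≈ᴹ-trans (Similitude.⟦⟧-cong h (p (to (inverse h) x)))
          (≈ᴹ-trans (Similitude.*ₗ-homo h k (to (inverse h) x)) (*ₗ-congˡ (inverse-right h x)))
    }

  PGSp : Group (a ⊔ b) (a ⊔ b)
  PGSp = GSp /ᴳ scalars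

  V∖0 : Setoid (a ⊔ b) b
  V∖0 = record
    { Carrier       = ∃[ x ] x ≉ᴹ 0ᴹ
    ; _≈_           = λ x y → proj₁ x ≈ᴹ proj₁ y
    ; isEquivalence = record { refl = ≈ᴹ-refl ; sym = ≈ᴹ-sym ; trans = ≈ᴹ-trans }
    }

  -- The one-dimensional subspace spanned by a nonzero vector.
  record Line : Set (a ⊔ b) where
    constructor line
    field
      generator   : Carrierᴹ
      generator≉0 : generator ≉ᴹ 0ᴹ

  open Line

  _∈_ : Carrierᴹ → Line → Set b
  x ∈ L = ∃[ k ] x ≈ᴹ k *ₗ generator L

  -- Lines are subsets of V: they are equal when they have the same elements,
  -- whatever their generators.
  P[V] : Setoid (a ⊔ b) (a ⊔ b)
  P[V] = record
    { Carrier       = Line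
    ; _≈_           = λ L M → ∀ x → x ∈ L ⇔ x ∈ M
    ; isEquivalence = record
      { refl  = λ x → mk⇔ id id
      ; sym   = λ p x → mk⇔ (Equivalence.from (p x)) (Equivalence.to (p x))
      ; trans = λ p q x → mk⇔ (Equivalence.to (q x) ∘ Equivalence.to (p x))
                              (Equivalence.from (p x) ∘ Equivalence.from (q x))
      }
    }

  open Setoid P[V] using () renaming (_≈_ to _≈ᴸ_)

  generator-∈ : ∀ L → generator L ∈ L
  generator-∈ L = 1# , ≈ᴹ-sym (*ₗ-identityˡ _)

  generator-∈⇒≈ : ∀ L M → generator L ∈ M → L ≈ᴸ M
  generator-∈⇒≈ (line u u≉0) (line v v≉0) (k , u≈kv) x = mk⇔
    (λ (r , x≈ru) → r * k , ≈ᴹ-trans x≈ru (≈ᴹ-trans (*ₗ-congˡ u≈kv) (≈ᴹ-sym (*ₗ-assoc r k v))))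
    (λ (r , x≈rv) → r * k⁻¹ , ≈ᴹ-trans x≈rv (≈ᴹ-trans
        (*ₗ-congˡ (≈ᴹ-trans (≈ᴹ-sym (*ₗ-cancelˡ k⁻¹ k k⁻¹k≈1 v)) (*ₗ-congˡ (≈ᴹ-sym u≈kv))))
        (≈ᴹ-sym (*ₗ-assoc r k⁻¹ u))))
    where
    k≉0 : k ≉ 0#
    k≉0 k≈0 = u≉0 (≈ᴹ-trans u≈kv (≈ᴹ-trans (*ₗ-congʳ k≈0) (*ₗ-zeroˡ v)))
    k⁻¹ : Carrier
    k⁻¹ = proj₁ (inverse* k k≉0)
    k⁻¹k≈1 : k⁻¹ * k ≈ 1#
    k⁻¹k≈1 = proj₂ (inverse* k k≉0)

  image≉0 : ∀ f {x} → x ≉ᴹ 0ᴹ → to f x ≉ᴹ 0ᴹ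
  image≉0 f x≉0 fx≈0 = x≉0 (Similitude.injective f (≈ᴹ-trans fx≈0 (≈ᴹ-sym (Similitude.0ᴹ-homo f))))

  actVec : Similitude → Setoid.Carrier V∖0 → Setoid.Carrier V∖0
  actVec f (x , x≉0) = to f x , image≉0 f x≉0

  -- The image of the line spanned by v is the line spanned by f v.
  actLine : Similitude → Line → Line
  actLine f (line v v≉0) = line (to f v) (image≉0 f v≉0)

  πvec-action : PermutationRepresentation GSp V∖0
  πvec-action = fromAction actVec
    (λ {f} {h} {x} {y} f≈h x≈y → ≈ᴹ-trans (Similitude.⟦⟧-cong f x≈y) (f≈h (proj₁ y)))
    (λ x → ≈ᴹ-refl)
    (λ f h x → ≈ᴹ-refl)

  πproj-action : PermutationRepresentation PGSp P[V]
  πproj-action = fromAction actLine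
    (λ {f} {h} {L} {M} f∼h L≈M → generator-∈⇒≈ (actLine f L) (actLine h M) (cong-∈ f h L M f∼h L≈M))
    (λ L → Setoid.refl P[V] {L})
    (λ f h L → Setoid.refl P[V] {actLine f (actLine h L)})
    where
    cong-∈ : ∀ f h L M → IsScalar (inverse f ∘ˢ h) → L ≈ᴸ M → generator (actLine f L) ∈ actLine h M
    cong-∈ f h (line u _) M@(line v _) (r , r≉0 , f⁻¹h≈r) L≈M
      with Equivalence.to (L≈M u) (1# , ≈ᴹ-sym (*ₗ-identityˡ u)) | inverse* r r≉0
    ... | k , u≈kv | r⁻¹ , r⁻¹r≈1 = k * r⁻¹ , (E.begin
      to f u                        E.≈⟨ Similitude.⟦⟧-cong f u≈kv ⟩
      to f (k *ₗ v)                 E.≈⟨ Similitude.*ₗ-homo f k v ⟩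
      k *ₗ to f v                   E.≈⟨ *ₗ-congˡ fv ⟩
      k *ₗ (r⁻¹ *ₗ to h v)          E.≈⟨ *ₗ-assoc k r⁻¹ (to h v) ⟨
      (k * r⁻¹) *ₗ to h v           E.∎)
      where
      fv : to f v ≈ᴹ r⁻¹ *ₗ to h v
      fv = E.begin
        to f v                            E.≈⟨ *ₗ-cancelˡ r⁻¹ r r⁻¹r≈1 (to f v) ⟨
        r⁻¹ *ₗ (r *ₗ to f v)              E.≈⟨ *ₗ-congˡ (Similitude.*ₗ-homo f r v) ⟨
        r⁻¹ *ₗ to f (r *ₗ v)              E.≈⟨ *ₗ-congˡ (Similitude.⟦⟧-cong f (f⁻¹h≈r v)) ⟨
        r⁻¹ *ₗ to f (to (inverse f) (to h v)) E.≈⟨ *ₗ-congˡ (inverse-right f (to h v)) ⟩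
        r⁻¹ *ₗ to h v                     E.∎

  private
    _≈0? : ∀ k → Dec (k ≈ 0#)
    k ≈0? = k Fin.≟ 0#

    *-cancelʳ-≉0 : ∀ {r} h k → r ≉ 0# → h * r ≈ k * r → h ≈ k
    *-cancelʳ-≉0 {r} h k r≉0 hr≈kr = let (r⁻¹ , r⁻¹r≈1) = inverse* r r≉0 in F.begin
      h               F.≈⟨ *-cancelˡ r⁻¹ r r⁻¹r≈1 h ⟨
      r⁻¹ * (r * h)   F.≈⟨ cong (r⁻¹ *_) (trans (*-comm r h) (trans hr≈kr (*-comm k r))) ⟩
      r⁻¹ * (r * k)   F.≈⟨ *-cancelˡ r⁻¹ r r⁻¹r≈1 k ⟩
      k               F.∎

    ⟪⟫-zeroʳ : ∀ x → ⟪ x , 0ᴹ ⟫ ≈ 0#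
    ⟪⟫-zeroʳ x = trans (⟪⟫-cong ≈ᴹ-refl (≈ᴹ-sym (*ₗ-zeroˡ 0ᴹ))) (trans (⟪⟫-*ʳ 0# x 0ᴹ) (zeroˡ _))

    ⟪⟫-zeroˡ : ∀ x → ⟪ 0ᴹ , x ⟫ ≈ 0#
    ⟪⟫-zeroˡ x = trans (⟪⟫-cong (≈ᴹ-sym (*ₗ-zeroˡ 0ᴹ)) ≈ᴹ-refl) (trans (⟪⟫-*ˡ 0# 0ᴹ x) (zeroˡ _))

    ⟪⟫≉0⇒≉0ʳ : ∀ {x y} → ⟪ x , y ⟫ ≉ 0# → y ≉ᴹ 0ᴹ
    ⟪⟫≉0⇒≉0ʳ {x} xy≉0 y≈0 = xy≉0 (trans (⟪⟫-cong ≈ᴹ-refl y≈0) (⟪⟫-zeroʳ x))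

    skew : ∀ x y → ⟪ x , y ⟫ ≈ - ⟪ y , x ⟫
    skew x y = inverseˡ-unique ⟪ x , y ⟫ ⟪ y , x ⟫ (F.begin
      ⟪ x , y ⟫ + ⟪ y , x ⟫                             F.≈⟨ cong₂ _+_ (+-identityˡ _) (+-identityʳ _) ⟨
      (0# + ⟪ x , y ⟫) + (⟪ y , x ⟫ + 0#)
        F.≈⟨ cong₂ (λ h k → (h + ⟪ x , y ⟫) + (⟪ y , x ⟫ + k)) (alternating x) (alternating y) ⟨
      (⟪ x , x ⟫ + ⟪ x , y ⟫) + (⟪ y , x ⟫ + ⟪ y , y ⟫) F.≈⟨ cong₂ _+_ (⟪⟫-+ʳ x x y) (⟪⟫-+ʳ y x y) ⟨
      ⟪ x , x +ᴹ y ⟫ + ⟪ y , x +ᴹ y ⟫                   F.≈⟨ ⟪⟫-+ˡ x y (x +ᴹ y) ⟨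
      ⟪ x +ᴹ y , x +ᴹ y ⟫                               F.≈⟨ alternating (x +ᴹ y) ⟩
      0#                                                F.∎)

    skew-≉0 : ∀ x y → ⟪ x , y ⟫ ≉ 0# → ⟪ y , x ⟫ ≉ 0#
    skew-≉0 x y xy≉0 yx≈0 = xy≉0 (trans (skew x y) (trans (cong -_ yx≈0) (GroupProperties.ε⁻¹≈ε +-group)))

    ⟪⟫-linearCombination : ∀ x {d} (coeff : Vector Carrier d) v → (∀ i → ⟪ x , v i ⟫ ≈ 0#) →
                           ⟪ x , linearCombination vectorSpace coeff v ⟫ ≈ 0#
    ⟪⟫-linearCombination x {zero}  coeff v xv≈0 = ⟪⟫-zeroʳ x
    ⟪⟫-linearCombination x {suc d} coeff v xv≈0 = F.begin
      ⟪ x , linearCombination vectorSpace coeff v ⟫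
        F.≈⟨ ⟪⟫-+ʳ x _ _ ⟩
      ⟪ x , coeff zero *ₗ v zero ⟫ + ⟪ x , linearCombination vectorSpace (coeff ∘ suc) (v ∘ suc) ⟫
        F.≈⟨ cong₂ _+_ (trans (⟪⟫-*ʳ (coeff zero) x (v zero)) (trans (cong (coeff zero *_) (xv≈0 zero)) (zeroʳ (coeff zero))))
                       (⟪⟫-linearCombination x (coeff ∘ suc) (v ∘ suc) (xv≈0 ∘ suc)) ⟩
      0# + 0#
        F.≈⟨ +-identityˡ 0# ⟩
      0#  F.∎

    orthogonalToBasis⇒≈0 : ∀ x → (∀ i → ⟪ x , basis i ⟫ ≈ 0#) → x ≈ᴹ 0ᴹ
    orthogonalToBasis⇒≈0 x xv≈0 = nondegenerate x λ y → let (coeff , lc≈y) = spanning y in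
      trans (⟪⟫-cong ≈ᴹ-refl (≈ᴹ-sym lc≈y)) (⟪⟫-linearCombination x coeff basis xv≈0)

    _≈ᴹ0? : ∀ x → Dec (x ≈ᴹ 0ᴹ)
    x ≈ᴹ0? with all? (λ i → ⟪ x , basis i ⟫ ≈0?)
    ... | yes xv≈0 = yes (orthogonalToBasis⇒≈0 x xv≈0)
    ... | no  xv≉0 = no λ x≈0 → xv≉0 λ i → trans (⟪⟫-cong x≈0 ≈ᴹ-refl) (⟪⟫-zeroˡ (basis i))

    nonOrthogonal : ∀ x → x ≉ᴹ 0ᴹ → ∃[ y ] ⟪ x , y ⟫ ≉ 0#
    nonOrthogonal x x≉0 with ¬∀⟶∃¬ _ (λ i → ⟪ x , basis i ⟫ ≈ 0#) (λ i → ⟪ x , basis i ⟫ ≈0?)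
                               (λ xv≈0 → x≉0 (orthogonalToBasis⇒≈0 x xv≈0))
    ... | i , xvᵢ≉0 = basis i , xvᵢ≉0

    link : ∀ x y → x ≉ᴹ 0ᴹ → y ≉ᴹ 0ᴹ → ∃[ z ] ⟪ x , z ⟫ ≉ 0# × ⟪ z , y ⟫ ≉ 0#
    link x y x≉0 y≉0 with nonOrthogonal x x≉0 | nonOrthogonal y y≉0
    ... | u , xu≉0 | v , yv≉0 with ⟪ u , y ⟫ ≈0? | ⟪ x , v ⟫ ≈0?
    ... | no  uy≉0 | _        = u , xu≉0 , uy≉0
    ... | yes uy≈0 | no xv≉0  = v , xv≉0 , skew-≉0 y v yv≉0
    ... | yes uy≈0 | yes xv≈0 = u +ᴹ v
      , (λ eq → xu≉0 (trans (sym (trans (cong (⟪ x , u ⟫ +_) xv≈0) (+-identityʳ ⟪ x , u ⟫))) (trans (sym (⟪⟫-+ʳ x u v)) eq)))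
      , (λ eq → skew-≉0 y v yv≉0 (trans (sym (trans (cong (_+ ⟪ v , y ⟫) uy≈0) (+-identityˡ ⟪ v , y ⟫))) (trans (sym (⟪⟫-+ˡ u v y)) eq)))

    module Transvection (u : Carrierᴹ) where
      transvect : Carrier → Carrierᴹ → Carrierᴹ
      transvect k z = z +ᴹ (k * ⟪ z , u ⟫) *ₗ u

      transvect-cong : ∀ k {x y} → x ≈ᴹ y → transvect k x ≈ᴹ transvect k y
      transvect-cong k x≈y = +ᴹ-cong x≈y (*ₗ-congʳ (cong (k *_) (⟪⟫-cong x≈y ≈ᴹ-refl)))

      transvect-⟪,u⟫ : ∀ k z → ⟪ transvect k z , u ⟫ ≈ ⟪ z , u ⟫
      transvect-⟪,u⟫ k z = F.begin
        ⟪ transvect k z , u ⟫                       F.≈⟨ ⟪⟫-+ˡ z _ u ⟩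
        ⟪ z , u ⟫ + ⟪ (k * ⟪ z , u ⟫) *ₗ u , u ⟫    F.≈⟨ cong (⟪ z , u ⟫ +_) (⟪⟫-*ˡ _ u u) ⟩
        ⟪ z , u ⟫ + (k * ⟪ z , u ⟫) * ⟪ u , u ⟫     F.≈⟨ cong (λ r → ⟪ z , u ⟫ + (k * ⟪ z , u ⟫) * r) (alternating u) ⟩
        ⟪ z , u ⟫ + (k * ⟪ z , u ⟫) * 0#            F.≈⟨ cong (⟪ z , u ⟫ +_) (zeroʳ (k * ⟪ z , u ⟫)) ⟩
        ⟪ z , u ⟫ + 0#                              F.≈⟨ +-identityʳ _ ⟩
        ⟪ z , u ⟫                                   F.∎

      transvect-cancel : ∀ h k → k + h ≈ 0# → ∀ z → transvect h (transvect k z) ≈ᴹ z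
      transvect-cancel h k k+h≈0 z = E.begin
        transvect k z +ᴹ (h * ⟪ transvect k z , u ⟫) *ₗ u            E.≈⟨ +ᴹ-congˡ (*ₗ-congʳ (cong (h *_) (transvect-⟪,u⟫ k z))) ⟩
        (z +ᴹ (k * ⟪ z , u ⟫) *ₗ u) +ᴹ (h * ⟪ z , u ⟫) *ₗ u          E.≈⟨ +ᴹ-assoc z _ _ ⟩
        z +ᴹ ((k * ⟪ z , u ⟫) *ₗ u +ᴹ (h * ⟪ z , u ⟫) *ₗ u)          E.≈⟨ +ᴹ-congˡ (*ₗ-distribʳ u _ _) ⟨
        z +ᴹ (k * ⟪ z , u ⟫ + h * ⟪ z , u ⟫) *ₗ u                    E.≈⟨ +ᴹ-congˡ (*ₗ-congʳ (distribʳ ⟪ z , u ⟫ k h)) ⟨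
        z +ᴹ ((k + h) * ⟪ z , u ⟫) *ₗ u                              E.≈⟨ +ᴹ-congˡ (*ₗ-congʳ (trans (cong (_* ⟪ z , u ⟫) k+h≈0) (zeroˡ ⟪ z , u ⟫))) ⟩
        z +ᴹ 0# *ₗ u                                                 E.≈⟨ +ᴹ-congˡ (*ₗ-zeroˡ u) ⟩
        z +ᴹ 0ᴹ                                                      E.≈⟨ +ᴹ-identityʳ z ⟩
        z                                                            E.∎

      transvect-+ : ∀ k x y → transvect k (x +ᴹ y) ≈ᴹ transvect k x +ᴹ transvect k y
      transvect-+ k x y = E.begin
        (x +ᴹ y) +ᴹ (k * ⟪ x +ᴹ y , u ⟫) *ₗ u
          E.≈⟨ +ᴹ-congˡ (*ₗ-congʳ (trans (cong (k *_) (⟪⟫-+ˡ x y u)) (distribˡ k ⟪ x , u ⟫ ⟪ y , u ⟫))) ⟩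
        (x +ᴹ y) +ᴹ (k * ⟪ x , u ⟫ + k * ⟪ y , u ⟫) *ₗ u
          E.≈⟨ +ᴹ-congˡ (*ₗ-distribʳ u _ _) ⟩
        (x +ᴹ y) +ᴹ ((k * ⟪ x , u ⟫) *ₗ u +ᴹ (k * ⟪ y , u ⟫) *ₗ u)
          E.≈⟨ interchange x y _ _ ⟩
        transvect k x +ᴹ transvect k y E.∎
        where
        open CommutativeSemigroupProperties
          (CommutativeMonoid.commutativeSemigroup +ᴹ-commutativeMonoid) using (interchange)

      transvect-* : ∀ k r x → transvect k (r *ₗ x) ≈ᴹ r *ₗ transvect k x
      transvect-* k r x = E.begin
        r *ₗ x +ᴹ (k * ⟪ r *ₗ x , u ⟫) *ₗ u       E.≈⟨ +ᴹ-congˡ (*ₗ-congʳ eq) ⟩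
        r *ₗ x +ᴹ (r * (k * ⟪ x , u ⟫)) *ₗ u      E.≈⟨ +ᴹ-congˡ (*ₗ-assoc r _ u) ⟩
        r *ₗ x +ᴹ r *ₗ ((k * ⟪ x , u ⟫) *ₗ u)     E.≈⟨ *ₗ-distribˡ r x _ ⟨
        r *ₗ transvect k x                        E.∎
        where
        eq : k * ⟪ r *ₗ x , u ⟫ ≈ r * (k * ⟪ x , u ⟫)
        eq = F.begin
          k * ⟪ r *ₗ x , u ⟫      F.≈⟨ cong (k *_) (⟪⟫-*ˡ r x u) ⟩
          k * (r * ⟪ x , u ⟫)     F.≈⟨ *-assoc k r ⟪ x , u ⟫ ⟨
          (k * r) * ⟪ x , u ⟫     F.≈⟨ cong (_* ⟪ x , u ⟫) (*-comm k r) ⟩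
          (r * k) * ⟪ x , u ⟫     F.≈⟨ *-assoc r k ⟪ x , u ⟫ ⟩
          r * (k * ⟪ x , u ⟫)     F.∎

      transvect-⟪⟫ : ∀ k z w → ⟪ transvect k z , transvect k w ⟫ ≈ ⟪ z , w ⟫
      transvect-⟪⟫ k z w = F.begin
        ⟪ z +ᴹ (k * α) *ₗ u , w′ ⟫                             F.≈⟨ ⟪⟫-+ˡ z _ w′ ⟩
        ⟪ z , w′ ⟫ + ⟪ (k * α) *ₗ u , w′ ⟫                     F.≈⟨ cong₂ _+_ (trans (⟪⟫-+ʳ z w _) (cong (⟪ z , w ⟫ +_) (⟪⟫-*ʳ (k * β) z u))) (⟪⟫-*ˡ (k * α) u w′) ⟩
        (⟪ z , w ⟫ + (k * β) * α) + (k * α) * ⟪ u , w′ ⟫       F.≈⟨ +-assoc ⟪ z , w ⟫ _ _ ⟩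
        ⟪ z , w ⟫ + ((k * β) * α + (k * α) * ⟪ u , w′ ⟫)       F.≈⟨ cong (λ r → ⟪ z , w ⟫ + ((k * β) * α + (k * α) * r)) (trans (skew u w′) (cong -_ (transvect-⟪,u⟫ k w))) ⟩
        ⟪ z , w ⟫ + ((k * β) * α + (k * α) * - β)              F.≈⟨ cong (λ r → ⟪ z , w ⟫ + ((k * β) * α + r)) (-‿distribʳ-* (k * α) β) ⟨
        ⟪ z , w ⟫ + ((k * β) * α + - ((k * α) * β))            F.≈⟨ cong (λ r → ⟪ z , w ⟫ + (r + - ((k * α) * β))) swap ⟩
        ⟪ z , w ⟫ + ((k * α) * β + - ((k * α) * β))            F.≈⟨ cong (⟪ z , w ⟫ +_) (-‿inverseʳ ((k * α) * β)) ⟩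
        ⟪ z , w ⟫ + 0#                                         F.≈⟨ +-identityʳ ⟪ z , w ⟫ ⟩
        ⟪ z , w ⟫                                              F.∎
        where
        α β : Carrier
        α = ⟪ z , u ⟫
        β = ⟪ w , u ⟫
        w′ : Carrierᴹ
        w′ = transvect k w
        swap : (k * β) * α ≈ (k * α) * β
        swap = trans (*-assoc k β α) (trans (cong (k *_) (*-comm β α)) (sym (*-assoc k α β)))

      transvection : Carrier → Similitude
      transvection k = record
        { to = transvect k
        ; isLinearAutomorphism = isAutomorphism (transvect k) (transvect (- k))
            (isHomomorphism (transvect k) (transvect-cong k) (transvect-+ k) (transvect-* k)) (transvect-cong (- k))
            (transvect-cancel k (- k) (-‿inverseˡ k)) (transvect-cancel (- k) k (-‿inverseʳ k))
        ; multiplier = 1#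
        ; multiplier≉0 = 𝔽-1≢0 ℓ-prime
        ; ⟪⟫-scaled = λ x y → trans (transvect-⟪⟫ k x y) (sym (*-identityˡ ⟪ x , y ⟫))
        }

    moveNonOrthogonal : ∀ x y → ⟪ x , y ⟫ ≉ 0# → ∃[ f ] to f x ≈ᴹ y
    moveNonOrthogonal x y xy≉0 = transvection k , (E.begin
      x +ᴹ (k * ⟪ x , u ⟫) *ₗ u     E.≈⟨ +ᴹ-congˡ (*ₗ-congʳ (trans (cong (k *_) xu≈xy) (proj₂ (inverse* _ xy≉0)))) ⟩
      x +ᴹ 1# *ₗ u                  E.≈⟨ +ᴹ-congˡ (*ₗ-identityˡ u) ⟩
      x +ᴹ u                        E.≈⟨ x+u≈y ⟩
      y                             E.∎)
      where
      u : Carrierᴹ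
      u = -ᴹ x +ᴹ y
      open Transvection u
      k : Carrier
      k = proj₁ (inverse* _ xy≉0)
      x+u≈y : x +ᴹ u ≈ᴹ y
      x+u≈y = GroupProperties.\\-leftDividesˡ +ᴹ-group x y
      xu≈xy : ⟪ x , u ⟫ ≈ ⟪ x , y ⟫
      xu≈xy = F.begin
        ⟪ x , u ⟫                 F.≈⟨ +-identityˡ _ ⟨
        0# + ⟪ x , u ⟫            F.≈⟨ cong (_+ ⟪ x , u ⟫) (alternating x) ⟨
        ⟪ x , x ⟫ + ⟪ x , u ⟫     F.≈⟨ ⟪⟫-+ʳ x x u ⟨
        ⟪ x , x +ᴹ u ⟫            F.≈⟨ ⟪⟫-cong ≈ᴹ-refl x+u≈y ⟩
        ⟪ x , y ⟫                 F.∎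

  πvec-transitive : Transitive πvec-action
  πvec-transitive (x , x≉0) (y , y≉0) with link x y x≉0 y≉0
  ... | z , xz≉0 , zy≉0 with moveNonOrthogonal x z xz≉0 | moveNonOrthogonal z y zy≉0
  ... | f , fx≈z | h , hz≈y = h ∘ˢ f , ≈ᴹ-trans (Similitude.⟦⟧-cong h fx≈z) hz≈y

  πvec-faithful : Faithful πvec-action
  πvec-faithful f f≈id x with x ≈ᴹ0?
  ... | yes x≈0 = ≈ᴹ-trans (Similitude.⟦⟧-cong f x≈0) (≈ᴹ-trans (Similitude.0ᴹ-homo f) (≈ᴹ-sym x≈0))
  ... | no  x≉0 = f≈id (x , x≉0)

  πproj-transitive : Transitive πproj-action
  πproj-transitive L@(line x x≉0) M@(line y y≉0) with πvec-transitive (x , x≉0) (y , y≉0)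
  ... | f , fx≈y = f , generator-∈⇒≈ (actLine f L) M (1# , ≈ᴹ-trans fx≈y (≈ᴹ-sym (*ₗ-identityˡ y)))

  private
    module _ (f : Similitude) (fixes : ∀ L → actLine f L ≈ᴸ L) where
      open Similitude f using (multiplier; ⟪⟫-scaled)

      eigenvalue : ∀ x → x ≉ᴹ 0ᴹ → ∃[ k ] to f x ≈ᴹ k *ₗ x
      eigenvalue x x≉0 = Equivalence.to (fixes L (to f x)) (generator-∈ (actLine f L))
        where
        L : Line
        L = line x x≉0

      multiplier-≈ : ∀ {x y} h k → to f x ≈ᴹ h *ₗ x → to f y ≈ᴹ k *ₗ y → ⟪ x , y ⟫ ≉ 0# → multiplier ≈ h * k
      multiplier-≈ {x} {y} h k fx≈hx fy≈ky xy≉0 = *-cancelʳ-≉0 multiplier (h * k) xy≉0 (F.begin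
        multiplier * ⟪ x , y ⟫      F.≈⟨ ⟪⟫-scaled x y ⟨
        ⟪ to f x , to f y ⟫         F.≈⟨ ⟪⟫-cong fx≈hx fy≈ky ⟩
        ⟪ h *ₗ x , k *ₗ y ⟫         F.≈⟨ ⟪⟫-*ˡ h x (k *ₗ y) ⟩
        h * ⟪ x , k *ₗ y ⟫          F.≈⟨ cong (h *_) (⟪⟫-*ʳ k x y) ⟩
        h * (k * ⟪ x , y ⟫)         F.≈⟨ *-assoc h k ⟪ x , y ⟫ ⟨
        (h * k) * ⟪ x , y ⟫         F.∎)

      eigenvalue-unique : ∀ x y (x≉0 : x ≉ᴹ 0ᴹ) (y≉0 : y ≉ᴹ 0ᴹ) → proj₁ (eigenvalue x x≉0) ≈ proj₁ (eigenvalue y y≉0)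
      eigenvalue-unique x y x≉0 y≉0 with eigenvalue x x≉0 | eigenvalue y y≉0 | link x y x≉0 y≉0
      ... | h , fx≈hx | k , fy≈ky | z , xz≉0 , zy≉0 with eigenvalue z (⟪⟫≉0⇒≉0ʳ xz≉0)
      ... | r , fz≈rz = *-cancelʳ-≉0 h k r≉0
        (trans (sym (multiplier-≈ h r fx≈hx fz≈rz xz≉0)) (trans (multiplier-≈ r k fz≈rz fy≈ky zy≉0) (*-comm r k)))
        where
        r≉0 : r ≉ 0#
        r≉0 r≈0 = image≉0 f (⟪⟫≉0⇒≉0ʳ xz≉0) (≈ᴹ-trans fz≈rz (≈ᴹ-trans (*ₗ-congʳ r≈0) (*ₗ-zeroˡ z)))

      fixesLines⇒scalar : IsScalar f
      fixesLines⇒scalar with all? (λ i → basis i ≈ᴹ0?)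
      ... | yes v≈0 = 1# , 𝔽-1≢0 ℓ-prime , λ x → ≈ᴹ-trans (x≈0 (to f x)) (≈ᴹ-sym (x≈0 (1# *ₗ x)))
        where
        x≈0 : ∀ x → x ≈ᴹ 0ᴹ
        x≈0 x = orthogonalToBasis⇒≈0 x λ i → trans (⟪⟫-cong ≈ᴹ-refl (v≈0 i)) (⟪⟫-zeroʳ x)
      ... | no  v≉0 with ¬∀⟶∃¬ _ (λ i → basis i ≈ᴹ 0ᴹ) (λ i → basis i ≈ᴹ0?) v≉0
      ... | i , vᵢ≉0 = k , k≉0 , scales
        where
        v : Carrierᴹ
        v = basis i
        k : Carrier
        k = proj₁ (eigenvalue v vᵢ≉0)
        k≉0 : k ≉ 0#
        k≉0 k≈0 = image≉0 f vᵢ≉0 (≈ᴹ-trans (proj₂ (eigenvalue v vᵢ≉0)) (≈ᴹ-trans (*ₗ-congʳ k≈0) (*ₗ-zeroˡ v)))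
        scales : ∀ x → to f x ≈ᴹ k *ₗ x
        scales x with x ≈ᴹ0?
        ... | yes x≈0 = ≈ᴹ-trans (Similitude.⟦⟧-cong f x≈0) (≈ᴹ-trans (Similitude.0ᴹ-homo f)
                          (≈ᴹ-sym (≈ᴹ-trans (*ₗ-congˡ x≈0) (*ₗ-zeroʳ k))))
        ... | no  x≉0 = ≈ᴹ-trans (proj₂ (eigenvalue x x≉0)) (*ₗ-congʳ (eigenvalue-unique x v x≉0 vᵢ≉0))

  πproj-faithful : Faithful πproj-action
  πproj-faithful f fixes =
    ∙-closed {inverse f} {identity-similitude} (⁻¹-closed {f} (fixesLines⇒scalar f fixes)) ε-closed
    where open NormalSubgroup scalars

  πvec : FaithfulTransitiveRepresentation GSp V∖0
  πvec = record { representation = πvec-action ; faithful = πvec-faithful ; transitive = πvec-transitive }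

  πproj : FaithfulTransitiveRepresentation PGSp P[V]
  πproj = record { representation = πproj-action ; faithful = πproj-faithful ; transitive = πproj-transitive }

{-# OPTIONS --safe #-}
module Submission where

-- Let M = |V|, let i be the index of an element and F its number of fixed points on
-- Ω.  The orbit of a moved point has at least two elements, so 2 i ≥ |Ω| − F, with
-- equality for involutions.  On vectors F + 1 is the order of the fixed space; on
-- lines (ℓ − 1) F is the number of nonzero eigenvectors.  Let E be an eigenspace and
-- Q the set of eigenvectors for other eigenvalues, with 0.  As E × Q embeds in V by
-- addition, |E| |Q| ≤ M, hence |E| + |Q| ≤ ℓ² + M / ℓ² if ℓ² ≤ |E| ≤ M / ℓ².  The
-- involution −1 on a hyperbolic plane and 1 on its orthogonal attains this bound.
-- An eigenspace can only be larger if it is a hyperplane, and then the element is a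
-- multiple of a transvection; it has no 2-cycles, so 3 i ≥ 2 (|Ω| − F), which is
-- enough because ℓ ≥ 3.  If every eigenspace has at most ℓ elements, there are too
-- few eigenvectors to matter.  For n = 1 the extremal element is diag(−1, 1), a
-- similitude with multiplier −1.

open import Defs
open import Algebra.Bundles using (CommutativeRing; CommutativeMonoid; Group)
open import Algebra.Module.Bundles using (LeftModule)
open import Algebra.Module.Morphism.Structures using (IsLeftModuleHomomorphism; IsLeftModuleIsomorphism)
import Algebra.Properties.AbelianGroup as AbelianGroupProperties
import Algebra.Properties.CommutativeMonoid.Sum as CommutativeMonoidSum
import Algebra.Properties.CommutativeSemigroup as CommutativeSemigroupProperties
import Algebra.Properties.Ring as RingProperties
open import Data.Fin.Base using (Fin; zero; suc; toℕ; funToFin; finToFun; combine)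
import Data.Fin.Properties as Fin
open import Data.Integer.Base using (-[1+_]) renaming (+_ to pos)
open import Data.List.Base using (List; []; _∷_; tabulate; lookup; length; deduplicate)
open import Data.List.Membership.Propositional.Properties using (∈-lookup)
import Data.List.Membership.Setoid as Membership
import Data.List.Membership.Setoid.Properties as ∈
open import Data.List.Relation.Unary.All as All using (_∷_)
open import Data.List.Relation.Unary.AllPairs using (_∷_)
open import Data.List.Relation.Unary.Any as Any using (here; there)
open import Data.List.Relation.Unary.Any.Properties using (lookup-index)
open import Data.List.Relation.Unary.Enumerates.Setoid using (IsEnumeration)
import Data.List.Relation.Unary.Enumerates.Setoid.Properties as Enumerates
import Data.List.Relation.Unary.Unique.DecSetoid.Properties as DecUnique
import Data.List.Relation.Unary.Unique.Setoid as Unique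
open import Data.Nat using (ℕ; zero; suc; _+_; _*_; _∸_; _^_; _≤_; _<_; _≥_; z≤n; s≤s; z<s; NonZero; >-nonZero; >-nonZero⁻¹; nonTrivial⇒n>1)
open import Data.Nat.DivMod using (_/_; m*n/n≡m; /-monoˡ-≤; m<n⇒m%n≡m)
open import Data.Nat.Divisibility using (_∣_; divides)
open import Data.Nat.Primality using (Prime; prime⇒nonZero; prime⇒nonTrivial)
import Data.Nat.Properties as ℕ
open import Data.Nat.Solver using (module +-*-Solver)
open import Data.Product using (∃; ∃-syntax; ∃₂; _×_; _,_; proj₁; proj₂)
open import Data.Product.Function.NonDependent.Setoid using (_×-inverse_)
open import Data.Product.Relation.Binary.Pointwise.NonDependent using (_×ₛ_; Pointwise-≡↔≡)
open import Data.Sum.Base using (_⊎_; inj₁; inj₂)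
open import Data.Sum.Function.Setoid using (_⊎-inverse_)
import Data.Sum.Relation.Binary.Pointwise as Sum
open import Data.Sum.Relation.Binary.Pointwise using (_⊎ₛ_; inj₁; inj₂)
open import Data.Unit.Polymorphic.Base using (⊤; tt)
open import Data.Vec.Functional using (Vector)
open import Function.Base using (_∘_; id; case_of_)
open import Function.Bundles using (Inverse; Surjection; Equivalence)
import Function.Construct.Composition as Compose
import Function.Construct.Symmetry as Symmetry
open import Level using (Level; _⊔_; 0ℓ) renaming (suc to lsuc)
open import Relation.Binary.Bundles using (Setoid; DecSetoid)
import Relation.Binary.Construct.On as On
open import Relation.Binary.Definitions using (Decidable; _Respects_)
open import Relation.Binary.PropositionalEquality as ≡ using (_≡_)
import Relation.Binary.Reasoning.Setoid as SetoidReasoning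
open import Relation.Nullary using (¬_; Dec; yes; no; contradiction)
open import Relation.Nullary.Decidable using (map′; ¬?; _→-dec_; _×-dec_)

open +-*-Solver using (solve; con; _:+_; _:*_; _:=_)

-- No subspace is given a basis; its size is its order, and codimension and product bounds become
-- statements about injections between finite sets. This suits Q, a union of eigenspaces that is no
-- subspace, and V need not be decomposed into eigenspaces. An index is a truncated difference, so
-- bounds are kept additive, as in M ≤ 2 i + e. Halving comes last, where the lower bound for all
-- nontrivial elements meets the upper bound at one of them. On lines all eigenvalues count at once.
-- An eigenspace of order e leaves at most M / e vectors to the others, and e + M / e is convex,
-- hence largest at the ends of the permitted range of e. The ends e = ℓ and e = M / ℓ would give
-- more than the claimed value; what excludes diag(-1, 1, ..., 1) in dimension above 2 is the form.
-- A hyperplane with more than ℓ elements is not totally isotropic, so it forces the multiplier to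
-- be the square of its eigenvalue, and no second eigenvalue remains. In dimension 2 a hyperplane is
-- an isotropic line, the multiplier is free, and that element exists, which is why n = 1 has other
-- values.

private
  variable
    a b c e o o₁ e₁ o₂ e₂ p₁ p₂ : Level

-- Finite setoids

module _ {S : Setoid o e} {k} (S-finite : HasCardinality S k) where
  open Setoid S
  open Inverse S-finite

  decide-≈ : Decidable _≈_
  decide-≈ x y = map′
    (λ eq → trans (sym (strictlyInverseʳ x)) (trans (from-cong eq) (strictlyInverseʳ y)))
    to-cong (to x Fin.≟ to y)

  canonical : Carrier → Carrier
  canonical = from ∘ to

  canonical-≈ : ∀ x → canonical x ≈ x
  canonical-≈ = strictlyInverseʳ

  -- The conclusion is `≡`, so a function that does not respect `≈`, such as one that picks a
  -- generator of a line, is still constant on a class once it is applied to representatives.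
  canonical-cong : ∀ {x y} → x ≈ y → canonical x ≡ canonical y
  canonical-cong = ≡.cong from ∘ to-cong

  to-injective : ∀ {x y} → to x ≡ to y → x ≈ y
  to-injective eq = trans (sym (strictlyInverseʳ _)) (trans (from-cong eq) (strictlyInverseʳ _))

  enumeration : List Carrier
  enumeration = tabulate from

  enumeration-complete : IsEnumeration S enumeration
  enumeration-complete x = ∈.∈-resp-≈ S (strictlyInverseʳ x) (∈.∈-tabulate⁺ S (to x))

  all-or-counterexample : {P : Carrier → Set p₁} → P Respects _≈_ → (∀ x → Dec (P x)) →
                          (∀ x → P x) ⊎ ∃ λ x → ¬ P x
  all-or-counterexample resp P? with Fin.all? (P? ∘ from)
  ... | yes all = inj₁ λ x → resp (strictlyInverseʳ x) (all (to x))
  ... | no ¬all with Fin.¬∀⟶∃¬ _ _ (P? ∘ from) ¬all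
  ... | i , ¬Pi = inj₂ (from i , ¬Pi)

module _ (S : Setoid o e) (_≈?_ : Decidable (Setoid._≈_ S)) where
  open Setoid S
  open Unique S using (Unique)

  private
    DS : DecSetoid o e
    DS = record { isDecEquivalence = record { isEquivalence = isEquivalence ; _≟_ = _≈?_ } }

    lookup-injective : ∀ {xs} → Unique xs → ∀ i j → lookup xs i ≈ lookup xs j → i ≡ j
    lookup-injective (_ ∷ _)     zero    zero    _  = ≡.refl
    lookup-injective (x∉xs ∷ _)  zero    (suc j) eq = contradiction eq (All.lookup x∉xs (∈-lookup j))
    lookup-injective (x∉xs ∷ _)  (suc i) zero    eq = contradiction (sym eq) (All.lookup x∉xs (∈-lookup i))
    lookup-injective (_ ∷ uniq)  (suc i) (suc j) eq = ≡.cong suc (lookup-injective uniq i j eq)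

  -- The cardinality is whatever length survives deduplication. Its value becomes known only
  -- afterwards, through injections in both directions.
  finite-enumerated : ∀ xs → IsEnumeration S xs → ∃ (HasCardinality S)
  finite-enumerated xs complete = length ys , record
    { to        = position
    ; from      = lookup ys
    ; to-cong   = λ {x} {y} x≈y → unique-position (trans (lookup-position x) (trans x≈y (sym (lookup-position y))))
    ; from-cong = λ { ≡.refl → Setoid.refl S }
    ; inverse   = (λ {i} {x} x≈ → unique-position (trans (lookup-position x) x≈))
                , (λ { {x} ≡.refl → lookup-position x })
    }
    where
    ys : List Carrier
    ys = deduplicate _≈?_ xs
    ys-complete : IsEnumeration S ys
    ys-complete = Enumerates.deduplicate⁺ DS complete
    position : Carrier → Fin (length ys)
    position x = Any.index (ys-complete x)
    lookup-position : ∀ x → lookup ys (position x) ≈ x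
    lookup-position x = sym (lookup-index (ys-complete x))
    unique-position : ∀ {i j} → lookup ys i ≈ lookup ys j → i ≡ j
    unique-position = lookup-injective (DecUnique.deduplicate-! DS xs) _ _

finite-image : {S : Setoid o₁ e₁} {T : Setoid o₂ e₂} → ∃ (HasCardinality S) → Surjection S T →
               Decidable (Setoid._≈_ T) → ∃ (HasCardinality T)
finite-image {S = S} {T} (_ , S-finite) surj _≈?_ =
  finite-enumerated T _≈?_ _ (Enumerates.map⁺ S T surj (enumeration-complete S-finite))

-- Equality forgets the proof of `P`, so an element counts once however many proofs it has; an
-- eigenvector can carry its eigenvalue without being counted twice.
Sub : (S : Setoid o e) → (Setoid.Carrier S → Set p₁) → Setoid (o ⊔ p₁) e
Sub S P = On.setoid {B = ∃ P} S proj₁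

finite-sub : {S : Setoid o e} → ∃ (HasCardinality S) → {P : Setoid.Carrier S → Set p₁} →
             P Respects (Setoid._≈_ S) → (∀ x → Dec (P x)) → ∃ (HasCardinality (Sub S P))
finite-sub {S = S} (_ , S-finite) {P} resp P? =
  finite-enumerated (Sub S P) (λ x y → decide-≈ S-finite (proj₁ x) (proj₁ y)) (select xs)
    λ (x , Px) → ∈-select Px (enumeration-complete S-finite x)
  where
  open Setoid S
  xs : List Carrier
  xs = enumeration S-finite
  select : List Carrier → List (∃ P)
  select []       = []
  select (x ∷ xs) with P? x
  ... | yes Px = (x , Px) ∷ select xs
  ... | no  _  = select xs
  ∈-select : ∀ {x xs} Px → Membership._∈_ S x xs → Membership._∈_ (Sub S P) (x , Px) (select xs)
  ∈-select {xs = y ∷ xs} Px x∈ with P? y | x∈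
  ... | yes Py | here x≈y  = here x≈y
  ... | yes Py | there x∈xs = there (∈-select Px x∈xs)
  ... | no ¬Py | here x≈y  = contradiction (resp x≈y Px) ¬Py
  ... | no ¬Py | there x∈xs = ∈-select Px x∈xs

InjectiveOn : (S : Setoid o₁ e₁) (T : Setoid o₂ e₂) → (Setoid.Carrier S → Setoid.Carrier T) → Set _
InjectiveOn S T f = ∀ {x y} → Setoid._≈_ T (f x) (f y) → Setoid._≈_ S x y

-- f need not respect the equality of S: it is only applied to representatives.
injective⇒card-≤ : {S : Setoid o₁ e₁} {T : Setoid o₂ e₂} → ∀ {m n} → HasCardinality S m → HasCardinality T n →
                   (f : Setoid.Carrier S → Setoid.Carrier T) → InjectiveOn S T f → m ≤ n
injective⇒card-≤ {S = S} {T} S-finite T-finite f f-injective =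
  Fin.injective⇒≤ {f = Inverse.to T-finite ∘ f ∘ Inverse.from S-finite} λ {i} {j} eq →
    ≡.trans (≡.sym (Inverse.strictlyInverseˡ S-finite i))
      (≡.trans (Inverse.to-cong S-finite (f-injective (to-injective T-finite eq)))
        (Inverse.strictlyInverseˡ S-finite j))

card-Fin : ∀ k → HasCardinality (≡.setoid (Fin k)) k
card-Fin k = Symmetry.inverse (record { to = id ; from = id ; to-cong = id ; from-cong = id ; inverse = id , id })

card-⊎ : {S : Setoid o₁ e₁} {T : Setoid o₂ e₂} → ∀ {m n} → HasCardinality S m → HasCardinality T n →
         HasCardinality (S ⊎ₛ T) (m + n)
card-⊎ S-finite T-finite = Compose.inverse (S-finite ⊎-inverse T-finite)
  (Compose.inverse (Sum.Pointwise-≡↔≡ _ _) (Symmetry.inverse Fin.+↔⊎))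

card-× : {S : Setoid o₁ e₁} {T : Setoid o₂ e₂} → ∀ {m n} → HasCardinality S m → HasCardinality T n →
         HasCardinality (S ×ₛ T) (m * n)
card-× S-finite T-finite = Compose.inverse (S-finite ×-inverse T-finite)
  (Compose.inverse Pointwise-≡↔≡ (Symmetry.inverse Fin.*↔×))

-- Orbits and indices

FixedPoints : {Ω : Setoid o e} → Permutation Ω → Setoid (o ⊔ e) e
FixedPoints {Ω = Ω} σ = Sub Ω λ x → Setoid._≈_ Ω (Inverse.to σ x) x

module _ {Ω : Setoid o e} (σ : Permutation Ω) {k} (Ω-finite : HasCardinality Ω k) where
  open Setoid Ω
  open Inverse σ

  σ-injective : ∀ {x y} → to x ≈ to y → x ≈ y
  σ-injective eq = trans (sym (strictlyInverseʳ _)) (trans (from-cong eq) (strictlyInverseʳ _))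

  private
    _≈?_ : Decidable _≈_
    _≈?_ = decide-≈ Ω-finite

    to≈⇒≈from : ∀ {x y} → to x ≈ y → x ≈ from y
    to≈⇒≈from eq = trans (sym (strictlyInverseʳ _)) (from-cong eq)

    power-injective : ∀ i {x y} → power σ (pos i) x ≈ power σ (pos i) y → x ≈ y
    power-injective zero    eq = eq
    power-injective (suc i) eq = power-injective i (σ-injective eq)

  -- Two of the first k + 1 iterates coincide by the pigeonhole principle, and injectivity strips
  -- the common initial power.
  period : ∀ x → ∃[ d ] power σ (pos (suc d)) x ≈ x
  period x with Fin.pigeonhole (ℕ.n<1+n k) (λ i → Inverse.to Ω-finite (power σ (pos (toℕ i)) x))
  ... | i , j , i<j , eq with ℕ.m≤n⇒∃[o]m+o≡n i<j
  ... | d , 1+i+d≡j = d , power-injective (toℕ i) (trans (power-+ σ (pos (toℕ i)) (pos (suc d)) x)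
    (trans (reflexive (≡.cong (λ m → power σ (pos m) x) (≡.trans (ℕ.+-suc (toℕ i) d) 1+i+d≡j)))
      (sym (to-injective Ω-finite eq))))

  -- The exponents range over all integers, but the iterates σ⁰ x, ..., σᵈ x are closed under σ and
  -- its inverse, the ends wrapping around because σᵈ⁺¹ x = x. A search over d + 1 exponents
  -- therefore decides.
  SameOrbit? : Decidable (SameOrbit σ)
  SameOrbit? x y = map′ (λ (m , _ , eq) → pos m , eq) (λ (i , eq) → respond eq (reach i))
    (ℕ.anyUpTo? (λ m → power σ (pos m) x ≈? y) (suc d))
    where
    d : ℕ
    d = proj₁ (period x)
    Reached : Carrier → Set e
    Reached y = ∃[ m ] m < suc d × power σ (pos m) x ≈ y
    respond : ∀ {y z} → y ≈ z → Reached y → Reached z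
    respond y≈z (m , m≤d , eq) = m , m≤d , trans eq y≈z
    forth : ∀ {y} → Reached y → Reached (to y)
    forth (m , m≤d , eq) with m ℕ.≟ d
    ... | yes ≡.refl = 0 , z<s , trans (sym (proj₂ (period x))) (to-cong eq)
    ... | no  m≢d    = suc m , s≤s (ℕ.≤∧≢⇒< (ℕ.≤-pred m≤d) m≢d) , to-cong eq
    back : ∀ {y} → Reached y → Reached (from y)
    back (zero  , _   , eq) = d , ℕ.n<1+n d , to≈⇒≈from (trans (proj₂ (period x)) eq)
    back (suc m , m≤d , eq) = m , ℕ.<-trans (ℕ.n<1+n m) m≤d , to≈⇒≈from eq
    reach : ∀ i → Reached (power σ i x)
    reach (pos zero)    = 0 , z<s , refl
    reach (pos (suc m)) = forth (reach (pos m))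
    reach -[1+ zero ]   = back (reach (pos 0))
    reach -[1+ suc m ]  = back (reach -[1+ m ])

  orbits-finite : ∃ (HasCardinality (orbits σ))
  orbits-finite = finite-image (k , Ω-finite) (record
    { to         = id
    ; cong       = λ x≈y → pos 0 , x≈y
    ; surjective = λ x → x , λ x≈y → pos 0 , x≈y
    }) SameOrbit?

  fixedPoints-finite : ∃ (HasCardinality (FixedPoints σ))
  fixedPoints-finite = finite-sub (k , Ω-finite)
    (λ x≈y σx≈x → trans (to-cong (sym x≈y)) (trans σx≈x x≈y)) (λ x → to x ≈? x)

  module _ {r f} (orbits-card : HasCardinality (orbits σ) r) (fixed-card : HasCardinality (FixedPoints σ) f) where
    private
      Fixed : Setoid _ _
      Fixed = FixedPoints σ
      module Orb = Setoid (orbits σ)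

      rep : Carrier → Carrier
      rep = canonical orbits-card

      rep-sameOrbit : ∀ {x y} → SameOrbit σ (rep x) (rep y) → SameOrbit σ x y
      rep-sameOrbit {x} {y} eq = Orb.trans (Orb.sym (canonical-≈ orbits-card x)) (Orb.trans eq (canonical-≈ orbits-card y))

      rep-≡ : ∀ {x y} → SameOrbit σ (rep x) (rep y) → rep x ≡ rep y
      rep-≡ = canonical-cong orbits-card ∘ rep-sameOrbit

    -- An orbit of a moved point x is counted at x, σ x, …, σᵐ x; the orbit of a
    -- fixed point once at this point and m times in the second summand.
    orbits≤ : ∀ m → (∀ x → ¬ to x ≈ x → ∀ (i j : Fin (suc m)) →
                       power σ (pos (toℕ i)) x ≈ power σ (pos (toℕ j)) x → i ≡ j) →
              suc m * r ≤ k + m * f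
    orbits≤ m spread = injective⇒card-≤ (card-× (card-Fin (suc m)) orbits-card)
      (card-⊎ Ω-finite (card-× (card-Fin m) fixed-card)) (λ (i , x) → place i (rep x)) λ {(i , x)} {(j , y)} → injective i j x y
      where
      Target : Setoid _ _
      Target = Ω ⊎ₛ (≡.setoid (Fin m) ×ₛ Fixed)
      module T = Setoid Target
      place : Fin (suc m) → Carrier → T.Carrier
      place i x with to x ≈? x
      place i       x | no  _  = inj₁ (power σ (pos (toℕ i)) x)
      place zero    x | yes _  = inj₁ x
      place (suc i) x | yes fx = inj₂ (i , x , fx)
      place-sameOrbit : ∀ i j x y → place i x T.≈ place j y → SameOrbit σ x y
      place-sameOrbit i j x y eq with to x ≈? x | to y ≈? y
      place-sameOrbit i       j       x y (inj₁ eq)       | no _  | no _  =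
        Orb.trans {j = power σ (pos (toℕ i)) x} (pos (toℕ i) , refl)
          (Orb.trans (pos 0 , eq) (Orb.sym {x = y} (pos (toℕ j) , refl)))
      place-sameOrbit i       zero    x y (inj₁ eq)       | no _  | yes _ = pos (toℕ i) , eq
      place-sameOrbit zero    j       x y (inj₁ eq)       | yes _ | no _  = Orb.sym {x = y} (pos (toℕ j) , sym eq)
      place-sameOrbit zero    zero    x y (inj₁ eq)       | yes _ | yes _ = pos 0 , eq
      place-sameOrbit (suc i) (suc j) x y (inj₂ (_ , eq)) | yes _ | yes _ = pos 0 , eq
      place-injective : ∀ i j x → place i x T.≈ place j x → i ≡ j
      place-injective i j x eq with to x ≈? x
      place-injective i       j       x (inj₁ eq)       | no mx = spread x mx i j eq
      place-injective zero    zero    x _               | yes _ = ≡.refl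
      place-injective (suc i) (suc j) x (inj₂ (eq , _)) | yes _ = ≡.cong suc eq
      injective : ∀ i j x y → place i (rep x) T.≈ place j (rep y) → i ≡ j × SameOrbit σ x y
      -- `spread` compares iterates of a single point, and `place` branches on a decision and need
      -- not respect `≈`. The two representatives are therefore first made propositionally equal by
      -- `rep-≡`.
      injective i j x y eq = place-injective i j (rep y) (≡.subst (λ z → place i z T.≈ place j (rep y)) (rep-≡ same) eq)
                           , rep-sameOrbit same
        where
        same : SameOrbit σ (rep x) (rep y)
        same = place-sameOrbit i j (rep x) (rep y) eq

    -- The orbits are {x} and {x , σ x}, so a point other than the
    -- representative of its orbit is determined by the orbit and not fixed.
    involution-orbits≥ : (∀ x → to (to x) ≈ x) → k + f ≤ r + r
    involution-orbits≥ invol = injective⇒card-≤ (card-⊎ Ω-finite fixed-card) (card-⊎ orbits-card orbits-card) place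
      λ {x} {y} → place-injective x y
      where
      module S = Setoid (Ω ⊎ₛ Fixed)
      module T = Setoid (orbits σ ⊎ₛ orbits σ)
      place : S.Carrier → T.Carrier
      place (inj₁ x) with x ≈? rep x
      ... | yes _ = inj₁ x
      ... | no  _ = inj₂ x
      place (inj₂ (x , _)) = inj₂ x
      power-invol : ∀ i x → power σ i x ≈ x ⊎ power σ i x ≈ to x
      power-invol (pos zero) x = inj₁ refl
      power-invol (pos (suc i)) x with power-invol (pos i) x
      ... | inj₁ eq = inj₂ (to-cong eq)
      ... | inj₂ eq = inj₁ (trans (to-cong eq) (invol x))
      power-invol -[1+ zero ] x = inj₂ (sym (to≈⇒≈from (invol x)))
      power-invol -[1+ suc i ] x with power-invol -[1+ i ] x
      ... | inj₁ eq = inj₂ (trans (from-cong eq) (sym (to≈⇒≈from (invol x))))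
      ... | inj₂ eq = inj₁ (trans (from-cong eq) (strictlyInverseʳ x))
      sameOrbit : ∀ {x y} → SameOrbit σ x y → x ≈ y ⊎ to x ≈ y
      sameOrbit {x} (i , eq) with power-invol i x
      ... | inj₁ eq′ = inj₁ (trans (sym eq′) eq)
      ... | inj₂ eq′ = inj₂ (trans (sym eq′) eq)
      moved : ∀ {x} → ¬ x ≈ rep x → to (rep x) ≈ x
      moved {x} x≉rep with sameOrbit (canonical-≈ orbits-card x)
      ... | inj₁ rep≈x = contradiction (sym rep≈x) x≉rep
      ... | inj₂ eq    = eq
      fixed : ∀ {x} → to x ≈ x → rep x ≈ x
      fixed {x} fx with sameOrbit (Orb.sym {x = rep x} (canonical-≈ orbits-card x))
      ... | inj₁ eq = sym eq
      ... | inj₂ eq = trans (sym eq) fx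
      rep-cong : ∀ {x y} → SameOrbit σ x y → rep x ≈ rep y
      rep-cong = reflexive ∘ canonical-cong orbits-card
      apart : ∀ {x y} → ¬ x ≈ rep x → to y ≈ y → ¬ SameOrbit σ x y
      apart {x} {y} x≉rep fy same = x≉rep (trans (sym (moved x≉rep))
        (trans (to-cong rep≈y) (trans fy (sym rep≈y))))
        where
        rep≈y : rep x ≈ y
        rep≈y = trans (rep-cong same) (fixed fy)
      place-injective : ∀ x y → place x T.≈ place y → x S.≈ y
      place-injective (inj₁ x) (inj₁ y) eq with x ≈? rep x | y ≈? rep y
      place-injective (inj₁ x) (inj₁ y) (inj₁ eq) | yes x≈ | yes y≈ = inj₁ (trans x≈ (trans (rep-cong eq) (sym y≈)))
      place-injective (inj₁ x) (inj₁ y) (inj₂ eq) | no x≉  | no y≉  = inj₁ (trans (sym (moved x≉)) (trans (to-cong (rep-cong eq)) (moved y≉)))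
      place-injective (inj₁ x) (inj₂ (y , fy)) eq with x ≈? rep x
      place-injective (inj₁ x) (inj₂ (y , fy)) (inj₂ eq) | no x≉ = contradiction eq (apart x≉ fy)
      place-injective (inj₂ (x , fx)) (inj₁ y) eq with y ≈? rep y
      place-injective (inj₂ (x , fx)) (inj₁ y) (inj₂ eq) | no y≉ = contradiction (Orb.sym {x = x} eq) (apart y≉ fx)
      place-injective (inj₂ (x , fx)) (inj₂ (y , fy)) (inj₂ eq) = inj₂ (trans (sym (fixed fx)) (trans (rep-cong eq) (fixed fy)))

-- `lower₃` is for permutations without 2-cycles, whose moved points lie in orbits of at least three
-- elements. All bounds are sums, which avoids halves and thirds of truncated differences.
record IndexBounds {Ω : Setoid o e} (σ : Permutation Ω) (k f i : ℕ) : Set (o ⊔ e) where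
  open Setoid Ω
  open Inverse σ
  field
    hasIndex   : HasIndex σ i
    lower      : k ≤ i + i + f
    lower₃     : (∀ x → to (to x) ≈ x → to x ≈ x) → k + k ≤ i + i + i + (f + f)
    upper      : (∀ x → to (to x) ≈ x) → i + i + f ≤ k

module _ {Ω : Setoid o e} (σ : Permutation Ω) {k f} (Ω-finite : HasCardinality Ω k)
         (fixed-card : HasCardinality (FixedPoints σ) f) where
  open Setoid Ω
  open Inverse σ

  index-bounds : ∃ (IndexBounds σ k f)
  index-bounds = i , record
    { hasIndex = record { size = k ; orbitCount = r ; Ω-size = Ω-finite ; orbits-size = r-card ; index = ≡.refl }
    ; lower    = lower
    ; lower₃   = lower₃
    ; upper    = upper
    }
    where
    r i : ℕ
    r = proj₁ (orbits-finite σ Ω-finite)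
    r-card : HasCardinality (orbits σ) r
    r-card = proj₂ (orbits-finite σ Ω-finite)
    i = k ∸ r
    -- Representatives of distinct orbits are distinct points, so r ≤ k and the subtraction does not
    -- truncate.
    i+r≡k : i + r ≡ k
    i+r≡k = ℕ.m∸n+n≡m (injective⇒card-≤ r-card Ω-finite (canonical r-card) λ {x} {y} eq →
      Setoid.trans (orbits σ) (Setoid.sym (orbits σ) (canonical-≈ r-card x))
        (Setoid.trans (orbits σ) {j = canonical r-card y} (pos 0 , eq) (canonical-≈ r-card y)))
    open ℕ.≤-Reasoning
    lower : k ≤ i + i + f
    -- `orbits≤` with m = 1 reads 2 r ≤ k + f, and 2 k = 2 i + 2 r; adding 2 i and cancelling k
    -- leaves the claim. `lower₃` is the same with m = 2.
    lower = ℕ.+-cancelˡ-≤ (k + r) _ _ (begin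
      k + r + k                   ≡⟨ solve 2 (λ k r → k :+ r :+ k := k :+ k :+ r) ≡.refl k r ⟩
      k + k + r                   ≡⟨ ≡.cong (λ m → m + m + r) i+r≡k ⟨
      (i + r) + (i + r) + r       ≡⟨ solve 2 (λ i r → (i :+ r) :+ (i :+ r) :+ r := i :+ i :+ r :+ con 2 :* r) ≡.refl i r ⟩
      i + i + r + 2 * r           ≤⟨ ℕ.+-monoʳ-≤ (i + i + r) (orbits≤ σ Ω-finite r-card fixed-card 1 spread) ⟩
      i + i + r + (k + 1 * f)     ≡⟨ solve 4 (λ i r k f → i :+ i :+ r :+ (k :+ con 1 :* f) := k :+ r :+ (i :+ i :+ f)) ≡.refl i r k f ⟩
      k + r + (i + i + f)         ∎)
      where
      spread : ∀ x → ¬ to x ≈ x → ∀ (i j : Fin 2) → power σ (pos (toℕ i)) x ≈ power σ (pos (toℕ j)) x → i ≡ j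
      spread x x≉ zero       zero       eq = ≡.refl
      spread x x≉ zero       (suc zero) eq = contradiction (sym eq) x≉
      spread x x≉ (suc zero) zero       eq = contradiction eq x≉
      spread x x≉ (suc zero) (suc zero) eq = ≡.refl
    lower₃ : (∀ x → to (to x) ≈ x → to x ≈ x) → k + k ≤ i + i + i + (f + f)
    lower₃ no2 = ℕ.+-cancelˡ-≤ k _ _ (begin
      k + (k + k)                       ≡⟨ ≡.cong (λ m → m + (m + m)) i+r≡k ⟨
      (i + r) + ((i + r) + (i + r))     ≡⟨ solve 2 (λ i r → (i :+ r) :+ ((i :+ r) :+ (i :+ r)) := i :+ i :+ i :+ con 3 :* r) ≡.refl i r ⟩
      i + i + i + 3 * r                 ≤⟨ ℕ.+-monoʳ-≤ (i + i + i) (orbits≤ σ Ω-finite r-card fixed-card 2 spread) ⟩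
      i + i + i + (k + 2 * f)           ≡⟨ solve 3 (λ i k f → i :+ i :+ i :+ (k :+ con 2 :* f) := k :+ (i :+ i :+ i :+ (f :+ f))) ≡.refl i k f ⟩
      k + (i + i + i + (f + f))         ∎)
      where
      spread : ∀ x → ¬ to x ≈ x → ∀ (i j : Fin 3) → power σ (pos (toℕ i)) x ≈ power σ (pos (toℕ j)) x → i ≡ j
      spread x x≉ zero             zero             eq = ≡.refl
      spread x x≉ zero             (suc zero)       eq = contradiction (sym eq) x≉
      spread x x≉ zero             (suc (suc zero)) eq = contradiction (no2 x (sym eq)) x≉
      spread x x≉ (suc zero)       zero             eq = contradiction eq x≉
      spread x x≉ (suc zero)       (suc zero)       eq = ≡.refl
      spread x x≉ (suc zero)       (suc (suc zero)) eq = contradiction (σ-injective σ Ω-finite (sym eq)) x≉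
      spread x x≉ (suc (suc zero)) zero             eq = contradiction (no2 x eq) x≉
      spread x x≉ (suc (suc zero)) (suc zero)       eq = contradiction (σ-injective σ Ω-finite eq) x≉
      spread x x≉ (suc (suc zero)) (suc (suc zero)) eq = ≡.refl
    upper : (∀ x → to (to x) ≈ x) → i + i + f ≤ k
    upper invol = ℕ.+-cancelˡ-≤ (r + r) _ _ (begin
      r + r + (i + i + f)         ≡⟨ solve 3 (λ i r f → r :+ r :+ (i :+ i :+ f) := (i :+ r) :+ ((i :+ r) :+ f)) ≡.refl i r f ⟩
      (i + r) + ((i + r) + f)     ≡⟨ ≡.cong (λ m → m + (m + f)) i+r≡k ⟩
      k + (k + f)                 ≤⟨ ℕ.+-monoʳ-≤ k (involution-orbits≥ σ Ω-finite r-card fixed-card invol) ⟩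
      k + (r + r)                 ≡⟨ ℕ.+-comm k (r + r) ⟩
      r + r + k                   ∎)

-- Vector spaces over a finite field

∃? : {S : Setoid o e} → ∀ {k} → HasCardinality S k → {P : Setoid.Carrier S → Set p₁} →
     P Respects (Setoid._≈_ S) → (∀ x → Dec (P x)) → Dec (∃ P)
∃? {S = S} S-finite resp P? = map′ (λ (i , Pi) → from i , Pi) (λ (x , Px) → to x , resp (sym (strictlyInverseʳ x)) Px)
  (Fin.any? (P? ∘ from))
  where
  open Inverse S-finite
  open Setoid S using (sym)

funToFin-cong : ∀ {m n} {f g : Fin m → Fin n} → (∀ i → f i ≡ g i) → funToFin f ≡ funToFin g
funToFin-cong {zero}  eq = ≡.refl
funToFin-cong {suc m} eq = ≡.cong₂ combine (eq zero) (funToFin-cong (eq ∘ suc))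

-- The linear algebra sees the prime field only through its order, its finiteness and its inverses,
-- so residue arithmetic stays out of the proofs; `primeField` is the instance.
record FiniteField c e : Set (lsuc (c ⊔ e)) where
  field
    commutativeRing : CommutativeRing c e
  open CommutativeRing commutativeRing public hiding (zero) renaming (_+_ to _⊕_; _*_ to _⊗_)
  field
    order     : ℕ
    finite    : HasCardinality setoid order
    1≉0       : ¬ 1# ≈ 0#
    invertible : ∀ k → ¬ k ≈ 0# → ∃[ h ] h ⊗ k ≈ 1#

  _≈?_ : Decidable _≈_
  _≈?_ = decide-≈ finite

module Vectors (F : FiniteField c e) (M : LeftModule (FiniteField.ring F) a b) where
  open FiniteField F
  open LeftModule M public
  open AbelianGroupProperties +ᴹ-abelianGroup public
    using () renaming (∙-cancelˡ to +ᴹ-cancelˡ; ∙-cancelʳ to +ᴹ-cancelʳ; x∙y⁻¹≈ε⇒x≈y to x-y≈0⇒x≈y; //-rightDividesˡ to x-y+y≈x; //-rightDividesʳ to x+y-y≈x; ⁻¹-∙-comm to -ᴹ-+ᴹ-comm)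
  open CommutativeSemigroupProperties (CommutativeMonoid.commutativeSemigroup +ᴹ-commutativeMonoid) public
    using (interchange)
  open RingProperties ring using (-‿distribˡ-*)
  open AbelianGroupProperties +-abelianGroup using () renaming (x∙y⁻¹≈ε⇒x≈y to k-h≈0⇒k≈h)
  open SetoidReasoning ≈ᴹ-setoid

  infixl 6 _-ᴹ_
  _-ᴹ_ : Carrierᴹ → Carrierᴹ → Carrierᴹ
  x -ᴹ y = x +ᴹ -ᴹ y

  -ᴹ‿distribˡ-*ₗ : ∀ k x → -ᴹ (k *ₗ x) ≈ᴹ (- k) *ₗ x
  -ᴹ‿distribˡ-*ₗ k x = ≈ᴹ-sym (AbelianGroupProperties.inverseˡ-unique +ᴹ-abelianGroup _ _
    (≈ᴹ-trans (≈ᴹ-sym (*ₗ-distribʳ x (- k) k)) (≈ᴹ-trans (*ₗ-congʳ (-‿inverseˡ k)) (*ₗ-zeroˡ x))))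

  -ᴹ‿distribʳ-*ₗ : ∀ k x → -ᴹ (k *ₗ x) ≈ᴹ k *ₗ -ᴹ x
  -ᴹ‿distribʳ-*ₗ k x = ≈ᴹ-sym (AbelianGroupProperties.inverseˡ-unique +ᴹ-abelianGroup _ _
    (≈ᴹ-trans (≈ᴹ-sym (*ₗ-distribˡ k (-ᴹ x) x)) (≈ᴹ-trans (*ₗ-congˡ (-ᴹ‿inverseˡ x)) (*ₗ-zeroʳ k))))

  *ₗ-distribʳ-- : ∀ k h x → (k - h) *ₗ x ≈ᴹ k *ₗ x -ᴹ h *ₗ x
  *ₗ-distribʳ-- k h x = ≈ᴹ-trans (*ₗ-distribʳ x k (- h)) (+ᴹ-congˡ (≈ᴹ-sym (-ᴹ‿distribˡ-*ₗ h x)))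

  *ₗ-distribˡ-- : ∀ k x y → k *ₗ (x -ᴹ y) ≈ᴹ k *ₗ x -ᴹ k *ₗ y
  *ₗ-distribˡ-- k x y = ≈ᴹ-trans (*ₗ-distribˡ k x (-ᴹ y)) (+ᴹ-congˡ (≈ᴹ-sym (-ᴹ‿distribʳ-*ₗ k y)))

  *ₗ-comm : ∀ k h x → k *ₗ (h *ₗ x) ≈ᴹ h *ₗ (k *ₗ x)
  *ₗ-comm k h x = ≈ᴹ-trans (≈ᴹ-sym (*ₗ-assoc k h x)) (≈ᴹ-trans (*ₗ-congʳ (*-comm k h)) (*ₗ-assoc h k x))

  -- For two decompositions of one vector: the difference of the second parts equals a difference of
  -- first parts, and so inherits membership in the subspace of the first parts.
  +ᴹ-exchange : ∀ {x y z w} → x +ᴹ y ≈ᴹ z +ᴹ w → y -ᴹ w ≈ᴹ z -ᴹ x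
  +ᴹ-exchange {x} {y} {z} {w} eq = +ᴹ-cancelʳ w _ _ (+ᴹ-cancelˡ x _ _ (begin
    x +ᴹ (y -ᴹ w +ᴹ w)        ≈⟨ +ᴹ-congˡ (x-y+y≈x w y) ⟩
    x +ᴹ y                    ≈⟨ eq ⟩
    z +ᴹ w                    ≈⟨ +ᴹ-congʳ (x-y+y≈x x z) ⟨
    (z -ᴹ x +ᴹ x) +ᴹ w        ≈⟨ +ᴹ-congʳ (+ᴹ-comm (z -ᴹ x) x) ⟩
    (x +ᴹ (z -ᴹ x)) +ᴹ w      ≈⟨ +ᴹ-assoc x _ w ⟩
    x +ᴹ (z -ᴹ x +ᴹ w)        ∎))

  k-h≉0 : ∀ {k h} → ¬ k ≈ h → ¬ k - h ≈ 0#
  k-h≉0 k≉h eq = k≉h (k-h≈0⇒k≈h _ _ eq)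

  *ₗ-inverse : ∀ {k h} → h ⊗ k ≈ 1# → ∀ x → h *ₗ (k *ₗ x) ≈ᴹ x
  *ₗ-inverse {k} {h} hk≈1 x = ≈ᴹ-trans (≈ᴹ-sym (*ₗ-assoc h k x)) (≈ᴹ-trans (*ₗ-congʳ hk≈1) (*ₗ-identityˡ x))

  *ₗ-cancelˡ : ∀ {k x y} → ¬ k ≈ 0# → k *ₗ x ≈ᴹ k *ₗ y → x ≈ᴹ y
  *ₗ-cancelˡ {k} {x} {y} k≉0 eq = let (_ , hk≈1) = invertible k k≉0 in
    ≈ᴹ-trans (≈ᴹ-sym (*ₗ-inverse hk≈1 x)) (≈ᴹ-trans (*ₗ-congˡ eq) (*ₗ-inverse hk≈1 y))

  kx≈0⇒x≈0 : ∀ {k x} → ¬ k ≈ 0# → k *ₗ x ≈ᴹ 0ᴹ → x ≈ᴹ 0ᴹ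
  kx≈0⇒x≈0 {k} k≉0 eq = *ₗ-cancelˡ k≉0 (≈ᴹ-trans eq (≈ᴹ-sym (*ₗ-zeroʳ k)))

  kx≈hx⇒x≈0 : ∀ {k h x} → ¬ k ≈ h → k *ₗ x ≈ᴹ h *ₗ x → x ≈ᴹ 0ᴹ
  kx≈hx⇒x≈0 {k} {h} {x} k≉h eq = kx≈0⇒x≈0 (k-h≉0 k≉h) (≈ᴹ-trans (*ₗ-distribʳ-- k h x)
    (≈ᴹ-trans (+ᴹ-congʳ eq) (-ᴹ‿inverseʳ (h *ₗ x))))

  kx≈hx⇒k≈h : ∀ {k h x} → ¬ x ≈ᴹ 0ᴹ → k *ₗ x ≈ᴹ h *ₗ x → k ≈ h
  kx≈hx⇒k≈h {k} {h} x≉0 eq with k ≈? h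
  ... | yes k≈h = k≈h
  ... | no  k≉h = contradiction (kx≈hx⇒x≈0 k≉h eq) x≉0

  module _ {d} {v : Vector Carrierᴹ d} (isBasis : IsBasis M v) where
    open IsBasis isBasis
    open CommutativeMonoidSum +ᴹ-commutativeMonoid using (sum-cong-≋; ∑-distrib-+)

    private
      lc : Vector Carrier d → Carrierᴹ
      lc k = linearCombination M k v

      lc-cong : ∀ {k h} → (∀ i → k i ≈ h i) → lc k ≈ᴹ lc h
      lc-cong eq = sum-cong-≋ (λ i → *ₗ-congʳ (eq i))

      lc-injective : ∀ {k h} → lc k ≈ᴹ lc h → ∀ i → k i ≈ h i
      lc-injective {k} {h} eq i = k-h≈0⇒k≈h _ _ (independent (λ i → k i - h i) (+ᴹ-cancelʳ (lc h) _ _ (begin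
        lc (λ i → k i - h i) +ᴹ lc h   ≈⟨ ∑-distrib-+ {d} (λ i → (k i - h i) *ₗ v i) (λ i → h i *ₗ v i) ⟨
        _                              ≈⟨ sum-cong-≋ (λ i → ≈ᴹ-trans (+ᴹ-congʳ (*ₗ-distribʳ-- (k i) (h i) (v i))) (x-y+y≈x _ _)) ⟩
        lc k                           ≈⟨ eq ⟩
        lc h                           ≈⟨ +ᴹ-identityˡ _ ⟨
        0ᴹ +ᴹ lc h                     ∎)) i)

      coordinates : Carrierᴹ → Vector Carrier d
      coordinates x = proj₁ (spanning x)

      module 𝔽 = Inverse finite

    -- `spanning` chooses coordinates without promising equal ones for equal vectors. Independence,
    -- through `lc-injective`, makes the choice well defined.
    basis⇒finite : HasCardinality ≈ᴹ-setoid (order ^ d)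
    basis⇒finite = record
      { to        = index
      ; from      = vector
      ; to-cong   = index-cong
      ; from-cong = λ { ≡.refl → ≈ᴹ-refl }
      ; inverse   = (λ {i} {x} x≈ → ≡.trans (index-cong x≈) (index-vector i))
                  , (λ { {x} ≡.refl → vector-index x })
      }
      where
      index : Carrierᴹ → Fin (order ^ d)
      index x = funToFin (𝔽.to ∘ coordinates x)
      vector : Fin (order ^ d) → Carrierᴹ
      vector i = lc (𝔽.from ∘ finToFun i)
      index-cong : ∀ {x y} → x ≈ᴹ y → index x ≡ index y
      index-cong {x} {y} x≈y = funToFin-cong λ i → 𝔽.to-cong (lc-injective
        (≈ᴹ-trans (proj₂ (spanning x)) (≈ᴹ-trans x≈y (≈ᴹ-sym (proj₂ (spanning y))))) i)
      vector-index : ∀ x → vector (index x) ≈ᴹ x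
      vector-index x = ≈ᴹ-trans (lc-cong λ i → trans (𝔽.from-cong (Fin.finToFun-funToFin (𝔽.to ∘ coordinates x) i))
        (𝔽.strictlyInverseʳ (coordinates x i))) (proj₂ (spanning x))
      index-vector : ∀ i → index (vector i) ≡ i
      index-vector i = ≡.trans (funToFin-cong λ j → ≡.trans
          (𝔽.to-cong (lc-injective (proj₂ (spanning (vector i))) j)) (𝔽.strictlyInverseˡ _))
        (Fin.funToFin-finToFin {d} i)

  -- Subspaces measured by their orders

  module Finite {m} (V-finite : HasCardinality ≈ᴹ-setoid m) where
    _≟ᴹ_ : Decidable _≈ᴹ_
    _≟ᴹ_ = decide-≈ V-finite

    record Subspace p₁ : Set (a ⊔ b ⊔ c ⊔ lsuc p₁) where
      field
        Member  : Carrierᴹ → Set p₁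
        resp    : Member Respects _≈ᴹ_
        0ᴹ∈     : Member 0ᴹ
        +ᴹ∈     : ∀ {x y} → Member x → Member y → Member (x +ᴹ y)
        *ₗ∈     : ∀ k {x} → Member x → Member (k *ₗ x)
        Member? : ∀ x → Dec (Member x)

      -ᴹ∈ : ∀ {x y} → Member x → Member y → Member (x -ᴹ y)
      -ᴹ∈ {x} {y} x∈ y∈ = +ᴹ∈ x∈ (resp (≈ᴹ-trans (≈ᴹ-sym (-ᴹ‿distribˡ-*ₗ 1# y)) (-ᴹ‿cong (*ₗ-identityˡ y))) (*ₗ∈ (- 1#) y∈))

      asSetoid : Setoid (a ⊔ p₁) b
      asSetoid = Sub ≈ᴹ-setoid Member

      -- Abstract so that the enumeration is never unfolded.
      abstract
        subspace-finite : ∃ (HasCardinality asSetoid)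
        subspace-finite = finite-sub (m , V-finite) resp Member?

      ∣_∣ : ℕ
      ∣_∣ = proj₁ subspace-finite

      card : HasCardinality asSetoid ∣_∣
      card = proj₂ subspace-finite

    open Subspace using (Member; ∣_∣; card)

    infix 4 _⊆_
    _⊆_ : Subspace p₁ → Subspace p₂ → Set _
    W ⊆ U = ∀ {x} → Member W x → Member U x

    ∣∣-mono : (W : Subspace p₁) (U : Subspace p₂) → W ⊆ U → ∣ W ∣ ≤ ∣ U ∣
    ∣∣-mono W U W⊆U = injective⇒card-≤ (card W) (card U) (λ (x , x∈W) → x , W⊆U x∈W) id

    ∣∣≤m : (W : Subspace p₁) → ∣ W ∣ ≤ m
    ∣∣≤m W = injective⇒card-≤ (card W) V-finite proj₁ id

    -- Finiteness turns a failed inclusion into an actual vector, which is the next one to adjoin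
    -- when a subspace is enlarged.
    exceeds : (U : Subspace p₁) (W : Subspace p₂) → U ⊆ W ⊎ ∃ λ x → Member U x × ¬ Member W x
    exceeds U W with all-or-counterexample V-finite {P = λ x → Member U x → Member W x}
      (λ x≈y U⇒W y∈U → W.resp x≈y (U⇒W (U.resp (≈ᴹ-sym x≈y) y∈U))) (λ x → U.Member? x →-dec W.Member? x)
      where
      module U = Subspace U
      module W = Subspace W
    ... | inj₁ U⊆W = inj₁ λ {x} → U⊆W x
    ... | inj₂ (x , ¬U⇒W) with Subspace.Member? U x
    ... | yes x∈U = inj₂ (x , x∈U , λ x∈W → ¬U⇒W λ _ → x∈W)
    ... | no  x∉U = contradiction (λ x∈U → contradiction x∈U x∉U) ¬U⇒W

    zeroSubspace : Subspace b
    zeroSubspace = record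
      { Member  = _≈ᴹ 0ᴹ
      ; resp    = λ x≈y x≈0 → ≈ᴹ-trans (≈ᴹ-sym x≈y) x≈0
      ; 0ᴹ∈     = ≈ᴹ-refl
      ; +ᴹ∈     = λ x≈0 y≈0 → ≈ᴹ-trans (+ᴹ-cong x≈0 y≈0) (+ᴹ-identityˡ 0ᴹ)
      ; *ₗ∈     = λ k x≈0 → ≈ᴹ-trans (*ₗ-congˡ x≈0) (*ₗ-zeroʳ k)
      ; Member? = _≟ᴹ 0ᴹ
      }

    wholeSpace : Subspace 0ℓ
    wholeSpace = record
      { Member = λ _ → ⊤ ; resp = _ ; 0ᴹ∈ = tt ; +ᴹ∈ = _ ; *ₗ∈ = _ ; Member? = λ _ → yes tt }

    m≤∣wholeSpace∣ : m ≤ ∣ wholeSpace ∣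
    m≤∣wholeSpace∣ = injective⇒card-≤ V-finite (card wholeSpace) (λ x → x , _) id

    infixl 6 _+⟨_⟩
    _+⟨_⟩ : Subspace p₁ → Carrierᴹ → Subspace (a ⊔ b ⊔ c ⊔ p₁)
    W +⟨ u ⟩ = record
      { Member  = λ x → ∃[ k ] ∃[ w ] W.Member w × x ≈ᴹ w +ᴹ k *ₗ u
      ; resp    = λ x≈y (k , w , w∈ , eq) → k , w , w∈ , ≈ᴹ-trans (≈ᴹ-sym x≈y) eq
      ; 0ᴹ∈     = 0# , 0ᴹ , W.0ᴹ∈ , ≈ᴹ-sym (≈ᴹ-trans (+ᴹ-identityˡ _) (*ₗ-zeroˡ u))
      ; +ᴹ∈     = λ (k , w , w∈ , eq) (h , z , z∈ , eq′) → k ⊕ h , w +ᴹ z , W.+ᴹ∈ w∈ z∈ ,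
                    ≈ᴹ-trans (+ᴹ-cong eq eq′) (≈ᴹ-trans (interchange w _ z _) (+ᴹ-congˡ (≈ᴹ-sym (*ₗ-distribʳ u k h))))
      ; *ₗ∈     = λ r (k , w , w∈ , eq) → r ⊗ k , r *ₗ w , W.*ₗ∈ r w∈ ,
                    ≈ᴹ-trans (*ₗ-congˡ eq) (≈ᴹ-trans (*ₗ-distribˡ r w _) (+ᴹ-congˡ (≈ᴹ-sym (*ₗ-assoc r k u))))
      ; Member? = λ x → map′ (λ (k , x-ku∈) → k , x -ᴹ k *ₗ u , x-ku∈ , ≈ᴹ-sym (x-y+y≈x (k *ₗ u) x))
                             (λ (k , w , w∈ , eq) → k , W.resp (≈ᴹ-trans (≈ᴹ-sym (x+y-y≈x (k *ₗ u) w)) (+ᴹ-congʳ (≈ᴹ-sym eq))) w∈)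
                             (∃? finite (λ k≈h → W.resp (+ᴹ-congˡ (-ᴹ‿cong (*ₗ-congʳ k≈h)))) (λ k → W.Member? (x -ᴹ k *ₗ u)))
      }
      where module W = Subspace W

    +⟨⟩-⊆ : (W : Subspace p₁) (U : Subspace p₂) → W ⊆ U → ∀ {u} → Member U u → W +⟨ u ⟩ ⊆ U
    +⟨⟩-⊆ W U W⊆U u∈U (k , w , w∈W , eq) = U.resp (≈ᴹ-sym eq) (U.+ᴹ∈ (W⊆U w∈W) (U.*ₗ∈ k u∈U))
      where module U = Subspace U

    ∣+⟨⟩∣≥ : (W : Subspace p₁) {u : Carrierᴹ} → ¬ Member W u → ∣ W ∣ * order ≤ ∣ W +⟨ u ⟩ ∣
    ∣+⟨⟩∣≥ W {u} u∉W = injective⇒card-≤ (card-× (card W) finite) (card (W +⟨ u ⟩))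
      (λ ((w , w∈) , k) → w +ᴹ k *ₗ u , k , w , w∈ , ≈ᴹ-refl) λ {((w , w∈) , k)} {((z , z∈) , h)} → injective w∈ z∈
      where
      module W = Subspace W
      injective : ∀ {w z k h} → Member W w → Member W z → w +ᴹ k *ₗ u ≈ᴹ z +ᴹ h *ₗ u → w ≈ᴹ z × k ≈ h
      injective {w} {z} {k} {h} w∈ z∈ eq with k ≈? h
      ... | yes k≈h = +ᴹ-cancelʳ (k *ₗ u) w z (≈ᴹ-trans eq (+ᴹ-congˡ (*ₗ-congʳ (sym k≈h)))) , k≈h
      -- If k ≠ h, then (k - h) u = z - w lies in `W`, and dividing by k - h puts u there.
      ... | no  k≉h = contradiction
        (W.resp (*ₗ-inverse (proj₂ (invertible _ (k-h≉0 k≉h))) u)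
          (W.*ₗ∈ _ (W.resp (≈ᴹ-trans (≈ᴹ-sym (+ᴹ-exchange eq)) (≈ᴹ-sym (*ₗ-distribʳ-- k h u))) (W.-ᴹ∈ z∈ w∈)))) u∉W

    ∣+⟨⟩∣≤ : (W : Subspace p₁) (u : Carrierᴹ) → ∣ W +⟨ u ⟩ ∣ ≤ ∣ W ∣ * order
    ∣+⟨⟩∣≤ W u = injective⇒card-≤ (card (W +⟨ u ⟩)) (card-× (card W) finite)
      (λ (_ , k , w , w∈ , _) → (w , w∈) , k) λ {(x , _ , _ , _ , eq)} {(y , _ , _ , _ , eq′)} (w≈z , k≈h) →
        ≈ᴹ-trans eq (≈ᴹ-trans (+ᴹ-cong w≈z (*ₗ-congʳ k≈h)) (≈ᴹ-sym eq′))

    1≤∣∣ : (W : Subspace p₁) → 1 ≤ ∣ W ∣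
    1≤∣∣ W = injective⇒card-≤ (card-Fin 1) (card W) (λ _ → 0ᴹ , Subspace.0ᴹ∈ W) λ { {zero} {zero} _ → ≡.refl }

    module _ {X : Setoid o₁ e₁} {k} (X-card : HasCardinality X k) (W : Subspace p₁) where
      private
        module X = Setoid X

      -- The groups act on nonzero vectors and lines, whereas the bounds concern orders of
      -- subspaces. The additional element is the zero vector; `nonzeros≥` is the converse passage.
      nonzeros≤ : (ι : X.Carrier → Carrierᴹ) → InjectiveOn X ≈ᴹ-setoid ι →
                  (∀ x → ¬ ι x ≈ᴹ 0ᴹ) → (∀ x → Member W (ι x)) → k + 1 ≤ ∣ W ∣
      nonzeros≤ ι ι-injective ι≉0 ι∈W = injective⇒card-≤ (card-⊎ X-card (card-Fin 1)) (card W) place λ {x} {y} → injective x y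
        where
        module S = Setoid (X ⊎ₛ ≡.setoid (Fin 1))
        place : S.Carrier → ∃ (Member W)
        place (inj₁ x) = ι x , ι∈W x
        place (inj₂ _) = 0ᴹ , Subspace.0ᴹ∈ W
        injective : ∀ x y → proj₁ (place x) ≈ᴹ proj₁ (place y) → x S.≈ y
        injective (inj₁ x)    (inj₁ y)    eq = inj₁ (ι-injective eq)
        injective (inj₁ x)    (inj₂ _)    eq = contradiction eq (ι≉0 x)
        injective (inj₂ _)    (inj₁ y)    eq = contradiction (≈ᴹ-sym eq) (ι≉0 y)
        injective (inj₂ zero) (inj₂ zero) _  = inj₂ ≡.refl

      nonzeros≥ : (κ : ∀ {x} → Member W x → ¬ x ≈ᴹ 0ᴹ → X.Carrier) →
                  (∀ {x y} {x∈ : Member W x} {y∈ : Member W y} {x≉0 y≉0} → κ x∈ x≉0 X.≈ κ y∈ y≉0 → x ≈ᴹ y) → ∣ W ∣ ≤ k + 1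
      nonzeros≥ κ κ-injective = injective⇒card-≤ (card W) (card-⊎ X-card (card-Fin 1)) place λ {x} {y} → injective x y
        where
        module T = Setoid (X ⊎ₛ ≡.setoid (Fin 1))
        place : ∃ (Member W) → T.Carrier
        place (x , x∈) with x ≟ᴹ 0ᴹ
        ... | yes _   = inj₂ zero
        ... | no  x≉0 = inj₁ (κ x∈ x≉0)
        injective : ∀ x y → place x T.≈ place y → proj₁ x ≈ᴹ proj₁ y
        injective (x , x∈) (y , y∈) eq with x ≟ᴹ 0ᴹ | y ≟ᴹ 0ᴹ | eq
        ... | yes x≈0 | yes y≈0 | _      = ≈ᴹ-trans x≈0 (≈ᴹ-sym y≈0)
        ... | no  _   | no  _   | inj₁ eq = κ-injective eq
        ... | yes _   | no  _   | ()
        ... | no  _   | yes _   | ()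

    -- Codimension 0, 1 and at least 2. A hyperplane keeps its complementary vector `u` because
    -- orthogonality to everything will be tested on `W` and `u`.
    data Codimension (W : Subspace p₁) : Set (a ⊔ b ⊔ c ⊔ p₁) where
      whole      : (∀ x → Member W x) → Codimension W
      hyperplane : ∀ u → ¬ Member W u → (∀ x → Member (W +⟨ u ⟩) x) → ∣ W ∣ * order ≤ m → m ≤ ∣ W ∣ * order → Codimension W
      deep       : ∣ W ∣ * order * order ≤ m → Codimension W

    codimension : (W : Subspace p₁) → Codimension W
    codimension W with exceeds wholeSpace W
    ... | inj₁ V⊆W = whole λ x → V⊆W _
    ... | inj₂ (u , _ , u∉W) with exceeds wholeSpace (W +⟨ u ⟩)
    ... | inj₁ V⊆W+u = hyperplane u u∉W (λ x → V⊆W+u _) (ℕ.≤-trans (∣+⟨⟩∣≥ W u∉W) (∣∣≤m (W +⟨ u ⟩)))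
                         (ℕ.≤-trans (injective⇒card-≤ V-finite (card (W +⟨ u ⟩)) (λ x → x , V⊆W+u _) id) (∣+⟨⟩∣≤ W u))
    ... | inj₂ (v , _ , v∉W+u) = deep (ℕ.≤-trans (ℕ.*-monoˡ-≤ order (∣+⟨⟩∣≥ W u∉W))
                         (ℕ.≤-trans (∣+⟨⟩∣≥ (W +⟨ u ⟩) v∉W+u) (∣∣≤m (W +⟨ u ⟩ +⟨ v ⟩))))

    data Dimension (W : Subspace p₁) : Set (a ⊔ b ⊔ c ⊔ p₁) where
      point : (∀ {x} → Member W x → x ≈ᴹ 0ᴹ) → Dimension W
      line  : ∀ u → (∀ {x} → Member W x → ∃[ k ] x ≈ᴹ k *ₗ u) → order ≤ ∣ W ∣ → Dimension W
      plane : order * order ≤ ∣ W ∣ → Dimension W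

    dimension : (W : Subspace p₁) → Dimension W
    dimension W with exceeds W zeroSubspace
    ... | inj₁ W⊆0 = point W⊆0
    ... | inj₂ (u , u∈W , u≉0) = case exceeds W ⟨u⟩ of λ where
        (inj₁ W⊆⟨u⟩) → line u (λ x∈W → let (k , w , w≈0 , eq) = W⊆⟨u⟩ x∈W in
          k , ≈ᴹ-trans eq (≈ᴹ-trans (+ᴹ-congʳ w≈0) (+ᴹ-identityˡ _))) (ℕ.≤-trans q≤∣⟨u⟩∣ (∣∣-mono ⟨u⟩ W ⟨u⟩⊆W))
        (inj₂ (v , v∈W , v∉⟨u⟩)) → plane (ℕ.≤-trans (ℕ.*-monoˡ-≤ order q≤∣⟨u⟩∣)
          (ℕ.≤-trans (∣+⟨⟩∣≥ ⟨u⟩ v∉⟨u⟩) (∣∣-mono (⟨u⟩ +⟨ v ⟩) W (+⟨⟩-⊆ ⟨u⟩ W ⟨u⟩⊆W v∈W))))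
      where
      ⟨u⟩ : Subspace (a ⊔ b ⊔ c)
      ⟨u⟩ = zeroSubspace +⟨ u ⟩
      ⟨u⟩⊆W : ⟨u⟩ ⊆ W
      ⟨u⟩⊆W = +⟨⟩-⊆ zeroSubspace W (λ x≈0 → Subspace.resp W (≈ᴹ-sym x≈0) (Subspace.0ᴹ∈ W)) u∈W
      q≤∣⟨u⟩∣ : order ≤ ∣ ⟨u⟩ ∣
      q≤∣⟨u⟩∣ = ℕ.≤-trans (ℕ.≤-reflexive (≡.sym (ℕ.*-identityˡ order)))
        (ℕ.≤-trans (ℕ.*-monoˡ-≤ order (1≤∣∣ zeroSubspace)) (∣+⟨⟩∣≥ zeroSubspace u≉0))

    -- Eigenspaces and counts of eigenvectors

    module Endomorphism {g : Carrierᴹ → Carrierᴹ} (isLinear : IsLeftModuleHomomorphism rawLeftModule rawLeftModule g) where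
      open IsLeftModuleHomomorphism isLinear

      eigenspace : Carrier → Subspace b
      eigenspace k = record
        { Member  = λ x → g x ≈ᴹ k *ₗ x
        ; resp    = λ x≈y eq → ≈ᴹ-trans (⟦⟧-cong (≈ᴹ-sym x≈y)) (≈ᴹ-trans eq (*ₗ-congˡ x≈y))
        ; 0ᴹ∈     = ≈ᴹ-trans 0ᴹ-homo (≈ᴹ-sym (*ₗ-zeroʳ k))
        ; +ᴹ∈     = λ {x} {y} x∈ y∈ → ≈ᴹ-trans (+ᴹ-homo x y) (≈ᴹ-trans (+ᴹ-cong x∈ y∈) (≈ᴹ-sym (*ₗ-distribˡ k x y)))
        ; *ₗ∈     = λ r {x} x∈ → ≈ᴹ-trans (*ₗ-homo r x) (≈ᴹ-trans (*ₗ-congˡ x∈) (*ₗ-comm r k x))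
        ; Member? = λ x → g x ≟ᴹ (k *ₗ x)
        }

      IsEigenvector : Carrierᴹ → Set _
      IsEigenvector x = ∃[ k ] g x ≈ᴹ k *ₗ x

      IsEigenvector? : ∀ x → Dec (IsEigenvector x)
      IsEigenvector? x = ∃? finite (λ k≈h eq → ≈ᴹ-trans eq (*ₗ-congʳ k≈h)) (λ k → g x ≟ᴹ (k *ₗ x))

      -- Zero would be an eigenvector for every eigenvalue. For an invertible `g` the vectors that
      -- remain are the nonzero vectors on the lines fixed by `g`.
      NonzeroEigenvectors : Setoid _ _
      NonzeroEigenvectors = Sub ≈ᴹ-setoid λ x → ¬ x ≈ᴹ 0ᴹ × IsEigenvector x

      module _ (k : Carrier) where
        private
          E : Subspace b
          E = eigenspace k
          module E = Subspace E

        -- A union of eigenspaces, zero included, and in general not closed under addition; hence a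
        -- predicate that is counted directly and not a `Subspace`.
        OtherEigenvector : Carrierᴹ → Set _
        OtherEigenvector x = ∃[ h ] ¬ h ≈ k × g x ≈ᴹ h *ₗ x

        OtherEigenvectors : Setoid _ _
        OtherEigenvectors = Sub ≈ᴹ-setoid OtherEigenvector

        abstract
          otherEigenvectors-finite : ∃ (HasCardinality OtherEigenvectors)
          otherEigenvectors-finite = finite-sub (m , V-finite)
            (λ x≈y (h , h≉k , eq) → h , h≉k , ≈ᴹ-trans (⟦⟧-cong (≈ᴹ-sym x≈y)) (≈ᴹ-trans eq (*ₗ-congˡ x≈y)))
            (λ x → ∃? finite (λ h≈h′ (h≉k , eq) → (λ h′≈k → h≉k (trans h≈h′ h′≈k)) , ≈ᴹ-trans eq (*ₗ-congʳ h≈h′))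
                             (λ h → ¬? (h ≈? k) ×-dec g x ≟ᴹ (h *ₗ x)))

        ∣others∣ : ℕ
        ∣others∣ = proj₁ otherEigenvectors-finite

        0-other : OtherEigenvector 0ᴹ
        -- Zero needs some eigenvalue different from k, and 1 + k always is one.
        0-other = 1# ⊕ k , (λ eq → 1≉0 (AbelianGroupProperties.identityˡ-unique +-abelianGroup 1# k eq))
                , Subspace.0ᴹ∈ (eigenspace (1# ⊕ k))

        -- (k − h) z = (h − h′) y and its image under g give (k − h) k z = (k − h) h′ z.
        eigenvector-difference : ∀ {z y y′ h h′} → z +ᴹ y ≈ᴹ y′ → g z ≈ᴹ k *ₗ z → g y ≈ᴹ h′ *ₗ y → g y′ ≈ᴹ h *ₗ y′ →
                                 ¬ h ≈ k → ¬ h′ ≈ k → z ≈ᴹ 0ᴹ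
        eigenvector-difference {z} {y} {y′} {h} {h′} z+y≈y′ z∈ gy gy′ h≉k h′≉k =
          kx≈hx⇒x≈0 (λ k≈h′ → h′≉k (sym k≈h′)) (*ₗ-cancelˡ (k-h≉0 λ k≈h → h≉k (sym k≈h)) (begin
            (k - h) *ₗ (k *ₗ z)       ≈⟨ *ₗ-congˡ z∈ ⟨
            (k - h) *ₗ g z            ≈⟨ *ₗ-homo _ z ⟨
            g ((k - h) *ₗ z)          ≈⟨ ⟦⟧-cong relation ⟩
            g ((h - h′) *ₗ y)         ≈⟨ *ₗ-homo _ y ⟩
            (h - h′) *ₗ g y           ≈⟨ *ₗ-congˡ gy ⟩
            (h - h′) *ₗ (h′ *ₗ y)     ≈⟨ *ₗ-comm _ _ y ⟩
            h′ *ₗ ((h - h′) *ₗ y)     ≈⟨ *ₗ-congˡ relation ⟨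
            h′ *ₗ ((k - h) *ₗ z)      ≈⟨ *ₗ-comm _ _ z ⟩
            (k - h) *ₗ (h′ *ₗ z)      ∎))
          where
          relation : (k - h) *ₗ z ≈ᴹ (h - h′) *ₗ y
          relation = begin
            (k - h) *ₗ z              ≈⟨ *ₗ-distribʳ-- k h z ⟩
            k *ₗ z -ᴹ h *ₗ z          ≈⟨ +ᴹ-exchange (begin
              h′ *ₗ y +ᴹ k *ₗ z         ≈⟨ +ᴹ-comm _ _ ⟩
              k *ₗ z +ᴹ h′ *ₗ y         ≈⟨ +ᴹ-cong z∈ gy ⟨
              g z +ᴹ g y                ≈⟨ +ᴹ-homo z y ⟨
              g (z +ᴹ y)                ≈⟨ ⟦⟧-cong z+y≈y′ ⟩
              g y′                      ≈⟨ gy′ ⟩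
              h *ₗ y′                   ≈⟨ *ₗ-congˡ z+y≈y′ ⟨
              h *ₗ (z +ᴹ y)             ≈⟨ *ₗ-distribˡ h z y ⟩
              h *ₗ z +ᴹ h *ₗ y          ≈⟨ +ᴹ-comm _ _ ⟩
              h *ₗ y +ᴹ h *ₗ z          ∎) ⟩
            h *ₗ y -ᴹ h′ *ₗ y         ≈⟨ *ₗ-distribʳ-- h h′ y ⟨
            (h - h′) *ₗ y             ∎

        -- If x + y = x′ + y′, then z = y - y′ lies in `E` and z + y′ = y. Both y and y′ are
        -- eigenvectors for eigenvalues other than k, possibly different ones, and
        -- `eigenvector-difference` still gives z = 0.
        ∣eigenspace∣*∣others∣≤m : ∣ E ∣ * ∣others∣ ≤ m
        ∣eigenspace∣*∣others∣≤m = injective⇒card-≤ (card-× (card E) (proj₂ otherEigenvectors-finite)) V-finite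
          (λ ((x , _) , (y , _)) → x +ᴹ y)
          λ {((x , x∈) , (y , h , h≉k , gy))} {((x′ , x′∈) , (y′ , h′ , h′≉k , gy′))} eq →
            let y-y′≈0 = eigenvector-difference (x-y+y≈x y′ y)
                           (E.resp (≈ᴹ-sym (+ᴹ-exchange eq)) (E.-ᴹ∈ x′∈ x∈)) gy′ gy h≉k h′≉k
                y≈y′ = x-y≈0⇒x≈y y y′ y-y′≈0
            in +ᴹ-cancelʳ y x x′ (≈ᴹ-trans eq (+ᴹ-congˡ (≈ᴹ-sym y≈y′))) , y≈y′

        -- The 2 accounts for zero, which lies in `E` and once more among the other eigenvectors.
        nonzeroEigenvectors≤ : ∀ {N} → HasCardinality NonzeroEigenvectors N → N + 2 ≤ ∣ E ∣ + ∣others∣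
        nonzeroEigenvectors≤ {N} N-card = injective⇒card-≤ (card-⊎ N-card (card-Fin 2))
          (card-⊎ (card E) (proj₂ otherEigenvectors-finite)) place λ {x} {y} → injective x y
          where
          module S = Setoid (NonzeroEigenvectors ⊎ₛ ≡.setoid (Fin 2))
          module T = Setoid (E.asSetoid ⊎ₛ OtherEigenvectors)
          place : S.Carrier → T.Carrier
          place (inj₁ (x , _ , h , gx)) with h ≈? k
          ... | yes h≈k = inj₁ (x , ≈ᴹ-trans gx (*ₗ-congʳ h≈k))
          ... | no  h≉k = inj₂ (x , h , h≉k , gx)
          place (inj₂ zero)       = inj₁ (0ᴹ , E.0ᴹ∈)
          place (inj₂ (suc zero)) = inj₂ (0ᴹ , 0-other)
          injective : ∀ x y → place x T.≈ place y → x S.≈ y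
          injective (inj₁ (x , x≉0 , h , gx)) (inj₁ (y , y≉0 , h′ , gy)) eq with h ≈? k | h′ ≈? k
          injective (inj₁ _) (inj₁ _) (inj₁ eq) | yes _ | yes _ = inj₁ eq
          injective (inj₁ _) (inj₁ _) (inj₂ eq) | no _ | no _ = inj₁ eq
          injective (inj₁ (x , x≉0 , h , gx)) (inj₂ zero) eq with h ≈? k
          injective (inj₁ (x , x≉0 , h , gx)) (inj₂ zero) (inj₁ eq) | yes _ = contradiction eq x≉0
          injective (inj₁ (x , x≉0 , h , gx)) (inj₂ (suc zero)) eq with h ≈? k
          injective (inj₁ (x , x≉0 , h , gx)) (inj₂ (suc zero)) (inj₂ eq) | no _ = contradiction eq x≉0
          injective (inj₂ zero) (inj₁ (y , y≉0 , h , gy)) eq with h ≈? k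
          injective (inj₂ zero) (inj₁ (y , y≉0 , h , gy)) (inj₁ eq) | yes _ = contradiction (≈ᴹ-sym eq) y≉0
          injective (inj₂ (suc zero)) (inj₁ (y , y≉0 , h , gy)) eq with h ≈? k
          injective (inj₂ (suc zero)) (inj₁ (y , y≉0 , h , gy)) (inj₂ eq) | no _ = contradiction (≈ᴹ-sym eq) y≉0
          injective (inj₂ zero)       (inj₂ zero)       _  = inj₂ ≡.refl
          injective (inj₂ zero)       (inj₂ (suc zero)) ()
          injective (inj₂ (suc zero)) (inj₂ zero)       ()
          injective (inj₂ (suc zero)) (inj₂ (suc zero)) _  = inj₂ ≡.refl

      -- An eigenvector is recorded by its eigenvalue and its coefficient along the generator for
      -- that eigenvalue. The eigenvalue is made canonical first, since `lines` may choose different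
      -- generators for equal eigenvalues.
      nonzeroEigenvectors≤q² : ∀ {N} → HasCardinality NonzeroEigenvectors N →
        (∀ k → ∃[ u ] ∀ {x} → Member (eigenspace k) x → ∃[ h ] x ≈ᴹ h *ₗ u) → N ≤ order * order
      nonzeroEigenvectors≤q² N-card lines = injective⇒card-≤ N-card (card-× finite finite)
        (λ v → eigenvalue v , proj₁ (coefficient v)) λ {v} {w} (k≈k′ , h≈h′) →
          ≈ᴹ-trans (proj₂ (coefficient v)) (≈ᴹ-trans (*ₗ-cong h≈h′
            (≈ᴹ-reflexive (≡.cong (λ r → proj₁ (lines r)) (eigenvalue-≡ v w k≈k′)))) (≈ᴹ-sym (proj₂ (coefficient w))))
        where
        eigenvalue : Setoid.Carrier NonzeroEigenvectors → Carrier
        eigenvalue (_ , _ , k , _) = canonical finite k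
        coefficient : (v : Setoid.Carrier NonzeroEigenvectors) → ∃[ h ] proj₁ v ≈ᴹ h *ₗ proj₁ (lines (eigenvalue v))
        coefficient (x , _ , k , gx) = proj₂ (lines (canonical finite k)) (≈ᴹ-trans gx (*ₗ-congʳ (sym (canonical-≈ finite k))))
        eigenvalue-≡ : ∀ v w → eigenvalue v ≈ eigenvalue w → eigenvalue v ≡ eigenvalue w
        eigenvalue-≡ (_ , _ , k , _) (_ , _ , h , _) eq = canonical-cong finite
          (trans (sym (canonical-≈ finite k)) (trans eq (canonical-≈ finite h)))

      nonzeroEigenvectors≡0 : ∀ {N} → HasCardinality NonzeroEigenvectors N →
        (∀ k {x} → Member (eigenspace k) x → x ≈ᴹ 0ᴹ) → N ≤ 0
      nonzeroEigenvectors≡0 N-card trivial = injective⇒card-≤ N-card (card-Fin 0)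
        (λ (x , x≉0 , k , gx) → contradiction (trivial k gx) x≉0) λ {(x , x≉0 , k , gx)} _ → contradiction (trivial k gx) x≉0

-- Alternating forms in odd characteristic

record SymplecticForm (F : FiniteField c e) (M : LeftModule (FiniteField.ring F) a b) : Set (a ⊔ b ⊔ c ⊔ e) where
  open FiniteField F
  open LeftModule M
  field
    ⟪_,_⟫   : Carrierᴹ → Carrierᴹ → Carrier
    ⟪⟫-cong : ∀ {x x′ y y′} → x ≈ᴹ x′ → y ≈ᴹ y′ → ⟪ x , y ⟫ ≈ ⟪ x′ , y′ ⟫
    ⟪⟫-+ˡ   : ∀ x y z → ⟪ x +ᴹ y , z ⟫ ≈ ⟪ x , z ⟫ ⊕ ⟪ y , z ⟫
    ⟪⟫-*ˡ   : ∀ k x y → ⟪ k *ₗ x , y ⟫ ≈ k ⊗ ⟪ x , y ⟫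
    ⟪⟫-+ʳ   : ∀ x y z → ⟪ x , y +ᴹ z ⟫ ≈ ⟪ x , y ⟫ ⊕ ⟪ x , z ⟫
    ⟪⟫-*ʳ   : ∀ k x y → ⟪ x , k *ₗ y ⟫ ≈ k ⊗ ⟪ x , y ⟫
    alternating   : ∀ x → ⟪ x , x ⟫ ≈ 0#
    nondegenerate : ∀ x → (∀ y → ⟪ x , y ⟫ ≈ 0#) → x ≈ᴹ 0ᴹ

module OddCharacteristic (F : FiniteField c e) (M : LeftModule (FiniteField.ring F) a b)
  (form : SymplecticForm F M) {m} (V-finite : HasCardinality (LeftModule.≈ᴹ-setoid M) m)
  (2≉0 : ¬ FiniteField._≈_ F (FiniteField._⊕_ F (FiniteField.1# F) (FiniteField.1# F)) (FiniteField.0# F)) where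
  open FiniteField F
  open Vectors F M
  open Finite V-finite
  open Subspace using (Member; ∣_∣)
  open SymplecticForm form
  open RingProperties ring using (-‿distribˡ-*; -‿distribʳ-*; -1*x≈-x)
  private
    module F = AbelianGroupProperties +-abelianGroup
    module R = SetoidReasoning setoid
    module E = SetoidReasoning ≈ᴹ-setoid
    open CommutativeSemigroupProperties (CommutativeMonoid.commutativeSemigroup +-commutativeMonoid)
      using () renaming (interchange to +-interchange)

  kr≈hr⇒r≈0 : ∀ {k h r} → ¬ k ≈ h → k ⊗ r ≈ h ⊗ r → r ≈ 0#
  kr≈hr⇒r≈0 {k} {h} {r} k≉h eq = let (k-h⁻¹ , inv) = invertible _ (k-h≉0 k≉h) in R.begin
    r                         R.≈⟨ *-identityˡ r ⟨
    1# ⊗ r                    R.≈⟨ *-congʳ inv ⟨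
    (k-h⁻¹ ⊗ (k - h)) ⊗ r     R.≈⟨ *-assoc _ _ r ⟩
    k-h⁻¹ ⊗ ((k - h) ⊗ r)     R.≈⟨ *-congˡ (distribʳ r k (- h)) ⟩
    k-h⁻¹ ⊗ (k ⊗ r ⊕ - h ⊗ r) R.≈⟨ *-congˡ (+-cong eq (sym (-‿distribˡ-* h r))) ⟩
    k-h⁻¹ ⊗ (h ⊗ r - h ⊗ r)   R.≈⟨ *-congˡ (-‿inverseʳ (h ⊗ r)) ⟩
    k-h⁻¹ ⊗ 0#                R.≈⟨ zeroʳ _ ⟩
    0#                        R.∎

  kr≈0⇒r≈0 : ∀ {k r} → ¬ k ≈ 0# → k ⊗ r ≈ 0# → r ≈ 0#
  kr≈0⇒r≈0 {k} {r} k≉0 eq = kr≈hr⇒r≈0 k≉0 (trans eq (sym (zeroˡ r)))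

  -- The one place where `2≉0` enters. It keeps transvections free of 2-cycles and separates the
  -- eigenvalues 1 and -1 of a reflection.
  x+x≈0⇒x≈0 : ∀ {x} → x +ᴹ x ≈ᴹ 0ᴹ → x ≈ᴹ 0ᴹ
  x+x≈0⇒x≈0 {x} eq = kx≈0⇒x≈0 2≉0 (≈ᴹ-trans (*ₗ-distribʳ x 1# 1#)
    (≈ᴹ-trans (+ᴹ-cong (*ₗ-identityˡ x) (*ₗ-identityˡ x)) eq))

  ⟪⟫-zeroˡ : ∀ x → ⟪ 0ᴹ , x ⟫ ≈ 0#
  ⟪⟫-zeroˡ x = trans (⟪⟫-cong (≈ᴹ-sym (*ₗ-zeroˡ 0ᴹ)) ≈ᴹ-refl) (trans (⟪⟫-*ˡ 0# 0ᴹ x) (zeroˡ _))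

  ⟪⟫-zeroʳ : ∀ x → ⟪ x , 0ᴹ ⟫ ≈ 0#
  ⟪⟫-zeroʳ x = trans (⟪⟫-cong ≈ᴹ-refl (≈ᴹ-sym (*ₗ-zeroˡ 0ᴹ))) (trans (⟪⟫-*ʳ 0# x 0ᴹ) (zeroˡ _))

  ⟪⟫--ˡ : ∀ x y z → ⟪ x -ᴹ y , z ⟫ ≈ ⟪ x , z ⟫ - ⟪ y , z ⟫
  ⟪⟫--ˡ x y z = trans (⟪⟫-+ˡ x (-ᴹ y) z) (+-congˡ (F.inverseˡ-unique _ _
    (trans (sym (⟪⟫-+ˡ (-ᴹ y) y z)) (trans (⟪⟫-cong (-ᴹ‿inverseˡ y) ≈ᴹ-refl) (⟪⟫-zeroˡ z)))))

  ⟪⟫--ʳ : ∀ x y z → ⟪ x , y -ᴹ z ⟫ ≈ ⟪ x , y ⟫ - ⟪ x , z ⟫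
  ⟪⟫--ʳ x y z = trans (⟪⟫-+ʳ x y (-ᴹ z)) (+-congˡ (F.inverseˡ-unique _ _
    (trans (sym (⟪⟫-+ʳ x (-ᴹ z) z)) (trans (⟪⟫-cong ≈ᴹ-refl (-ᴹ‿inverseˡ z)) (⟪⟫-zeroʳ x)))))

  skew : ∀ x y → ⟪ x , y ⟫ ≈ - ⟪ y , x ⟫
  skew x y = F.inverseˡ-unique _ _ (R.begin
    ⟪ x , y ⟫ ⊕ ⟪ y , x ⟫                             R.≈⟨ +-cong (trans (+-congʳ (alternating x)) (+-identityˡ _)) (trans (+-congˡ (alternating y)) (+-identityʳ _)) ⟨
    (⟪ x , x ⟫ ⊕ ⟪ x , y ⟫) ⊕ (⟪ y , x ⟫ ⊕ ⟪ y , y ⟫) R.≈⟨ +-cong (⟪⟫-+ʳ x x y) (⟪⟫-+ʳ y x y) ⟨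
    ⟪ x , x +ᴹ y ⟫ ⊕ ⟪ y , x +ᴹ y ⟫                   R.≈⟨ ⟪⟫-+ˡ x y (x +ᴹ y) ⟨
    ⟪ x +ᴹ y , x +ᴹ y ⟫                               R.≈⟨ alternating (x +ᴹ y) ⟩
    0#                                                R.∎)

  ⊥-+⟨⟩ : (W : Subspace p₁) → ∀ {u x} → (∀ y → Member (W +⟨ u ⟩) y) →
          (∀ {y} → Member W y → ⟪ x , y ⟫ ≈ 0#) → ⟪ x , u ⟫ ≈ 0# → x ≈ᴹ 0ᴹ
  ⊥-+⟨⟩ W {u} {x} V⊆W+u x⊥W x⊥u = nondegenerate x λ y → let (k , w , w∈W , eq) = V⊆W+u y in R.begin
    ⟪ x , y ⟫                        R.≈⟨ ⟪⟫-cong ≈ᴹ-refl eq ⟩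
    ⟪ x , w +ᴹ k *ₗ u ⟫              R.≈⟨ ⟪⟫-+ʳ x w _ ⟩
    ⟪ x , w ⟫ ⊕ ⟪ x , k *ₗ u ⟫       R.≈⟨ +-cong (x⊥W w∈W) (trans (⟪⟫-*ʳ k x u) (trans (*-congˡ x⊥u) (zeroʳ k))) ⟩
    0# ⊕ 0#                          R.≈⟨ +-identityˡ 0# ⟩
    0#                               R.∎

  -- If the k-eigenspace E of f is a hyperplane that is not totally isotropic,
  -- then f has multiplier k², so f x − k x lies in the orthogonal of E, which
  -- is contained in E; hence k⁻¹ f is a transvection.
  module _ {f : Carrierᴹ → Carrierᴹ} (isLinear : IsLeftModuleHomomorphism rawLeftModule rawLeftModule f)
           {multiplier : Carrier} (multiplier≉0 : ¬ multiplier ≈ 0#)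
           (⟪⟫-scaled : ∀ x y → ⟪ f x , f y ⟫ ≈ multiplier ⊗ ⟪ x , y ⟫)
           (k : Carrier) {u} (V⊆E+u : ∀ x → Member (Endomorphism.eigenspace isLinear k +⟨ u ⟩) x)
           (q<∣E∣ : order < ∣ Endomorphism.eigenspace isLinear k ∣) where
    open IsLeftModuleHomomorphism isLinear

    private
      E : Subspace b
      E = Endomorphism.eigenspace isLinear k
      module E′ = Subspace E

    ⟪E,E⟫ : ∀ {x y} → Member E x → Member E y → multiplier ⊗ ⟪ x , y ⟫ ≈ (k ⊗ k) ⊗ ⟪ x , y ⟫
    ⟪E,E⟫ {x} {y} x∈E y∈E = R.begin
      multiplier ⊗ ⟪ x , y ⟫      R.≈⟨ ⟪⟫-scaled x y ⟨
      ⟪ f x , f y ⟫             R.≈⟨ ⟪⟫-cong x∈E y∈E ⟩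
      ⟪ k *ₗ x , k *ₗ y ⟫         R.≈⟨ ⟪⟫-*ˡ k x _ ⟩
      k ⊗ ⟪ x , k *ₗ y ⟫          R.≈⟨ *-congˡ (⟪⟫-*ʳ k x y) ⟩
      k ⊗ (k ⊗ ⟪ x , y ⟫)         R.≈⟨ *-assoc k k _ ⟨
      (k ⊗ k) ⊗ ⟪ x , y ⟫         R.∎

    -- Otherwise `⟪E,E⟫` makes the form vanish on `E`. A vector of `E` is then determined by its
    -- product with `u`, as `E` and `u` span V, so `E` would have at most `order` elements.
    multiplier≈k² : multiplier ≈ k ⊗ k
    multiplier≈k² with multiplier ≈? (k ⊗ k)
    ... | yes eq = eq
    ... | no neq = contradiction q<∣E∣ (ℕ.≤⇒≯ (injective⇒card-≤ (Subspace.card E) finite (λ (x , _) → ⟪ x , u ⟫)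
      λ {(x , x∈E)} {(y , y∈E)} eq → x-y≈0⇒x≈y x y (⊥-+⟨⟩ E V⊆E+u
        (λ z∈E → kr≈hr⇒r≈0 neq (⟪E,E⟫ (E′.-ᴹ∈ x∈E y∈E) z∈E))
        (trans (⟪⟫--ˡ x y u) (F.x≈y⇒x∙y⁻¹≈ε eq)))))

    k≉0 : ¬ k ≈ 0#
    k≉0 k≈0 = multiplier≉0 (trans multiplier≈k² (trans (*-congʳ k≈0) (zeroˡ k)))

    displacement : Carrierᴹ → Carrierᴹ
    displacement x = f x -ᴹ k *ₗ x

    -- For y in `E` the vector k y is f y, and pairing either f x or k x with f y gives k² ⟪ x , y
    -- ⟫.
    displacement⊥E : ∀ x {y} → Member E y → ⟪ displacement x , y ⟫ ≈ 0#
    displacement⊥E x {y} y∈E = kr≈0⇒r≈0 k≉0 (R.begin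
      k ⊗ ⟪ displacement x , y ⟫                  R.≈⟨ ⟪⟫-*ʳ k _ y ⟨
      ⟪ displacement x , k *ₗ y ⟫                 R.≈⟨ ⟪⟫-cong ≈ᴹ-refl y∈E ⟨
      ⟪ f x -ᴹ k *ₗ x , f y ⟫                   R.≈⟨ ⟪⟫--ˡ (f x) (k *ₗ x) (f y) ⟩
      ⟪ f x , f y ⟫ - ⟪ k *ₗ x , f y ⟫         R.≈⟨ F.x≈y⇒x∙y⁻¹≈ε (R.begin
        ⟪ f x , f y ⟫                             R.≈⟨ ⟪⟫-scaled x y ⟩
        multiplier ⊗ ⟪ x , y ⟫                      R.≈⟨ *-congʳ multiplier≈k² ⟩
        (k ⊗ k) ⊗ ⟪ x , y ⟫                         R.≈⟨ *-assoc k k _ ⟩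
        k ⊗ (k ⊗ ⟪ x , y ⟫)                         R.≈⟨ *-congˡ (⟪⟫-*ʳ k x y) ⟨
        k ⊗ ⟪ x , k *ₗ y ⟫                          R.≈⟨ *-congˡ (⟪⟫-cong ≈ᴹ-refl y∈E) ⟨
        k ⊗ ⟪ x , f y ⟫                            R.≈⟨ ⟪⟫-*ˡ k x (f y) ⟨
        ⟪ k *ₗ x , f y ⟫                           R.∎) ⟩
      0#                                          R.∎)

    -- A vector d orthogonal to `E` and to `u` is zero. Otherwise write d = w + h u with w in `E`:
    -- since the form is alternating, 0 = ⟪ d , d ⟫ = h ⟪ d , u ⟫, so h = 0 and d = w.
    displacement∈E : ∀ x → Member E (displacement x)
    displacement∈E x with ⟪ displacement x , u ⟫ ≈? 0#
    ... | yes cu≈0 = E′.resp (≈ᴹ-sym (⊥-+⟨⟩ E V⊆E+u (displacement⊥E x) cu≈0)) E′.0ᴹ∈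
    ... | no  cu≉0 = let (h , w , w∈E , eq) = V⊆E+u d
                         h≈0 = kr≈0⇒r≈0 cu≉0 (R.begin
                           ⟪ d , u ⟫ ⊗ h                 R.≈⟨ *-comm _ h ⟩
                           h ⊗ ⟪ d , u ⟫                 R.≈⟨ ⟪⟫-*ʳ h d u ⟨
                           ⟪ d , h *ₗ u ⟫                R.≈⟨ +-identityˡ _ ⟨
                           0# ⊕ ⟪ d , h *ₗ u ⟫           R.≈⟨ +-congʳ (displacement⊥E x w∈E) ⟨
                           ⟪ d , w ⟫ ⊕ ⟪ d , h *ₗ u ⟫    R.≈⟨ ⟪⟫-+ʳ d w _ ⟨
                           ⟪ d , w +ᴹ h *ₗ u ⟫           R.≈⟨ ⟪⟫-cong ≈ᴹ-refl eq ⟨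
                           ⟪ d , d ⟫                     R.≈⟨ alternating d ⟩
                           0#                            R.∎)
                     in E′.resp (≈ᴹ-sym (≈ᴹ-trans eq (≈ᴹ-trans (+ᴹ-congˡ (≈ᴹ-trans (*ₗ-congʳ h≈0) (*ₗ-zeroˡ u))) (+ᴹ-identityʳ w)))) w∈E
      where
      d : Carrierᴹ
      d = displacement x

    -- f² x = k² x + 2 k d with d = f x − k x, so either x ∈ E or h = k² and d = 0.
    transvection-no2cycle : ∀ {x h} → f (f x) ≈ᴹ h *ₗ x → Member E x
    transvection-no2cycle {x} {h} ffx≈hx = case h ≈? (k ⊗ k) of λ where
        (yes h≈k²) → x-y≈0⇒x≈y _ _ (kx≈0⇒x≈0 k≉0 (x+x≈0⇒x≈0 (≈ᴹ-trans 2kd≈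
                       (≈ᴹ-trans (*ₗ-congʳ (F.x≈y⇒x∙y⁻¹≈ε h≈k²)) (*ₗ-zeroˡ x)))))
        (no h≉k²)  → E′.resp (*ₗ-inverse (proj₂ (invertible _ (k-h≉0 h≉k²))) x)
                       (E′.*ₗ∈ _ (E′.resp 2kd≈ (E′.+ᴹ∈ (E′.*ₗ∈ k (displacement∈E x)) (E′.*ₗ∈ k (displacement∈E x)))))
      where
      d : Carrierᴹ
      d = displacement x
      kd : Carrierᴹ
      kd = k *ₗ d
      ffx : f (f x) ≈ᴹ (kd +ᴹ kd) +ᴹ (k ⊗ k) *ₗ x
      ffx = E.begin
        f (f x)                           E.≈⟨ ⟦⟧-cong (x-y+y≈x (k *ₗ x) (f x)) ⟨
        f (d +ᴹ k *ₗ x)                    E.≈⟨ +ᴹ-homo d _ ⟩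
        f d +ᴹ f (k *ₗ x)                 E.≈⟨ +ᴹ-cong (displacement∈E x) (*ₗ-homo k x) ⟩
        kd +ᴹ k *ₗ f x                     E.≈⟨ +ᴹ-congˡ (*ₗ-congˡ (x-y+y≈x (k *ₗ x) (f x))) ⟨
        kd +ᴹ k *ₗ (d +ᴹ k *ₗ x)            E.≈⟨ +ᴹ-congˡ (*ₗ-distribˡ k d _) ⟩
        kd +ᴹ (kd +ᴹ k *ₗ (k *ₗ x))         E.≈⟨ +ᴹ-assoc kd kd _ ⟨
        (kd +ᴹ kd) +ᴹ k *ₗ (k *ₗ x)         E.≈⟨ +ᴹ-congˡ (*ₗ-assoc k k x) ⟨
        (kd +ᴹ kd) +ᴹ (k ⊗ k) *ₗ x          E.∎
      2kd≈ : kd +ᴹ kd ≈ᴹ (h - k ⊗ k) *ₗ x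
      2kd≈ = E.begin
        kd +ᴹ kd                                          E.≈⟨ x+y-y≈x ((k ⊗ k) *ₗ x) _ ⟨
        (kd +ᴹ kd) +ᴹ (k ⊗ k) *ₗ x -ᴹ (k ⊗ k) *ₗ x        E.≈⟨ +ᴹ-congʳ ffx ⟨
        f (f x) -ᴹ (k ⊗ k) *ₗ x                         E.≈⟨ +ᴹ-congʳ ffx≈hx ⟩
        h *ₗ x -ᴹ (k ⊗ k) *ₗ x                            E.≈⟨ *ₗ-distribʳ-- h (k ⊗ k) x ⟨
        (h - k ⊗ k) *ₗ x                                  E.∎

  isLinear : {f : Carrierᴹ → Carrierᴹ} → (∀ {x y} → x ≈ᴹ y → f x ≈ᴹ f y) → (∀ x y → f (x +ᴹ y) ≈ᴹ f x +ᴹ f y) →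
             (∀ k x → f (k *ₗ x) ≈ᴹ k *ₗ f x) → IsLeftModuleHomomorphism rawLeftModule rawLeftModule f
  isLinear {f} f-cong f-+ f-* = record
    { +ᴹ-isGroupHomomorphism = record
      { isMonoidHomomorphism = record
        { isMagmaHomomorphism = record { isRelHomomorphism = record { cong = f-cong } ; homo = f-+ }
        ; ε-homo = f-0
        }
      ; ⁻¹-homo = λ x → AbelianGroupProperties.inverseˡ-unique +ᴹ-abelianGroup _ _
          (≈ᴹ-trans (≈ᴹ-sym (f-+ (-ᴹ x) x)) (≈ᴹ-trans (f-cong (-ᴹ‿inverseˡ x)) f-0))
      }
    ; *ₗ-homo = f-*
    }
    where
    f-0 : f 0ᴹ ≈ᴹ 0ᴹ
    f-0 = ≈ᴹ-trans (f-cong (≈ᴹ-sym (*ₗ-zeroˡ 0ᴹ))) (≈ᴹ-trans (f-* 0# 0ᴹ) (*ₗ-zeroˡ (f 0ᴹ)))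

  -- The involution 1 − 2P of a projection P.
  module Reflection {P : Carrierᴹ → Carrierᴹ} (P-linear : IsLeftModuleHomomorphism rawLeftModule rawLeftModule P)
                    (P-idem : ∀ x → P (P x) ≈ᴹ P x) where
    open IsLeftModuleHomomorphism P-linear
    open Endomorphism P-linear using (∣others∣; OtherEigenvectors; otherEigenvectors-finite; ∣eigenspace∣*∣others∣≤m)

    kernel image : Subspace b
    kernel = Endomorphism.eigenspace P-linear 0#
    image  = Endomorphism.eigenspace P-linear 1#

    kernel⇒ : ∀ {x} → Member kernel x → P x ≈ᴹ 0ᴹ
    kernel⇒ {x} eq = ≈ᴹ-trans eq (*ₗ-zeroˡ x)

    image⇒ : ∀ {x} → Member image x → P x ≈ᴹ x
    image⇒ {x} eq = ≈ᴹ-trans eq (*ₗ-identityˡ x)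

    P∈image : ∀ x → Member image (P x)
    P∈image x = ≈ᴹ-trans (P-idem x) (≈ᴹ-sym (*ₗ-identityˡ (P x)))

    P-homo- : ∀ x y → P (x -ᴹ y) ≈ᴹ P x -ᴹ P y
    P-homo- x y = ≈ᴹ-trans (+ᴹ-homo x (-ᴹ y)) (+ᴹ-congˡ (-ᴹ-homo y))

    complement∈kernel : ∀ x → Member kernel (x -ᴹ P x)
    complement∈kernel x = E.begin
      P (x -ᴹ P x)          E.≈⟨ P-homo- x (P x) ⟩
      P x -ᴹ P (P x)        E.≈⟨ +ᴹ-congˡ (-ᴹ‿cong (P-idem x)) ⟩
      P x -ᴹ P x            E.≈⟨ -ᴹ‿inverseʳ (P x) ⟩
      0ᴹ                    E.≈⟨ *ₗ-zeroˡ _ ⟨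
      0# *ₗ (x -ᴹ P x)      E.∎

    m≤∣kernel∣*∣image∣ : m ≤ ∣ kernel ∣ * ∣ image ∣
    m≤∣kernel∣*∣image∣ = injective⇒card-≤ V-finite (card-× (Subspace.card kernel) (Subspace.card image))
      (λ x → (x -ᴹ P x , complement∈kernel x) , (P x , P∈image x)) λ {x} {y} (k≈ , i≈) →
        ≈ᴹ-trans (≈ᴹ-sym (x-y+y≈x (P x) x)) (≈ᴹ-trans (+ᴹ-cong k≈ i≈) (x-y+y≈x (P y) y))

    -- Kernel and image are the eigenspaces of P for 0 and 1, so the product bound for an eigenspace
    -- and the other eigenvectors applies.
    ∣kernel∣*∣image∣≤m : ∣ kernel ∣ * ∣ image ∣ ≤ m
    ∣kernel∣*∣image∣≤m = ℕ.≤-trans (ℕ.*-monoʳ-≤ ∣ kernel ∣ (injective⇒card-≤ (Subspace.card image)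
      (proj₂ (otherEigenvectors-finite 0#)) (λ (x , x∈) → x , 1# , 1≉0 , x∈) id)) (∣eigenspace∣*∣others∣≤m 0#)

    reflect : Carrierᴹ → Carrierᴹ
    reflect x = x -ᴹ (P x +ᴹ P x)

    reflect-linear : IsLeftModuleHomomorphism rawLeftModule rawLeftModule reflect
    reflect-linear = isLinear
      (λ x≈y → +ᴹ-cong x≈y (-ᴹ‿cong (+ᴹ-cong (⟦⟧-cong x≈y) (⟦⟧-cong x≈y))))
      (λ x y → E.begin
        (x +ᴹ y) -ᴹ (P (x +ᴹ y) +ᴹ P (x +ᴹ y))             E.≈⟨ +ᴹ-congˡ (-ᴹ‿cong (+ᴹ-cong (+ᴹ-homo x y) (+ᴹ-homo x y))) ⟩
        (x +ᴹ y) -ᴹ ((P x +ᴹ P y) +ᴹ (P x +ᴹ P y))         E.≈⟨ +ᴹ-congˡ (-ᴹ‿cong (interchange (P x) (P y) (P x) (P y))) ⟩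
        (x +ᴹ y) -ᴹ ((P x +ᴹ P x) +ᴹ (P y +ᴹ P y))         E.≈⟨ +ᴹ-congˡ (-ᴹ-+ᴹ-comm _ _) ⟨
        (x +ᴹ y) +ᴹ (-ᴹ (P x +ᴹ P x) -ᴹ (P y +ᴹ P y))      E.≈⟨ interchange x y _ _ ⟩
        reflect x +ᴹ reflect y                             E.∎)
      (λ k x → E.begin
        k *ₗ x -ᴹ (P (k *ₗ x) +ᴹ P (k *ₗ x))       E.≈⟨ +ᴹ-congˡ (-ᴹ‿cong (+ᴹ-cong (*ₗ-homo k x) (*ₗ-homo k x))) ⟩
        k *ₗ x -ᴹ (k *ₗ P x +ᴹ k *ₗ P x)           E.≈⟨ +ᴹ-congˡ (-ᴹ‿cong (*ₗ-distribˡ k (P x) (P x))) ⟨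
        k *ₗ x -ᴹ k *ₗ (P x +ᴹ P x)                E.≈⟨ *ₗ-distribˡ-- k x _ ⟨
        k *ₗ reflect x                             E.∎)

    P-reflect : ∀ x → P (reflect x) ≈ᴹ -ᴹ P x
    P-reflect x = E.begin
      P (x -ᴹ (P x +ᴹ P x))                E.≈⟨ P-homo- x _ ⟩
      P x -ᴹ P (P x +ᴹ P x)                E.≈⟨ +ᴹ-congˡ (-ᴹ‿cong (≈ᴹ-trans (+ᴹ-homo _ _) (+ᴹ-cong (P-idem x) (P-idem x)))) ⟩
      P x -ᴹ (P x +ᴹ P x)                  E.≈⟨ +ᴹ-congˡ (-ᴹ-+ᴹ-comm (P x) (P x)) ⟨
      P x +ᴹ (-ᴹ P x -ᴹ P x)               E.≈⟨ +ᴹ-assoc _ _ _ ⟨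
      (P x -ᴹ P x) -ᴹ P x                  E.≈⟨ +ᴹ-congʳ (-ᴹ‿inverseʳ (P x)) ⟩
      0ᴹ -ᴹ P x                            E.≈⟨ +ᴹ-identityˡ _ ⟩
      -ᴹ P x                               E.∎

    reflect-involutive : ∀ x → reflect (reflect x) ≈ᴹ x
    reflect-involutive x = E.begin
      reflect x -ᴹ (P (reflect x) +ᴹ P (reflect x))   E.≈⟨ +ᴹ-congˡ (-ᴹ‿cong (+ᴹ-cong (P-reflect x) (P-reflect x))) ⟩
      reflect x -ᴹ (-ᴹ P x -ᴹ P x)                    E.≈⟨ +ᴹ-congˡ (-ᴹ‿cong (-ᴹ-+ᴹ-comm (P x) (P x))) ⟩
      reflect x -ᴹ -ᴹ (P x +ᴹ P x)                    E.≈⟨ x+y-y≈x (-ᴹ (P x +ᴹ P x)) x ⟩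
      x                                               E.∎

    reflect-kernel : ∀ {x} → Member kernel x → reflect x ≈ᴹ x
    reflect-kernel {x} x∈ = x-y≈0⇒x≈y _ _ (E.begin
      (x -ᴹ (P x +ᴹ P x)) -ᴹ x       E.≈⟨ AbelianGroupProperties.xyx⁻¹≈y +ᴹ-abelianGroup x _ ⟩
      -ᴹ (P x +ᴹ P x)                E.≈⟨ -ᴹ‿cong (≈ᴹ-trans (+ᴹ-cong (kernel⇒ x∈) (kernel⇒ x∈)) (+ᴹ-identityˡ 0ᴹ)) ⟩
      -ᴹ 0ᴹ                          E.≈⟨ AbelianGroupProperties.ε⁻¹≈ε +ᴹ-abelianGroup ⟩
      0ᴹ                             E.∎)

    reflect-image : ∀ {x} → Member image x → reflect x ≈ᴹ -ᴹ x
    reflect-image {x} x∈ = E.begin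
      x -ᴹ (P x +ᴹ P x)         E.≈⟨ +ᴹ-congˡ (-ᴹ‿cong (+ᴹ-cong (image⇒ x∈) (image⇒ x∈))) ⟩
      x -ᴹ (x +ᴹ x)             E.≈⟨ +ᴹ-congˡ (-ᴹ-+ᴹ-comm x x) ⟨
      x +ᴹ (-ᴹ x -ᴹ x)          E.≈⟨ +ᴹ-assoc _ _ _ ⟨
      (x -ᴹ x) -ᴹ x             E.≈⟨ +ᴹ-congʳ (-ᴹ‿inverseʳ x) ⟩
      0ᴹ -ᴹ x                   E.≈⟨ +ᴹ-identityˡ _ ⟩
      -ᴹ x                      E.∎

    reflect-image-fixed : ∀ {x} → Member image x → reflect x ≈ᴹ x → x ≈ᴹ 0ᴹ
    reflect-image-fixed {x} x∈ fixed = x+x≈0⇒x≈0 (≈ᴹ-trans (+ᴹ-congʳ (≈ᴹ-trans (≈ᴹ-sym fixed) (reflect-image x∈))) (-ᴹ‿inverseˡ x))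

    kernel∩image : ∀ {x y} → Member kernel x → Member image y → x ≈ᴹ y → x ≈ᴹ 0ᴹ
    kernel∩image x∈ y∈ x≈y = ≈ᴹ-trans x≈y (≈ᴹ-trans (≈ᴹ-sym (image⇒ y∈)) (≈ᴹ-trans (⟦⟧-cong (≈ᴹ-sym x≈y)) (kernel⇒ x∈)))

    open Endomorphism reflect-linear using (NonzeroEigenvectors)

    -- The reverse of `nonzeroEigenvectors≤`, which makes that bound sharp at a reflection. The zero
    -- vectors of kernel and image take up the 2.
    ∣kernel∣+∣image∣≤ : ∀ {N} → HasCardinality NonzeroEigenvectors N → ∣ kernel ∣ + ∣ image ∣ ≤ N + 2
    ∣kernel∣+∣image∣≤ N-card = injective⇒card-≤ (card-⊎ (Subspace.card kernel) (Subspace.card image))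
      (card-⊎ N-card (card-Fin 2)) place λ {x} {y} → injective x y
      where
      module S = Setoid (Subspace.asSetoid kernel ⊎ₛ Subspace.asSetoid image)
      module T = Setoid (NonzeroEigenvectors ⊎ₛ ≡.setoid (Fin 2))
      place : S.Carrier → T.Carrier
      place (inj₁ (x , x∈)) with x ≟ᴹ 0ᴹ
      ... | yes _   = inj₂ zero
      ... | no  x≉0 = inj₁ (x , x≉0 , 1# , ≈ᴹ-trans (reflect-kernel x∈) (≈ᴹ-sym (*ₗ-identityˡ x)))
      place (inj₂ (x , x∈)) with x ≟ᴹ 0ᴹ
      ... | yes _   = inj₂ (suc zero)
      ... | no  x≉0 = inj₁ (x , x≉0 , - 1# , ≈ᴹ-trans (reflect-image x∈)
                        (≈ᴹ-trans (-ᴹ‿cong (≈ᴹ-sym (*ₗ-identityˡ x))) (-ᴹ‿distribˡ-*ₗ 1# x)))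
      injective : ∀ x y → place x T.≈ place y → x S.≈ y
      injective (inj₁ (x , x∈)) (inj₁ (y , y∈)) eq with x ≟ᴹ 0ᴹ | y ≟ᴹ 0ᴹ | eq
      ... | yes x≈0 | yes y≈0 | _       = inj₁ (≈ᴹ-trans x≈0 (≈ᴹ-sym y≈0))
      ... | no  _   | no  _   | inj₁ eq = inj₁ eq
      ... | yes _   | no  _   | ()
      ... | no  _   | yes _   | ()
      injective (inj₂ (x , x∈)) (inj₂ (y , y∈)) eq with x ≟ᴹ 0ᴹ | y ≟ᴹ 0ᴹ | eq
      ... | yes x≈0 | yes y≈0 | _       = inj₂ (≈ᴹ-trans x≈0 (≈ᴹ-sym y≈0))
      ... | no  _   | no  _   | inj₁ eq = inj₂ eq
      ... | yes _   | no  _   | ()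
      ... | no  _   | yes _   | ()
      injective (inj₁ (x , x∈)) (inj₂ (y , y∈)) eq with x ≟ᴹ 0ᴹ | y ≟ᴹ 0ᴹ | eq
      ... | yes _   | yes _   | inj₂ ()
      ... | no  x≉0 | no  _   | inj₁ eq = contradiction (kernel∩image x∈ y∈ eq) x≉0
      ... | yes _   | no  _   | ()
      ... | no  _   | yes _   | ()
      injective (inj₂ (x , x∈)) (inj₁ (y , y∈)) eq with x ≟ᴹ 0ᴹ | y ≟ᴹ 0ᴹ | eq
      ... | yes _   | yes _   | inj₂ ()
      ... | no  _   | no  y≉0 | inj₁ eq = contradiction (kernel∩image y∈ x∈ (≈ᴹ-sym eq)) y≉0
      ... | yes _   | no  _   | ()
      ... | no  _   | yes _   | ()

    -- Bilinearity alone, with the terms in P left open: for the plane projection all three of them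
    -- agree, for the line projection the last one vanishes.
    ⟪reflect⟫ : ∀ x y → ⟪ reflect x , reflect y ⟫ ≈
      (⟪ x , y ⟫ - (⟪ x , P y ⟫ ⊕ ⟪ x , P y ⟫)) -
        ((⟪ P x , y ⟫ ⊕ ⟪ P x , y ⟫) - ((⟪ P x , P y ⟫ ⊕ ⟪ P x , P y ⟫) ⊕ (⟪ P x , P y ⟫ ⊕ ⟪ P x , P y ⟫)))
    ⟪reflect⟫ x y = trans (⟪⟫--ˡ x _ _) (+-cong (trans (⟪⟫--ʳ x y _) (+-congˡ (-‿cong (⟪⟫-+ʳ x _ _))))
      (-‿cong (trans (⟪⟫-+ˡ (P x) (P x) _) (trans (+-cong expand expand) (trans (+-interchange _ _ _ _) (+-congˡ (F.⁻¹-∙-comm _ _)))))))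
      where
      expand : ⟪ P x , reflect y ⟫ ≈ ⟪ P x , y ⟫ - (⟪ P x , P y ⟫ ⊕ ⟪ P x , P y ⟫)
      expand = trans (⟪⟫--ʳ (P x) y _) (+-congˡ (-‿cong (⟪⟫-+ʳ (P x) _ _)))

  ≉0⇒2≤∣∣ : (W : Subspace p₁) → ∀ {x} → Member W x → ¬ x ≈ᴹ 0ᴹ → 2 ≤ ∣ W ∣
  ≉0⇒2≤∣∣ W {x} x∈W x≉0 = injective⇒card-≤ (card-Fin 2) (Subspace.card W) place λ {i} {j} → injective i j
    where
    place : Fin 2 → ∃ (Member W)
    place zero       = 0ᴹ , Subspace.0ᴹ∈ W
    place (suc zero) = x , x∈W
    injective : ∀ i j → proj₁ (place i) ≈ᴹ proj₁ (place j) → i ≡ j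
    injective zero       zero       _  = ≡.refl
    injective zero       (suc zero) eq = contradiction (≈ᴹ-sym eq) x≉0
    injective (suc zero) zero       eq = contradiction eq x≉0
    injective (suc zero) (suc zero) _  = ≡.refl

  2≤∣∣⇒≉0 : (W : Subspace p₁) → 2 ≤ ∣ W ∣ → ∃[ x ] Member W x × ¬ x ≈ᴹ 0ᴹ
  2≤∣∣⇒≉0 W 2≤ with exceeds W zeroSubspace
  ... | inj₂ x   = x
  ... | inj₁ W⊆0 = contradiction 2≤ (ℕ.<⇒≱ (s≤s (injective⇒card-≤ (Subspace.card W) (card-Fin 1) (λ _ → zero)
                     λ {(x , x∈)} {(y , y∈)} _ → ≈ᴹ-trans (W⊆0 x∈) (≈ᴹ-sym (W⊆0 y∈)))))

  hyperbolicPair : 2 ≤ m → ∃₂ λ u v → ⟪ u , v ⟫ ≈ 1#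
  hyperbolicPair 2≤m with 2≤∣∣⇒≉0 wholeSpace (ℕ.≤-trans 2≤m m≤∣wholeSpace∣)
  ... | u , _ , u≉0 with all-or-counterexample V-finite {P = λ v → ⟪ u , v ⟫ ≈ 0#}
                           (λ x≈y eq → trans (⟪⟫-cong ≈ᴹ-refl (≈ᴹ-sym x≈y)) eq) (λ v → ⟪ u , v ⟫ ≈? 0#)
  ... | inj₁ u⊥V       = contradiction (nondegenerate u u⊥V) u≉0
  ... | inj₂ (v , uv≉0) = let (k , eq) = invertible _ uv≉0 in u , k *ₗ v , trans (⟪⟫-*ʳ k u v) eq

  -- Projections and reflections from a hyperbolic pair

  module HyperbolicPair {u v} (uv≈1 : ⟪ u , v ⟫ ≈ 1#) where
    -- Because ⟪ u , v ⟫ = 1, these read off the coefficients of u and v. Thus `toPlane` is the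
    -- orthogonal projection onto the plane of u and v, and `toLine` keeps only its u-component.
    α β : Carrierᴹ → Carrier
    α x = ⟪ x , v ⟫
    β x = ⟪ u , x ⟫

    combination : Carrier → Carrier → Carrierᴹ
    combination k h = k *ₗ u +ᴹ h *ₗ v

    toLine toPlane : Carrierᴹ → Carrierᴹ
    toLine  x = α x *ₗ u
    toPlane x = combination (α x) (β x)

    private
      combination-+ : ∀ k h k′ h′ → combination (k ⊕ k′) (h ⊕ h′) ≈ᴹ combination k h +ᴹ combination k′ h′
      combination-+ k h k′ h′ = ≈ᴹ-trans (+ᴹ-cong (*ₗ-distribʳ u k k′) (*ₗ-distribʳ v h h′)) (interchange _ _ _ _)

      combination-cong : ∀ {k h k′ h′} → k ≈ k′ → h ≈ h′ → combination k h ≈ᴹ combination k′ h′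
      combination-cong k≈k′ h≈h′ = +ᴹ-cong (*ₗ-congʳ k≈k′) (*ₗ-congʳ h≈h′)

      k*1≈k : ∀ {k r} → r ≈ 1# → k ⊗ r ≈ k
      k*1≈k {k} eq = trans (*-congˡ eq) (*-identityʳ k)

      k*0≈0 : ∀ {k r} → r ≈ 0# → k ⊗ r ≈ 0#
      k*0≈0 {k} eq = trans (*-congˡ eq) (zeroʳ k)

    α-line : ∀ k → α (k *ₗ u) ≈ k
    α-line k = trans (⟪⟫-*ˡ k u v) (k*1≈k uv≈1)

    α-combination : ∀ k h → α (combination k h) ≈ k
    α-combination k h = trans (⟪⟫-+ˡ _ _ v) (trans (+-cong (α-line k) (trans (⟪⟫-*ˡ h v v) (k*0≈0 (alternating v)))) (+-identityʳ k))

    β-combination : ∀ k h → β (combination k h) ≈ h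
    β-combination k h = trans (⟪⟫-+ʳ u _ _) (trans (+-cong (trans (⟪⟫-*ʳ k u u) (k*0≈0 (alternating u)))
      (trans (⟪⟫-*ʳ h u v) (k*1≈k uv≈1))) (+-identityˡ h))

    toLine-linear : IsLeftModuleHomomorphism rawLeftModule rawLeftModule toLine
    toLine-linear = isLinear (λ x≈y → *ₗ-congʳ (⟪⟫-cong x≈y ≈ᴹ-refl))
      (λ x y → ≈ᴹ-trans (*ₗ-congʳ (⟪⟫-+ˡ x y v)) (*ₗ-distribʳ u _ _))
      (λ k x → ≈ᴹ-trans (*ₗ-congʳ (⟪⟫-*ˡ k x v)) (*ₗ-assoc k _ u))

    toLine-idem : ∀ x → toLine (toLine x) ≈ᴹ toLine x
    toLine-idem x = *ₗ-congʳ (α-line (α x))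

    toPlane-linear : IsLeftModuleHomomorphism rawLeftModule rawLeftModule toPlane
    toPlane-linear = isLinear (λ x≈y → combination-cong (⟪⟫-cong x≈y ≈ᴹ-refl) (⟪⟫-cong ≈ᴹ-refl x≈y))
      (λ x y → ≈ᴹ-trans (combination-cong (⟪⟫-+ˡ x y v) (⟪⟫-+ʳ u x y)) (combination-+ _ _ _ _))
      (λ k x → ≈ᴹ-trans (combination-cong (⟪⟫-*ˡ k x v) (⟪⟫-*ʳ k u x))
        (≈ᴹ-trans (+ᴹ-cong (*ₗ-assoc k _ u) (*ₗ-assoc k _ v)) (≈ᴹ-sym (*ₗ-distribˡ k _ _))))

    toPlane-combination : ∀ k h → toPlane (combination k h) ≈ᴹ combination k h
    toPlane-combination k h = combination-cong (α-combination k h) (β-combination k h)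

    module LineReflection  = Reflection toLine-linear toLine-idem
    module PlaneReflection = Reflection toPlane-linear (λ x → toPlane-combination (α x) (β x))

    ∣line∣≤q : ∣ LineReflection.image ∣ ≤ order
    ∣line∣≤q = injective⇒card-≤ (Subspace.card LineReflection.image) finite (λ (x , _) → α x) λ {(_ , x∈)} {(_ , y∈)} eq →
      ≈ᴹ-trans (≈ᴹ-sym (LineReflection.image⇒ x∈)) (≈ᴹ-trans (*ₗ-congʳ eq) (LineReflection.image⇒ y∈))

    q≤∣line∣ : order ≤ ∣ LineReflection.image ∣
    q≤∣line∣ = injective⇒card-≤ finite (Subspace.card LineReflection.image)
      (λ k → k *ₗ u , ≈ᴹ-trans (*ₗ-congʳ (α-line k)) (≈ᴹ-sym (*ₗ-identityˡ _)))
      λ {k} {h} eq → trans (sym (α-line k)) (trans (⟪⟫-cong eq ≈ᴹ-refl) (α-line h))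

    ∣plane∣≤q² : ∣ PlaneReflection.image ∣ ≤ order * order
    ∣plane∣≤q² = injective⇒card-≤ (Subspace.card PlaneReflection.image) (card-× finite finite) (λ (x , _) → α x , β x)
      λ {(_ , x∈)} {(_ , y∈)} (eq , eq′) →
        ≈ᴹ-trans (≈ᴹ-sym (PlaneReflection.image⇒ x∈)) (≈ᴹ-trans (combination-cong eq eq′) (PlaneReflection.image⇒ y∈))

    q²≤∣plane∣ : order * order ≤ ∣ PlaneReflection.image ∣
    q²≤∣plane∣ = injective⇒card-≤ (card-× finite finite) (Subspace.card PlaneReflection.image)
      (λ (k , h) → combination k h , ≈ᴹ-trans (toPlane-combination k h) (≈ᴹ-sym (*ₗ-identityˡ _)))
      λ {(k , h)} {(k′ , h′)} eq → trans (sym (α-combination k h)) (trans (⟪⟫-cong eq ≈ᴹ-refl) (α-combination k′ h′))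
                                 , trans (sym (β-combination k h)) (trans (⟪⟫-cong ≈ᴹ-refl eq) (β-combination k′ h′))

    -- The form of the hyperbolic plane as a determinant of coordinates. `toPlane` is self-adjoint,
    -- so projecting either argument or both yields this same value.
    D : Carrierᴹ → Carrierᴹ → Carrier
    D x y = α x ⊗ β y - β x ⊗ α y

    ⟪-,u⟫ : ∀ x k → k ⊗ ⟪ x , u ⟫ ≈ - (β x ⊗ k)
    ⟪-,u⟫ x k = trans (*-congˡ (skew x u)) (trans (sym (-‿distribʳ-* k (β x))) (-‿cong (*-comm k (β x))))

    ⟪toPlane,⟫ : ∀ x y → ⟪ toPlane x , y ⟫ ≈ D x y
    ⟪toPlane,⟫ x y = trans (⟪⟫-+ˡ _ _ y) (+-cong (⟪⟫-*ˡ (α x) u y)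
      (trans (⟪⟫-*ˡ (β x) v y) (trans (*-congˡ (skew v y)) (sym (-‿distribʳ-* (β x) (α y))))))

    ⟪,toPlane⟫ : ∀ x y → ⟪ x , toPlane y ⟫ ≈ D x y
    ⟪,toPlane⟫ x y = trans (⟪⟫-+ʳ x _ _) (trans (+-cong (trans (⟪⟫-*ʳ (α y) x u) (⟪-,u⟫ x (α y)))
      (trans (⟪⟫-*ʳ (β y) x v) (*-comm (β y) (α x)))) (+-comm _ _))

    ⟪toPlane,toPlane⟫ : ∀ x y → ⟪ toPlane x , toPlane y ⟫ ≈ D x y
    ⟪toPlane,toPlane⟫ x y = trans (⟪toPlane,⟫ x (toPlane y))
      (+-cong (*-congˡ (β-combination (α y) (β y))) (-‿cong (*-congˡ (α-combination (α y) (β y)))))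

    planeReflection-isometry : ∀ x y → ⟪ PlaneReflection.reflect x , PlaneReflection.reflect y ⟫ ≈ 1# ⊗ ⟪ x , y ⟫
    planeReflection-isometry x y = R.begin
      ⟪ PlaneReflection.reflect x , PlaneReflection.reflect y ⟫     R.≈⟨ PlaneReflection.⟪reflect⟫ x y ⟩
      _   R.≈⟨ +-cong (+-congˡ (-‿cong (+-cong (⟪,toPlane⟫ x y) (⟪,toPlane⟫ x y))))
                 (-‿cong (+-cong (+-cong (⟪toPlane,⟫ x y) (⟪toPlane,⟫ x y)) (-‿cong (+-cong 2D 2D)))) ⟩
      (⟪ x , y ⟫ - t) - (t - (t ⊕ t))     R.≈⟨ +-congˡ (-‿cong (trans (+-congˡ (sym (F.⁻¹-∙-comm t t))) (F.\\-leftDividesˡ t (- t)))) ⟩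
      (⟪ x , y ⟫ - t) - - t               R.≈⟨ F.//-rightDividesʳ (- t) ⟪ x , y ⟫ ⟩
      ⟪ x , y ⟫                           R.≈⟨ *-identityˡ _ ⟨
      1# ⊗ ⟪ x , y ⟫                      R.∎
      where
      t : Carrier
      t = D x y ⊕ D x y
      2D : ⟪ toPlane x , toPlane y ⟫ ⊕ ⟪ toPlane x , toPlane y ⟫ ≈ t
      2D = +-cong (⟪toPlane,toPlane⟫ x y) (⟪toPlane,toPlane⟫ x y)

    module _ (V-plane : ∀ x → toPlane x ≈ᴹ x) where
      ⟪,toLine⟫+⟪toLine,⟫ : ∀ x y → ⟪ x , toLine y ⟫ ⊕ ⟪ toLine x , y ⟫ ≈ ⟪ x , y ⟫
      ⟪,toLine⟫+⟪toLine,⟫ x y = R.begin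
        ⟪ x , toLine y ⟫ ⊕ ⟪ toLine x , y ⟫     R.≈⟨ +-cong (trans (⟪⟫-*ʳ (α y) x u) (⟪-,u⟫ x (α y))) (⟪⟫-*ˡ (α x) u y) ⟩
        - (β x ⊗ α y) ⊕ α x ⊗ β y               R.≈⟨ +-comm _ _ ⟩
        D x y                                   R.≈⟨ ⟪,toPlane⟫ x y ⟨
        ⟪ x , toPlane y ⟫                       R.≈⟨ ⟪⟫-cong ≈ᴹ-refl (V-plane y) ⟩
        ⟪ x , y ⟫                               R.∎

      -- In a plane the form pairs only u-components with v-components, so negating the u-components
      -- changes its sign: the expansion collapses to ⟪ x , y ⟫ - 2 ⟪ x , y ⟫.
      lineReflection-anti : ∀ x y → ⟪ LineReflection.reflect x , LineReflection.reflect y ⟫ ≈ (- 1#) ⊗ ⟪ x , y ⟫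
      lineReflection-anti x y = R.begin
        ⟪ LineReflection.reflect x , LineReflection.reflect y ⟫     R.≈⟨ LineReflection.⟪reflect⟫ x y ⟩
        _                                   R.≈⟨ +-congˡ (-‿cong (trans (+-congˡ (trans (-‿cong 4·0≈0) F.ε⁻¹≈ε)) (+-identityʳ (s ⊕ s)))) ⟩
        (⟪ x , y ⟫ - (r ⊕ r)) - (s ⊕ s)     R.≈⟨ +-assoc _ _ _ ⟩
        ⟪ x , y ⟫ ⊕ (- (r ⊕ r) - (s ⊕ s))   R.≈⟨ +-congˡ (trans (F.⁻¹-∙-comm _ _) (-‿cong (trans (+-interchange r r s s) (+-cong (⟪,toLine⟫+⟪toLine,⟫ x y) (⟪,toLine⟫+⟪toLine,⟫ x y))))) ⟩
        ⟪ x , y ⟫ - (⟪ x , y ⟫ ⊕ ⟪ x , y ⟫) R.≈⟨ trans (+-congˡ (sym (F.⁻¹-∙-comm _ _))) (F.\\-leftDividesˡ _ _) ⟩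
        - ⟪ x , y ⟫                         R.≈⟨ -1*x≈-x _ ⟨
        (- 1#) ⊗ ⟪ x , y ⟫                  R.∎
        where
        r s t : Carrier
        r = ⟪ x , toLine y ⟫
        s = ⟪ toLine x , y ⟫
        t = ⟪ toLine x , toLine y ⟫
        t≈0 : t ≈ 0#
        t≈0 = trans (⟪⟫-*ˡ _ u _) (k*0≈0 (trans (⟪⟫-*ʳ _ u u) (k*0≈0 (alternating u))))
        2·0≈0 : t ⊕ t ≈ 0#
        2·0≈0 = trans (+-cong t≈0 t≈0) (+-identityˡ 0#)
        4·0≈0 : (t ⊕ t) ⊕ (t ⊕ t) ≈ 0#
        4·0≈0 = trans (+-cong 2·0≈0 2·0≈0) (+-identityˡ 0#)

    -- A nonzero vector in the kernel of `toPlane` would give kernel and image a product of orders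
    -- of at least 2 q², more than m.
    plane-whole : 1 ≤ order → m ≡ order * order → ∀ x → toPlane x ≈ᴹ x
    plane-whole 1≤q m≡q² x with (x -ᴹ toPlane x) ≟ᴹ 0ᴹ
    ... | yes eq  = ≈ᴹ-sym (x-y≈0⇒x≈y _ _ eq)
    ... | no  neq = contradiction (ℕ.*-mono-≤ (≉0⇒2≤∣∣ PlaneReflection.kernel (PlaneReflection.complement∈kernel x) neq) q²≤∣plane∣)
      (ℕ.<⇒≱ (ℕ.≤-<-trans PlaneReflection.∣kernel∣*∣image∣≤m (ℕ.≤-<-trans (ℕ.≤-reflexive m≡q²)
        (ℕ.m<m+n _ (ℕ.≤-trans (ℕ.*-mono-≤ 1≤q 1≤q) (ℕ.≤-reflexive (≡.sym (ℕ.+-identityʳ _))))))))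

-- Indices of similitudes on vectors and on lines

primeField : ∀ {ℓ} → Prime ℓ → FiniteField 0ℓ 0ℓ
primeField {ℓ} ℓ-prime = record
  { commutativeRing = 𝔽 ℓ-prime
  ; order           = ℓ
  ; finite          = card-Fin ℓ
  ; 1≉0             = 𝔽-1≢0 ℓ-prime
  ; invertible      = 𝔽-inverse ℓ-prime
  }

module Similitudes {ℓ} {ℓ-prime : Prime ℓ} {n} (V : SymplecticSpace ℓ-prime n a b) where
  open SymplecticSpace V public using (vectorSpace; isBasis; ⟪_,_⟫)
  open FiniteField (primeField ℓ-prime) public hiding (_≉_)
  open Vectors (primeField ℓ-prime) vectorSpace public
  open Setoid (P[V] V) using () renaming (_≈_ to _≈ᴸ_)

  M : ℕ
  M = ℓ ^ (2 * n)

  abstract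
    V-finite : HasCardinality ≈ᴹ-setoid M
    V-finite = basis⇒finite isBasis

  open Finite V-finite public
  open Subspace using (Member; ∣_∣) public

  module _ (f : Similitude V) where
    open Similitude f using (to; isLinearAutomorphism)
    open IsLeftModuleIsomorphism isLinearAutomorphism using (isLeftModuleHomomorphism)
    open Endomorphism isLeftModuleHomomorphism public

  abstract
    V∖0-finite : ∃ (HasCardinality (V∖0 V))
    V∖0-finite = finite-sub (M , V-finite) (λ x≈y x≉0 y≈0 → x≉0 (≈ᴹ-trans x≈y y≈0)) (λ x → ¬? (x ≟ᴹ 0ᴹ))

  ∣V∖0∣+1≡M : proj₁ V∖0-finite + 1 ≡ M
  ∣V∖0∣+1≡M = ℕ.≤-antisym
    (ℕ.≤-trans (nonzeros≤ (proj₂ V∖0-finite) wholeSpace proj₁ id proj₂ _) (∣∣≤m wholeSpace))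
    (ℕ.≤-trans m≤∣wholeSpace∣ (nonzeros≥ (proj₂ V∖0-finite) wholeSpace (λ {x} _ x≉0 → x , x≉0) id))

  -- `IndexBounds` with the zero vector added both to the set and to the fixed points, which turns
  -- the number of fixed points into the order of an eigenspace.
  record VectorIndex (f : Similitude V) (i : ℕ) : Set (a ⊔ b) where
    open Similitude f using (to)
    field
      lower    : M ≤ i + i + ∣ eigenspace f 1# ∣
      lower₃   : (∀ x → to (to x) ≈ᴹ x → to x ≈ᴹ x) → M + M ≤ i + i + i + (∣ eigenspace f 1# ∣ + ∣ eigenspace f 1# ∣)
      upper    : (∀ x → to (to x) ≈ᴹ x) → i + i + ∣ eigenspace f 1# ∣ ≤ M

  abstract
    vector-index : ∀ f → ∃[ i ] HasIndex (PermutationRepresentation.perm (πvec-action V) f) i × VectorIndex f i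
    vector-index f = i , bounds.hasIndex , record
      { lower    = begin
          M                         ≡⟨ ∣V∖0∣+1≡M ⟨
          k + 1                     ≤⟨ ℕ.+-monoˡ-≤ 1 bounds.lower ⟩
          i + i + j + 1             ≡⟨ ℕ.+-assoc (i + i) j 1 ⟩
          i + i + (j + 1)           ≤⟨ ℕ.+-monoʳ-≤ (i + i) j+1≤e ⟩
          i + i + ∣ E ∣             ∎
      ; lower₃   = λ no2 → begin
          M + M                     ≡⟨ ≡.cong₂ _+_ ∣V∖0∣+1≡M ∣V∖0∣+1≡M ⟨
          (k + 1) + (k + 1)         ≡⟨ solve 1 (λ k → (k :+ con 1) :+ (k :+ con 1) := k :+ k :+ con 2) ≡.refl k ⟩
          k + k + 2                 ≤⟨ ℕ.+-monoˡ-≤ 2 (bounds.lower₃ (λ (x , _) → no2 x)) ⟩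
          i + i + i + (j + j) + 2   ≡⟨ solve 2 (λ i j → i :+ (j :+ j) :+ con 2 := i :+ ((j :+ con 1) :+ (j :+ con 1))) ≡.refl (i + i + i) j ⟩
          i + i + i + ((j + 1) + (j + 1)) ≤⟨ ℕ.+-monoʳ-≤ (i + i + i) (ℕ.+-mono-≤ j+1≤e j+1≤e) ⟩
          i + i + i + (∣ E ∣ + ∣ E ∣) ∎
      ; upper    = λ invol → begin
          i + i + ∣ E ∣             ≤⟨ ℕ.+-monoʳ-≤ (i + i) e≤j+1 ⟩
          i + i + (j + 1)           ≡⟨ ℕ.+-assoc (i + i) j 1 ⟨
          i + i + j + 1             ≤⟨ ℕ.+-monoˡ-≤ 1 (bounds.upper (λ (x , _) → invol x)) ⟩
          k + 1                     ≡⟨ ∣V∖0∣+1≡M ⟩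
          M                         ∎
      }
      where
      open ℕ.≤-Reasoning
      σ : Permutation (V∖0 V)
      σ = PermutationRepresentation.perm (πvec-action V) f
      E : Subspace b
      E = eigenspace f 1#
      k j i : ℕ
      k = proj₁ V∖0-finite
      k-card : HasCardinality (V∖0 V) k
      k-card = proj₂ V∖0-finite
      j = proj₁ (fixedPoints-finite σ k-card)
      j-card : HasCardinality (FixedPoints σ) j
      j-card = proj₂ (fixedPoints-finite σ k-card)
      i = proj₁ (index-bounds σ k-card j-card)
      module bounds = IndexBounds (proj₂ (index-bounds σ k-card j-card))
      j+1≤e : j + 1 ≤ ∣ E ∣
      j+1≤e = nonzeros≤ j-card E (λ ((x , _) , _) → x) id (λ ((_ , x≉0) , _) → x≉0)
        (λ ((x , _) , fx≈x) → ≈ᴹ-trans fx≈x (≈ᴹ-sym (*ₗ-identityˡ x)))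
      e≤j+1 : ∣ E ∣ ≤ j + 1
      e≤j+1 = nonzeros≥ j-card E (λ {x} x∈ x≉0 → (x , x≉0) , ≈ᴹ-trans x∈ (*ₗ-identityˡ x)) id

  private
    infix 4 _∈ᴸ_
    _∈ᴸ_ : Carrierᴹ → Line V → Set b
    x ∈ᴸ L = _∈_ V x L

    ∈-resp-≈ᴸ : ∀ {x L L′} → L ≈ᴸ L′ → x ∈ᴸ L → x ∈ᴸ L′
    ∈-resp-≈ᴸ {x} L≈L′ = Equivalence.to (L≈L′ x)

    _≟ᴸ_ : Decidable _≈ᴸ_
    L ≟ᴸ L′ = map′ (generator-∈⇒≈ V L L′) (λ L≈L′ → ∈-resp-≈ᴸ {L = L} {L′} L≈L′ (generator-∈ V L))
      (Fin.any? λ k → Line.generator L ≟ᴹ (k *ₗ Line.generator L′))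

  abstract
    P[V]-finite : ∃ (HasCardinality (P[V] V))
    P[V]-finite = finite-image V∖0-finite (record
      { to         = λ (x , x≉0) → line x x≉0
      ; cong       = λ {x} {y} x≈y → same x y x≈y
      ; surjective = λ (line x x≉0) → (x , x≉0) , λ {y} y≈x → same y (x , x≉0) y≈x
      }) _≟ᴸ_
      where
      same : ∀ x y → proj₁ x ≈ᴹ proj₁ y → line {V = V} (proj₁ x) (proj₂ x) ≈ᴸ line (proj₁ y) (proj₂ y)
      same (x , x≉0) (y , y≉0) x≈y = generator-∈⇒≈ V (line x x≉0) (line y y≉0) (1# , ≈ᴹ-trans x≈y (≈ᴹ-sym (*ₗ-identityˡ y)))

  -- Counts the pairs (L , x) with x ∈ L, for L in a family of lines with nonzero
  -- vectors X.
  module _ {𝓛 : Setoid o₁ e₁} {X : Setoid o₂ e₂} {r N}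
           (𝓛-card : HasCardinality 𝓛 r) (X-card : HasCardinality X N) where
    private
      module 𝓛 = Setoid 𝓛
      module X = Setoid X

    count-vectors : (toLine : 𝓛.Carrier → Line V) → (∀ {L L′} → L 𝓛.≈ L′ → toLine L ≈ᴸ toLine L′) →
      (∀ {L L′} → toLine L ≈ᴸ toLine L′ → L 𝓛.≈ L′) →
      (vector : X.Carrier → Carrierᴹ) → (∀ {x y} → x X.≈ y → vector x ≈ᴹ vector y) → (∀ {x y} → vector x ≈ᴹ vector y → x X.≈ y) → (∀ x → ¬ vector x ≈ᴹ 0ᴹ) →
      (spanned : X.Carrier → 𝓛.Carrier) → (∀ x → vector x ∈ᴸ toLine (spanned x)) →
      (∀ {v} L → v ∈ᴸ toLine L → ¬ v ≈ᴹ 0ᴹ → ∃[ x ] vector x ≈ᴹ v) → ℓ * r ≡ N + r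
    count-vectors toLine toLine-cong toLine-injective vector vector-cong vector-injective vector≉0 spanned ∈-spanned vector-surjective =
      ℕ.≤-antisym
        (injective⇒card-≤ (card-× finite 𝓛-card) (card-⊎ X-card 𝓛-card) split λ {x} {y} → split-injective x y)
        (injective⇒card-≤ (card-⊎ X-card 𝓛-card) (card-× finite 𝓛-card) join λ {x} {y} → join-injective x y)
      where
      module S = Setoid (X ⊎ₛ 𝓛)
      module T = Setoid (setoid ×ₛ 𝓛)

      rep : 𝓛.Carrier → 𝓛.Carrier
      rep = canonical 𝓛-card
      -- Equal lines may come with different generators, so the generator is read at the
      -- representative.
      gen : 𝓛.Carrier → Carrierᴹ
      gen L = Line.generator (toLine (rep L))
      gen≉0 : ∀ L → ¬ gen L ≈ᴹ 0ᴹ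
      gen≉0 L = Line.generator≉0 (toLine (rep L))
      gen-cong : ∀ {L L′} → L 𝓛.≈ L′ → gen L ≡ gen L′
      gen-cong = ≡.cong (λ L → Line.generator (toLine L)) ∘ canonical-cong 𝓛-card

      multiple : ∀ {k} → ¬ k ≈ 0# → (L : 𝓛.Carrier) → ∃[ x ] vector x ≈ᴹ k *ₗ gen L
      multiple {k} k≉0 L = vector-surjective (rep L) (k , ≈ᴹ-refl) (λ eq → gen≉0 L (kx≈0⇒x≈0 k≉0 eq))

      -- A pair (k , L) stands for k times the generator of L. Nonzero multiples are vectors of X;
      -- the zero multiple is kept once per line, which is the summand r.
      split : T.Carrier → S.Carrier
      split (k , L) with k ≈? 0#
      ... | yes _   = inj₂ L
      ... | no  k≉0 = inj₁ (proj₁ (multiple k≉0 L))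

      sameLine : ∀ {k h L L′} → ¬ k ≈ 0# → k *ₗ gen L ≈ᴹ h *ₗ gen L′ → L 𝓛.≈ L′
      sameLine {k} {h} {L} {L′} k≉0 eq = 𝓛.trans (𝓛.sym (canonical-≈ 𝓛-card L)) (𝓛.trans
        (toLine-injective (generator-∈⇒≈ V (toLine (rep L)) (toLine (rep L′)) (k⁻¹ ⊗ h ,
          ≈ᴹ-trans (≈ᴹ-sym (*ₗ-inverse k⁻¹k≈1 (gen L))) (≈ᴹ-trans (*ₗ-congˡ eq) (≈ᴹ-sym (*ₗ-assoc k⁻¹ h (gen L′)))))))
        (canonical-≈ 𝓛-card L′))
        where
        k⁻¹ : Carrier
        k⁻¹ = proj₁ (invertible k k≉0)
        k⁻¹k≈1 : k⁻¹ ⊗ k ≈ 1#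
        k⁻¹k≈1 = proj₂ (invertible k k≉0)

      multiple-injective : ∀ {k h} (k≉0 : ¬ k ≈ 0#) (h≉0 : ¬ h ≈ 0#) L L′ →
        proj₁ (multiple k≉0 L) X.≈ proj₁ (multiple h≉0 L′) → k ≈ h × L 𝓛.≈ L′
      multiple-injective {k} {h} k≉0 h≉0 L L′ eq = kx≈hx⇒k≈h (gen≉0 L)
          (≈ᴹ-trans eq′ (*ₗ-congˡ (≈ᴹ-reflexive (≡.sym (gen-cong L≈L′))))) , L≈L′
        where
        eq′ : k *ₗ gen L ≈ᴹ h *ₗ gen L′
        eq′ = ≈ᴹ-trans (≈ᴹ-sym (proj₂ (multiple k≉0 L))) (≈ᴹ-trans (vector-cong eq) (proj₂ (multiple h≉0 L′)))
        L≈L′ : L 𝓛.≈ L′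
        L≈L′ = sameLine k≉0 eq′

      split-injective : ∀ x y → split x S.≈ split y → x T.≈ y
      split-injective (k , L) (h , L′) eq with k ≈? 0# | h ≈? 0# | eq
      ... | yes k≈0 | yes h≈0 | inj₂ L≈L′ = trans k≈0 (sym h≈0) , L≈L′
      ... | no  k≉0 | no  h≉0 | inj₁ eq   = multiple-injective k≉0 h≉0 L L′ eq
      ... | yes _   | no  _   | ()
      ... | no  _   | yes _   | ()

      coefficient : ∀ x → ∃[ k ] vector x ≈ᴹ k *ₗ gen (spanned x)
      coefficient x = ∈-resp-≈ᴸ {L = toLine (spanned x)} {toLine (rep (spanned x))}
        (toLine-cong (𝓛.sym (canonical-≈ 𝓛-card (spanned x)))) (∈-spanned x)

      coefficient≉0 : ∀ x → ¬ proj₁ (coefficient x) ≈ 0#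
      coefficient≉0 x k≈0 = vector≉0 x (≈ᴹ-trans (proj₂ (coefficient x)) (≈ᴹ-trans (*ₗ-congʳ k≈0) (*ₗ-zeroˡ _)))

      join : S.Carrier → T.Carrier
      join (inj₁ x) = proj₁ (coefficient x) , spanned x
      join (inj₂ L) = 0# , L

      join-injective : ∀ x y → join x T.≈ join y → x S.≈ y
      join-injective (inj₁ x) (inj₁ y) (k≈h , L≈L′) = inj₁ (vector-injective (≈ᴹ-trans (proj₂ (coefficient x))
        (≈ᴹ-trans (*ₗ-cong k≈h (≈ᴹ-reflexive (gen-cong L≈L′))) (≈ᴹ-sym (proj₂ (coefficient y))))))
      join-injective (inj₁ x) (inj₂ L) (k≈0 , _) = contradiction k≈0 (coefficient≉0 x)
      join-injective (inj₂ L) (inj₁ y) (0≈h , _) = contradiction (sym 0≈h) (coefficient≉0 y)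
      join-injective (inj₂ L) (inj₂ L′) (_ , L≈L′) = inj₂ L≈L′

  module _ (f : Similitude V) where
    open Similitude f using (to; ⟦⟧-cong; *ₗ-homo)

    nonzeroEigenvectors-finite : ∃ (HasCardinality (NonzeroEigenvectors f))
    nonzeroEigenvectors-finite = finite-sub (M , V-finite)
      (λ x≈y (x≉0 , k , eq) → (λ y≈0 → x≉0 (≈ᴹ-trans x≈y y≈0)) , k ,
        ≈ᴹ-trans (⟦⟧-cong (≈ᴹ-sym x≈y)) (≈ᴹ-trans eq (*ₗ-congˡ x≈y)))
      (λ x → ¬? (x ≟ᴹ 0ᴹ) ×-dec IsEigenvector? f x)

    -- `IndexBounds` multiplied by ℓ - 1, the number of nonzero vectors on a line: numbers of lines
    -- become numbers of vectors, fixed lines become `N`, and the remaining constants are zero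
    -- vectors.
    record LineIndex (i N : ℕ) : Set (a ⊔ b) where
      field
        N-card   : HasCardinality (NonzeroEigenvectors f) N
        lower    : M ≤ (ℓ ∸ 1) * (i + i) + (N + 1)
        lower₃   : (∀ x → IsEigenvector f x ⊎ ¬ (∃[ k ] to (to x) ≈ᴹ k *ₗ x)) →
                   M + M ≤ (ℓ ∸ 1) * (i + i + i) + (N + N + 2)
        upper    : (∀ x → to (to x) ≈ᴹ x) → (ℓ ∸ 1) * (i + i) + (N + 1) ≤ M

    abstract
      line-index : ∃₂ λ i N → HasIndex (PermutationRepresentation.perm (πproj-action V) f) i × LineIndex i N
      line-index = i , N , bounds.hasIndex , record
        { N-card   = N-card
        ; lower    = begin
            M                               ≡⟨ M≡pr+1 ⟩
            p * r + 1                       ≤⟨ ℕ.+-monoˡ-≤ 1 (ℕ.*-monoʳ-≤ p bounds.lower) ⟩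
            p * (i + i + j) + 1             ≡⟨ solve 3 (λ p i j → p :* (i :+ j) :+ con 1 := p :* i :+ (p :* j :+ con 1)) ≡.refl p (i + i) j ⟩
            p * (i + i) + (p * j + 1)       ≡⟨ ≡.cong (λ m → p * (i + i) + (m + 1)) pj≡N ⟩
            p * (i + i) + (N + 1)           ∎
        ; lower₃   = λ no2 → begin
            M + M                           ≡⟨ ≡.cong (λ m → m + m) M≡pr+1 ⟩
            (p * r + 1) + (p * r + 1)       ≡⟨ solve 2 (λ p r → (p :* r :+ con 1) :+ (p :* r :+ con 1) := p :* (r :+ r) :+ con 2) ≡.refl p r ⟩
            p * (r + r) + 2                 ≤⟨ ℕ.+-monoˡ-≤ 2 (ℕ.*-monoʳ-≤ p (bounds.lower₃ (noTwoCycles no2))) ⟩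
            p * (i + i + i + (j + j)) + 2   ≡⟨ solve 3 (λ p i j → p :* (i :+ (j :+ j)) :+ con 2 := p :* i :+ (p :* j :+ p :* j :+ con 2)) ≡.refl p (i + i + i) j ⟩
            p * (i + i + i) + (p * j + p * j + 2) ≡⟨ ≡.cong (λ m → p * (i + i + i) + (m + m + 2)) pj≡N ⟩
            p * (i + i + i) + (N + N + 2)   ∎
        ; upper    = λ invol → begin
            p * (i + i) + (N + 1)           ≡⟨ ≡.cong (λ m → p * (i + i) + (m + 1)) pj≡N ⟨
            p * (i + i) + (p * j + 1)       ≡⟨ solve 3 (λ p i j → p :* (i :+ j) :+ con 1 := p :* i :+ (p :* j :+ con 1)) ≡.refl p (i + i) j ⟨
            p * (i + i + j) + 1             ≤⟨ ℕ.+-monoˡ-≤ 1 (ℕ.*-monoʳ-≤ p (bounds.upper (involutive invol))) ⟩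
            p * r + 1                       ≡⟨ M≡pr+1 ⟨
            M                               ∎
        }
        where
        open ℕ.≤-Reasoning
        σ : Permutation (P[V] V)
        σ = PermutationRepresentation.perm (πproj-action V) f
        p r j i N : ℕ
        p = ℓ ∸ 1
        r = proj₁ P[V]-finite
        r-card : HasCardinality (P[V] V) r
        r-card = proj₂ P[V]-finite
        j = proj₁ (fixedPoints-finite σ r-card)
        j-card : HasCardinality (FixedPoints σ) j
        j-card = proj₂ (fixedPoints-finite σ r-card)
        i = proj₁ (index-bounds σ r-card j-card)
        module bounds = IndexBounds (proj₂ (index-bounds σ r-card j-card))
        N = proj₁ nonzeroEigenvectors-finite
        N-card : HasCardinality (NonzeroEigenvectors f) N
        N-card = proj₂ nonzeroEigenvectors-finite

        ℓ≡1+p : ℓ ≡ suc p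
        ℓ≡1+p = ≡.sym (ℕ.m+[n∸m]≡n {1} (>-nonZero⁻¹ ℓ {{prime⇒nonZero ℓ-prime}}))

        cancel : ∀ {m} s → ℓ * s ≡ m + s → p * s ≡ m
        cancel {m} s eq = ℕ.+-cancelʳ-≡ s _ _ (≡.trans (ℕ.+-comm (p * s) s) (≡.trans (≡.cong (_* s) (≡.sym ℓ≡1+p)) eq))

        fixed⇒eigen : ∀ L → actLine V f L ≈ᴸ L → IsEigenvector f (Line.generator L)
        fixed⇒eigen L fixed = ∈-resp-≈ᴸ {L = actLine V f L} {L} fixed (generator-∈ V (actLine V f L))

        M≡pr+1 : M ≡ p * r + 1
        M≡pr+1 = ≡.trans (≡.sym ∣V∖0∣+1≡M) (≡.cong (_+ 1) (≡.sym (cancel r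
          (count-vectors r-card (proj₂ V∖0-finite) id id id proj₁ id id proj₂
            (λ (x , x≉0) → line x x≉0) (λ (x , x≉0) → generator-∈ V (line x x≉0)) (λ {v} _ _ v≉0 → (v , v≉0) , ≈ᴹ-refl)))))

        pj≡N : p * j ≡ N
        pj≡N = cancel j (count-vectors j-card N-card proj₁ id id proj₁ id id (λ (_ , x≉0 , _) → x≉0)
          (λ (x , x≉0 , eigen) → line x x≉0 , generator-∈⇒≈ V (actLine V f (line x x≉0)) (line x x≉0) eigen)
          (λ (x , x≉0 , _) → generator-∈ V (line x x≉0))
          (λ {v} (L , fixed) (k , v≈ku) v≉0 → let (h , fu≈hu) = fixed⇒eigen L fixed in
            (v , v≉0 , h , ≈ᴹ-trans (⟦⟧-cong v≈ku) (≈ᴹ-trans (*ₗ-homo k _) (≈ᴹ-trans (*ₗ-congˡ fu≈hu)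
              (≈ᴹ-trans (*ₗ-comm k h _) (*ₗ-congˡ (≈ᴹ-sym v≈ku)))))) , ≈ᴹ-refl))

        noTwoCycles : (∀ x → IsEigenvector f x ⊎ ¬ (∃[ k ] to (to x) ≈ᴹ k *ₗ x)) →
                      ∀ L → actLine V f (actLine V f L) ≈ᴸ L → actLine V f L ≈ᴸ L
        noTwoCycles no2 L fixed with no2 (Line.generator L)
        ... | inj₁ eigen = generator-∈⇒≈ V (actLine V f L) L eigen
        ... | inj₂ ¬eigen = contradiction (∈-resp-≈ᴸ {L = actLine V f (actLine V f L)} {L} fixed
                              (generator-∈ V (actLine V f (actLine V f L)))) ¬eigen

        involutive : (∀ x → to (to x) ≈ᴹ x) → ∀ L → actLine V f (actLine V f L) ≈ᴸ L
        involutive invol L = generator-∈⇒≈ V (actLine V f (actLine V f L)) L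
          (1# , ≈ᴹ-trans (invol (Line.generator L)) (≈ᴹ-sym (*ₗ-identityˡ _)))

-- The Malle invariants

-- Together with `≤-/2` this squeezes an index with m ≤ 2 i and 2 i ≤ m to the floor `m / 2` of the
-- theorem.
/2-≤ : ∀ {m i} → m ≤ i + i → m / 2 ≤ i
/2-≤ {m} {i} m≤2i = begin
  m / 2        ≤⟨ /-monoˡ-≤ 2 m≤2i ⟩
  (i + i) / 2  ≡⟨ ≡.cong (_/ 2) (solve 1 (λ i → i :+ i := i :* con 2) ≡.refl i) ⟩
  i * 2 / 2    ≡⟨ m*n/n≡m i 2 ⟩
  i            ∎
  where open ℕ.≤-Reasoning

≤-/2 : ∀ {m i} → i + i ≤ m → i ≤ m / 2
≤-/2 {m} {i} 2i≤m = begin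
  i            ≡⟨ m*n/n≡m i 2 ⟨
  i * 2 / 2    ≡⟨ ≡.cong (_/ 2) (solve 1 (λ i → i :+ i := i :* con 2) ≡.refl i) ⟨
  (i + i) / 2  ≤⟨ /-monoˡ-≤ 2 2i≤m ⟩
  m / 2        ∎
  where open ℕ.≤-Reasoning

-- (e − s)(Q − e) ≥ 0.
sum≤-of-product≤ : ∀ {s Q e o} → 1 ≤ s → s ≤ e → e ≤ Q → e * o ≤ s * Q → e + o ≤ Q + s
sum≤-of-product≤ {s} {Q} {e} {o} 1≤s s≤e e≤Q eo≤sQ with ℕ.m≤n⇒∃[o]m+o≡n s≤e | ℕ.m≤n⇒∃[o]m+o≡n e≤Q
... | d , ≡.refl | d′ , ≡.refl = ℕ.*-cancelˡ-≤ e {{>-nonZero (ℕ.≤-trans 1≤s s≤e)}} (begin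
  e * (e + o)                        ≡⟨ ℕ.*-distribˡ-+ e e o ⟩
  e * e + e * o                      ≤⟨ ℕ.+-monoʳ-≤ (e * e) eo≤sQ ⟩
  e * e + s * (e + d′)               ≤⟨ ℕ.m≤m+n _ (d * d′) ⟩
  e * e + s * (e + d′) + d * d′      ≡⟨ solve 3 (λ s d d′ → let e = s :+ d in
                                          e :* e :+ s :* (e :+ d′) :+ d :* d′ := e :* (e :+ d′ :+ s)) ≡.refl s d d′ ⟩
  e * (e + d′ + s)                   ∎)
  where open ℕ.≤-Reasoning

-- The index of a transvection exceeds that of an involution: 4 ℓ ≤ ℓ² + 3.
transvection-arithmetic : ∀ {ℓ Q i} → 3 ≤ ℓ → ℓ * ℓ * Q + ℓ * ℓ * Q ≤ i + i + i + (Q * ℓ + Q * ℓ) → ℓ * ℓ * Q ≤ i + i + Q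
transvection-arithmetic {ℓ} {Q} {i} 3≤ℓ le with ℕ.m≤n⇒∃[o]m+o≡n 3≤ℓ
... | d , ≡.refl = ℕ.*-cancelˡ-≤ 3 (ℕ.+-cancelʳ-≤ (4 * (ℓ * Q)) _ _ (begin
  -- For ℓ = 3 + d the slack ℓ² + 3 - 4 ℓ = (ℓ - 1)(ℓ - 3) equals 2 d + d².
  3 * (ℓ * ℓ * Q) + 4 * (ℓ * Q)                                ≤⟨ ℕ.m≤m+n _ ((2 * d + d * d) * Q) ⟩
  3 * (ℓ * ℓ * Q) + 4 * (ℓ * Q) + (2 * d + d * d) * Q          ≡⟨ solve 2 (λ d Q → let ℓ = con 3 :+ d in
      con 3 :* (ℓ :* ℓ :* Q) :+ con 4 :* (ℓ :* Q) :+ (con 2 :* d :+ d :* d) :* Q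
        := con 2 :* (ℓ :* ℓ :* Q :+ ℓ :* ℓ :* Q) :+ con 3 :* Q) ≡.refl d Q ⟩
  2 * (ℓ * ℓ * Q + ℓ * ℓ * Q) + 3 * Q                          ≤⟨ ℕ.+-monoˡ-≤ (3 * Q) (ℕ.*-monoʳ-≤ 2 le) ⟩
  2 * (i + i + i + (Q * ℓ + Q * ℓ)) + 3 * Q                    ≡⟨ solve 3 (λ ℓ Q i →
      con 2 :* (i :+ i :+ i :+ (Q :* ℓ :+ Q :* ℓ)) :+ con 3 :* Q := con 3 :* (i :+ i :+ Q) :+ con 4 :* (ℓ :* Q)) ≡.refl ℓ Q i ⟩
  3 * (i + i + Q) + 4 * (ℓ * Q)                                ∎))
  where open ℕ.≤-Reasoning

module _ {ℓ} {ℓ-prime : Prime ℓ} {n} (V : SymplecticSpace ℓ-prime n a b) where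
  symplecticForm : SymplecticForm (primeField ℓ-prime) (SymplecticSpace.vectorSpace V)
  symplecticForm = record
    { ⟪_,_⟫ = ⟪_,_⟫ ; ⟪⟫-cong = ⟪⟫-cong ; ⟪⟫-+ˡ = ⟪⟫-+ˡ ; ⟪⟫-*ˡ = ⟪⟫-*ˡ ; ⟪⟫-+ʳ = ⟪⟫-+ʳ ; ⟪⟫-*ʳ = ⟪⟫-*ʳ
    ; alternating = alternating ; nondegenerate = nondegenerate }
    where open SymplecticSpace V

module _ {ℓ} (ℓ-prime : Prime ℓ) (ℓ-odd : ¬ (2 ∣ ℓ)) where
  private
    instance
      ℓ-nonZero : NonZero ℓ
      ℓ-nonZero = prime⇒nonZero ℓ-prime
  open FiniteField (primeField ℓ-prime) using (_≈_; 0#; 1#; _⊕_)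
  open ResidueRing ℓ using (mod-⊕; toℕ-mod)

  3≤ℓ : 3 ≤ ℓ
  3≤ℓ = ℕ.≤∧≢⇒< (nonTrivial⇒n>1 ℓ {{prime⇒nonTrivial ℓ-prime}}) λ 2≡ℓ → ℓ-odd (≡.subst (2 ∣_) 2≡ℓ (divides 1 ≡.refl))

  odd⇒2≉0 : ¬ 1# ⊕ 1# ≈ 0#
  odd⇒2≉0 eq = contradiction (≡.trans (≡.sym (m<n⇒m%n≡m 3≤ℓ)) (≡.trans (≡.sym (toℕ-mod 2))
    (≡.trans (≡.cong toℕ (≡.trans (≡.sym (mod-⊕ 1 1)) eq)) (≡.trans (toℕ-mod 0) (m<n⇒m%n≡m (>-nonZero⁻¹ ℓ)))))) λ ()

module MalleInvariant {ℓ} {ℓ-prime : Prime ℓ} (ℓ-odd : ¬ (2 ∣ ℓ)) {n} (V : SymplecticSpace ℓ-prime n a b) where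
  open Similitudes V
  open OddCharacteristic (primeField ℓ-prime) vectorSpace (symplecticForm V) V-finite (odd⇒2≉0 ℓ-prime ℓ-odd)
    hiding (isLinear)

  private
    module Vec  = Group (GSp V)
    module Proj = Group (PGSp V)

    p : ℕ
    p = ℓ ∸ 1

    1≤ℓ : 1 ≤ ℓ
    1≤ℓ = ℕ.≤-trans (s≤s z≤n) (3≤ℓ ℓ-prime ℓ-odd)

    2≤ℓ : 2 ≤ ℓ
    2≤ℓ = ℕ.≤-trans (s≤s (s≤s z≤n)) (3≤ℓ ℓ-prime ℓ-odd)

  linear : (f : Similitude V) → IsLeftModuleHomomorphism rawLeftModule rawLeftModule (Similitude.to f)
  linear f = IsLeftModuleIsomorphism.isLeftModuleHomomorphism (Similitude.isLinearAutomorphism f)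

  vectorIndex lineIndex : Similitude V → ℕ
  vectorIndex f = proj₁ (vector-index f)
  lineIndex f = proj₁ (line-index f)

  -- Such a map fixes every line, and faithfulness on lines then delivers the scalar for the inverse
  -- that equality in the quotient asks for.
  scalar⇒∼ε : ∀ f k → (∀ x → Similitude.to f x ≈ᴹ k *ₗ x) → f Proj.≈ Proj.ε
  scalar⇒∼ε f k f≈k = πproj-faithful V f λ L → generator-∈⇒≈ V (actLine V f L) L (k , f≈k (Line.generator L))

  -- 2 ≤ Q holds if dim V > 2, and then a hyperplane has more than ℓ elements.
  module _ {Q} (M≡ℓℓQ : M ≡ ℓ * ℓ * Q) (2≤Q : 2 ≤ Q) where
    private
      hyperplane-card : ∀ {e} → e * ℓ ≤ M → M ≤ e * ℓ → e ≡ Q * ℓ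
      hyperplane-card {e} ≤M M≤ = ℕ.*-cancelʳ-≡ e (Q * ℓ) ℓ {{>-nonZero 1≤ℓ}} (≡.trans (ℕ.≤-antisym ≤M M≤)
        (≡.trans M≡ℓℓQ (solve 2 (λ l Q → l :* l :* Q := Q :* l :* l) ≡.refl ℓ Q)))

      deep-card : ∀ {e} → e * ℓ * ℓ ≤ M → e ≤ Q
      deep-card {e} le = ℕ.*-cancelʳ-≤ e Q (ℓ * ℓ) {{>-nonZero (ℕ.*-mono-≤ 1≤ℓ 1≤ℓ)}}
        (ℕ.≤-trans (ℕ.≤-reflexive (≡.sym (ℕ.*-assoc e ℓ ℓ))) (ℕ.≤-trans le (ℕ.≤-reflexive (≡.trans M≡ℓℓQ (ℕ.*-comm (ℓ * ℓ) Q)))))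

      ℓ<Qℓ : ∀ {e} → e ≡ Q * ℓ → ℓ < e
      ℓ<Qℓ ≡.refl = ℕ.<-≤-trans (ℕ.m<m+n ℓ (ℕ.≤-trans 1≤ℓ (ℕ.m≤m+n ℓ 0))) (ℕ.*-monoˡ-≤ ℓ 2≤Q)

    vectorIndex≥ : ∀ f → ¬ f Vec.≈ Vec.ε → M ≤ vectorIndex f + vectorIndex f + Q
    vectorIndex≥ f f≉ε with codimension (eigenspace f 1#)
    ... | whole E=V = contradiction (λ x → ≈ᴹ-trans (E=V x) (*ₗ-identityˡ x)) f≉ε
    ... | deep le = ℕ.≤-trans (VectorIndex.lower (proj₂ (proj₂ (vector-index f)))) (ℕ.+-monoʳ-≤ _ (deep-card le))
    ... | hyperplane u u∉E V⊆E+u ≤M M≤ = ℕ.≤-trans (ℕ.≤-reflexive M≡ℓℓQ) (transvection-arithmetic {ℓ} {Q} {i} (3≤ℓ ℓ-prime ℓ-odd)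
      (≡.subst₂ (λ m e → m + m ≤ i + i + i + (e + e)) M≡ℓℓQ e≡Qℓ (VectorIndex.lower₃ (proj₂ (proj₂ (vector-index f))) no2)))
      where
      open Similitude f
      i : ℕ
      i = vectorIndex f
      e≡Qℓ : ∣ eigenspace f 1# ∣ ≡ Q * ℓ
      e≡Qℓ = hyperplane-card ≤M M≤
      no2 : ∀ x → to (to x) ≈ᴹ x → to x ≈ᴹ x
      no2 x ffx≈x = ≈ᴹ-trans (transvection-no2cycle (linear f) multiplier≉0 ⟪⟫-scaled 1# V⊆E+u (ℓ<Qℓ e≡Qℓ)
        (≈ᴹ-trans ffx≈x (≈ᴹ-sym (*ₗ-identityˡ x)))) (*ₗ-identityˡ x)

    lineIndex≥ : ∀ f → ¬ f Proj.≈ Proj.ε → M + 1 ≤ p * (lineIndex f + lineIndex f) + (Q + ℓ * ℓ)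
    lineIndex≥ f f≉ε = case Fin.any? (λ k → ℓ * ℓ ℕ.≤? ∣ eigenspace f k ∣) of λ where
        -- At most one generator per eigenvalue gives N ≤ ℓ², and 2 ≤ Q absorbs the 2.
        (no  small) → fromEigenvectors (ℕ.≤-trans (ℕ.+-monoˡ-≤ 2 (nonzeroEigenvectors≤q² f N-card (smallEigenspaces small)))
          (ℕ.≤-trans (ℕ.+-monoʳ-≤ (ℓ * ℓ) 2≤Q) (ℕ.≤-reflexive (ℕ.+-comm (ℓ * ℓ) Q))))
        (yes (k , large)) → largeEigenspace k large (codimension (eigenspace f k))
      where
      open Similitude f
      open ℕ.≤-Reasoning
      i N : ℕ
      i = lineIndex f
      N = proj₁ (proj₂ (line-index f))
      module index = LineIndex (proj₂ (proj₂ (proj₂ (line-index f))))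
      open index using (N-card)

      fromEigenvectors : N + 2 ≤ Q + ℓ * ℓ → M + 1 ≤ p * (i + i) + (Q + ℓ * ℓ)
      fromEigenvectors le = begin
        M + 1                       ≤⟨ ℕ.+-monoˡ-≤ 1 index.lower ⟩
        p * (i + i) + (N + 1) + 1   ≡⟨ solve 2 (λ x y → x :+ (y :+ con 1) :+ con 1 := x :+ (y :+ con 2)) ≡.refl (p * (i + i)) N ⟩
        p * (i + i) + (N + 2)       ≤⟨ ℕ.+-monoʳ-≤ (p * (i + i)) le ⟩
        p * (i + i) + (Q + ℓ * ℓ)   ∎

      smallEigenspaces : ¬ (∃[ k ] ℓ * ℓ ≤ ∣ eigenspace f k ∣) →
                         ∀ k → ∃[ u ] ∀ {x} → Member (eigenspace f k) x → ∃[ h ] x ≈ᴹ h *ₗ u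
      smallEigenspaces small k with dimension (eigenspace f k)
      ... | point E=0    = 0ᴹ , λ x∈E → 0# , ≈ᴹ-trans (E=0 x∈E) (≈ᴹ-sym (*ₗ-zeroʳ 0#))
      ... | line u E⊆u _ = u , E⊆u
      ... | plane large  = contradiction (k , large) small

      largeEigenspace : ∀ k → ℓ * ℓ ≤ ∣ eigenspace f k ∣ → Codimension (eigenspace f k) → M + 1 ≤ p * (i + i) + (Q + ℓ * ℓ)
      largeEigenspace k large (whole E=V) = contradiction (scalar⇒∼ε f k E=V) f≉ε
      largeEigenspace k large (deep le) = fromEigenvectors (ℕ.≤-trans (nonzeroEigenvectors≤ f k N-card)
        (sum≤-of-product≤ (ℕ.*-mono-≤ 1≤ℓ 1≤ℓ) large (deep-card le)
          (ℕ.≤-trans (∣eigenspace∣*∣others∣≤m f k) (ℕ.≤-reflexive M≡ℓℓQ))))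
      largeEigenspace k large (hyperplane u u∉E V⊆E+u ≤M M≤) = begin
        M + 1                              ≡⟨ ≡.cong (_+ 1) M≡ℓℓQ ⟩
        -- The inequality for vectors is reused with `p * i` in the role of the index; the 1 is
        -- absorbed by ℓ².
        ℓ * ℓ * Q + 1                      ≤⟨ ℕ.+-mono-≤ (transvection-arithmetic {ℓ} {Q} {p * i} (3≤ℓ ℓ-prime ℓ-odd) bound) (ℕ.*-mono-≤ 1≤ℓ 1≤ℓ) ⟩
        p * i + p * i + Q + ℓ * ℓ          ≡⟨ solve 4 (λ p i q s → p :* i :+ p :* i :+ q :+ s := p :* (i :+ i) :+ (q :+ s)) ≡.refl p i Q (ℓ * ℓ) ⟩
        p * (i + i) + (Q + ℓ * ℓ)          ∎
        where
        E : Subspace b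
        E = eigenspace f k
        e≡Qℓ : ∣ E ∣ ≡ Q * ℓ
        e≡Qℓ = hyperplane-card ≤M M≤
        no2 : ∀ {x h} → to (to x) ≈ᴹ h *ₗ x → Member E x
        no2 = transvection-no2cycle (linear f) multiplier≉0 ⟪⟫-scaled k V⊆E+u (ℓ<Qℓ e≡Qℓ)
        -- From f x = h x follows f² x = h² x, and `no2` places x in `E`: there are no eigenvectors
        -- for other eigenvalues.
        N+1≤Qℓ : N + 1 ≤ Q * ℓ
        N+1≤Qℓ = ℕ.≤-trans (nonzeros≤ N-card E proj₁ id (λ (_ , x≉0 , _) → x≉0) (λ (x , _ , h , fx≈hx) → no2
          (≈ᴹ-trans (⟦⟧-cong fx≈hx) (≈ᴹ-trans (*ₗ-homo h x) (≈ᴹ-trans (*ₗ-congˡ fx≈hx) (≈ᴹ-sym (*ₗ-assoc h h x)))))))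
          (ℕ.≤-reflexive e≡Qℓ)
        eigen-or-moved : ∀ x → IsEigenvector f x ⊎ ¬ (∃[ h ] to (to x) ≈ᴹ h *ₗ x)
        eigen-or-moved x with Subspace.Member? E x
        ... | yes x∈E = inj₁ (k , x∈E)
        ... | no  x∉E = inj₂ λ (h , eq) → x∉E (no2 eq)
        bound : ℓ * ℓ * Q + ℓ * ℓ * Q ≤ p * i + p * i + p * i + (Q * ℓ + Q * ℓ)
        bound = begin
          ℓ * ℓ * Q + ℓ * ℓ * Q                              ≡⟨ ≡.cong (λ m → m + m) M≡ℓℓQ ⟨
          M + M                                              ≤⟨ index.lower₃ eigen-or-moved ⟩
          p * (i + i + i) + (N + N + 2)                      ≡⟨ solve 3 (λ p i N → p :* (i :+ i :+ i) :+ (N :+ N :+ con 2)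
                                                                  := p :* i :+ p :* i :+ p :* i :+ ((N :+ con 1) :+ (N :+ con 1))) ≡.refl p i N ⟩
          p * i + p * i + p * i + ((N + 1) + (N + 1))        ≤⟨ ℕ.+-monoʳ-≤ (p * i + p * i + p * i) (ℕ.+-mono-≤ N+1≤Qℓ N+1≤Qℓ) ⟩
          p * i + p * i + p * i + (Q * ℓ + Q * ℓ)            ∎

  module _ (M≡ℓℓ : M ≡ ℓ * ℓ) where
    private
      nonwhole-card : ∀ {W : Subspace b} → Codimension W → ¬ (∀ x → Member W x) → ∣ W ∣ ≤ ℓ
      nonwhole-card {W} codim W≠V = ℕ.*-cancelʳ-≤ ∣ W ∣ ℓ ℓ {{>-nonZero 1≤ℓ}} (ℕ.≤-trans (step codim) (ℕ.≤-reflexive M≡ℓℓ))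
        where
        step : Codimension W → ∣ W ∣ * ℓ ≤ M
        step (whole W=V)           = contradiction W=V W≠V
        step (hyperplane _ _ _ le _) = le
        step (deep le)             = ℕ.≤-trans (ℕ.m≤m*n (∣ W ∣ * ℓ) ℓ {{>-nonZero 1≤ℓ}}) le

    -- In dimension 2 a hyperplane has ℓ elements, and the extremal reflection itself fixes one. The
    -- bound from orbits of length two is therefore already sharp, and hyperplanes need no special
    -- treatment.
    vectorIndex≥₁ : ∀ f → ¬ f Vec.≈ Vec.ε → M ≤ vectorIndex f + vectorIndex f + ℓ
    vectorIndex≥₁ f f≉ε = ℕ.≤-trans (VectorIndex.lower (proj₂ (proj₂ (vector-index f)))) (ℕ.+-monoʳ-≤ _
      (nonwhole-card (codimension (eigenspace f 1#)) λ E=V → f≉ε λ x → ≈ᴹ-trans (E=V x) (*ₗ-identityˡ x)))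

    lineIndex≥₁ : ∀ f → ¬ f Proj.≈ Proj.ε → M + 1 ≤ p * (lineIndex f + lineIndex f) + (ℓ + ℓ)
    lineIndex≥₁ f f≉ε = begin
        M + 1                       ≤⟨ ℕ.+-monoˡ-≤ 1 index.lower ⟩
        p * (i + i) + (N + 1) + 1   ≡⟨ solve 2 (λ x y → x :+ (y :+ con 1) :+ con 1 := x :+ (y :+ con 2)) ≡.refl (p * (i + i)) N ⟩
        p * (i + i) + (N + 2)       ≤⟨ ℕ.+-monoʳ-≤ (p * (i + i)) N+2≤ℓ+ℓ ⟩
        p * (i + i) + (ℓ + ℓ)       ∎
      where
      open ℕ.≤-Reasoning
      i N : ℕ
      i = lineIndex f
      N = proj₁ (proj₂ (line-index f))
      module index = LineIndex (proj₂ (proj₂ (proj₂ (line-index f))))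
      open index using (N-card)
      N+2≤ℓ+ℓ : N + 2 ≤ ℓ + ℓ
      N+2≤ℓ+ℓ with Fin.any? (λ k → ℓ ℕ.≤? ∣ eigenspace f k ∣)
      ... | yes (k , large) = ℕ.≤-trans (nonzeroEigenvectors≤ f k N-card) (sum≤-of-product≤ 1≤ℓ large
              (nonwhole-card (codimension (eigenspace f k)) λ E=V → f≉ε (scalar⇒∼ε f k E=V))
              (ℕ.≤-trans (∣eigenspace∣*∣others∣≤m f k) (ℕ.≤-reflexive M≡ℓℓ)))
      -- A nonzero eigenspace has at least ℓ elements, so here all eigenspaces are zero and N = 0.
      ... | no  small = ℕ.+-mono-≤ (ℕ.≤-trans (nonzeroEigenvectors≡0 f N-card trivial) z≤n) 2≤ℓ
        where
        trivial : ∀ k {x} → Member (eigenspace f k) x → x ≈ᴹ 0ᴹ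
        trivial k with dimension (eigenspace f k)
        ... | point E=0    = E=0
        ... | line _ _ le  = contradiction (k , le) small
        ... | plane le     = contradiction (k , ℕ.≤-trans (ℕ.m≤m*n ℓ ℓ {{>-nonZero 1≤ℓ}}) le) small

  -- `s` and `Q` are meant as the orders of the (-1)- and the 1-eigenspace of an involution: ℓ² and
  -- ℓ^(2n-2), or ℓ and ℓ when n = 1. The two inequalities reverse the lower bounds valid for every
  -- nontrivial element, and one element serves both actions.
  record ExtremalElement (s Q : ℕ) : Set (a ⊔ b) where
    field
      element     : Similitude V
      ≉ε          : ¬ element Vec.≈ Vec.ε
      ≁ε          : ¬ element Proj.≈ Proj.ε
      vectorIndex≤ : vectorIndex element + vectorIndex element + Q ≤ M
      lineIndex≤   : p * (lineIndex element + lineIndex element) + (Q + s) ≤ M + 1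

  module _ {P : Carrierᴹ → Carrierᴹ} (P-linear : IsLeftModuleHomomorphism rawLeftModule rawLeftModule P)
           (P-idem : ∀ x → P (P x) ≈ᴹ P x) where
    open Reflection P-linear P-idem

    module _ {μ} (μ≉0 : ¬ μ ≈ 0#) (⟪⟫-scaled : ∀ x y → ⟪ reflect x , reflect y ⟫ ≈ μ ⊗ ⟪ x , y ⟫)
             {s Q} (2≤s : 2 ≤ s) (2≤Q : 2 ≤ Q) (M≡sQ : M ≡ s * Q) (∣image∣≡s : ∣ image ∣ ≡ s) where
      reflection : Similitude V
      reflection = record
        { to = reflect
        ; isLinearAutomorphism = record
          { isLeftModuleMonomorphism = record
            { isLeftModuleHomomorphism = reflect-linear
            ; injective = λ {x} {y} eq → ≈ᴹ-trans (≈ᴹ-sym (reflect-involutive x))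
                (≈ᴹ-trans (reflect-cong eq) (reflect-involutive y))
            }
          ; surjective = λ y → reflect y , λ eq → ≈ᴹ-trans (reflect-cong eq) (reflect-involutive y)
          }
        ; multiplier = μ
        ; multiplier≉0 = μ≉0
        ; ⟪⟫-scaled = ⟪⟫-scaled
        }
        where open IsLeftModuleHomomorphism reflect-linear using () renaming (⟦⟧-cong to reflect-cong)

      private
        Q≤∣kernel∣ : Q ≤ ∣ kernel ∣
        Q≤∣kernel∣ = ℕ.*-cancelˡ-≤ s {{>-nonZero (ℕ.≤-trans (s≤s z≤n) 2≤s)}} (ℕ.≤-trans (ℕ.≤-reflexive (≡.sym M≡sQ))
          (ℕ.≤-trans m≤∣kernel∣*∣image∣ (ℕ.≤-reflexive (≡.trans (≡.cong (∣ kernel ∣ *_) ∣image∣≡s) (ℕ.*-comm ∣ kernel ∣ s)))))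

        negated : ∃[ x ] Member image x × ¬ x ≈ᴹ 0ᴹ
        negated = 2≤∣∣⇒≉0 image (ℕ.≤-trans 2≤s (ℕ.≤-reflexive (≡.sym ∣image∣≡s)))

        fixed : ∃[ x ] Member kernel x × ¬ x ≈ᴹ 0ᴹ
        fixed = 2≤∣∣⇒≉0 kernel (ℕ.≤-trans 2≤Q Q≤∣kernel∣)

      reflection≉ε : ¬ reflection Vec.≈ Vec.ε
      reflection≉ε eq = let (x , x∈ , x≉0) = negated in x≉0 (reflect-image-fixed x∈ (eq x))

      -- A nonzero vector of the kernel is fixed, so the scalar could only be 1, but a nonzero
      -- vector of the image is not fixed.
      reflection≁ε : ¬ reflection Proj.≈ Proj.ε
      reflection≁ε (k , _ , f⁻¹≈k) = x≉0 (reflect-image-fixed x∈ (≈ᴹ-trans (≈ᴹ-sym (*ₗ-identityˡ (reflect x)))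
        (≈ᴹ-trans (*ₗ-congʳ (sym k≈1)) (≈ᴹ-trans (≈ᴹ-sym (f⁻¹≈k (reflect x))) (inverse-left V reflection x)))))
        where
        x y : Carrierᴹ
        x = proj₁ negated
        y = proj₁ fixed
        x∈ : Member image x
        x∈ = proj₁ (proj₂ negated)
        x≉0 : ¬ x ≈ᴹ 0ᴹ
        x≉0 = proj₂ (proj₂ negated)
        k≈1 : k ≈ 1#
        k≈1 = kx≈hx⇒k≈h (proj₂ (proj₂ fixed)) (≈ᴹ-trans (≈ᴹ-sym (f⁻¹≈k y))
          (≈ᴹ-trans (Similitude.⟦⟧-cong (inverse V reflection) (≈ᴹ-sym (reflect-kernel (proj₁ (proj₂ fixed)))))
            (≈ᴹ-trans (inverse-left V reflection y) (≈ᴹ-sym (*ₗ-identityˡ y)))))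

      vectorIndex-reflection : vectorIndex reflection + vectorIndex reflection + Q ≤ M
      vectorIndex-reflection = ℕ.≤-trans
        (ℕ.+-monoʳ-≤ _ (ℕ.≤-trans Q≤∣kernel∣ (∣∣-mono kernel (eigenspace reflection 1#)
          λ {x} x∈ → ≈ᴹ-trans (reflect-kernel x∈) (≈ᴹ-sym (*ₗ-identityˡ x)))))
        (VectorIndex.upper (proj₂ (proj₂ (vector-index reflection))) reflect-involutive)

      lineIndex-reflection : p * (lineIndex reflection + lineIndex reflection) + (Q + s) ≤ M + 1
      lineIndex-reflection = begin
        p * (i + i) + (Q + s)                    ≤⟨ ℕ.+-monoʳ-≤ (p * (i + i)) (ℕ.+-mono-≤ Q≤∣kernel∣ (ℕ.≤-reflexive (≡.sym ∣image∣≡s))) ⟩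
        p * (i + i) + (∣ kernel ∣ + ∣ image ∣)   ≤⟨ ℕ.+-monoʳ-≤ (p * (i + i)) (∣kernel∣+∣image∣≤ index.N-card) ⟩
        p * (i + i) + (N + 2)                    ≡⟨ solve 2 (λ x y → x :+ (y :+ con 2) := x :+ (y :+ con 1) :+ con 1) ≡.refl (p * (i + i)) N ⟩
        p * (i + i) + (N + 1) + 1                ≤⟨ ℕ.+-monoˡ-≤ 1 (index.upper reflect-involutive) ⟩
        M + 1                                    ∎
        where
        open ℕ.≤-Reasoning
        i N : ℕ
        i = lineIndex reflection
        N = proj₁ (proj₂ (line-index reflection))
        module index = LineIndex (proj₂ (proj₂ (proj₂ (line-index reflection))))

      reflection-extremal : ExtremalElement s Q
      reflection-extremal = record
        { element      = reflection
        ; ≉ε           = reflection≉ε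
        ; ≁ε           = reflection≁ε
        ; vectorIndex≤ = vectorIndex-reflection
        ; lineIndex≤   = lineIndex-reflection
        }

  module _ {s Q} (2≤s : 2 ≤ s) (2≤Q : 2 ≤ Q) (M≡sQ : M ≡ s * Q) where
    private
      pair : ∃₂ λ u v → ⟪ u , v ⟫ ≈ 1#
      pair = hyperbolicPair (ℕ.≤-trans 2≤s (ℕ.≤-trans (ℕ.m≤m*n s Q {{>-nonZero (ℕ.≤-trans (s≤s z≤n) 2≤Q)}}) (ℕ.≤-reflexive (≡.sym M≡sQ))))
      open HyperbolicPair (proj₂ (proj₂ pair))

      -1≉0 : ¬ - 1# ≈ 0#
      -1≉0 eq = 1≉0 (trans (sym (+-identityˡ 1#)) (trans (+-congʳ (sym eq)) (-‿inverseˡ 1#)))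

    planeElement : s ≡ ℓ * ℓ → ExtremalElement s Q
    planeElement s≡ℓ² = reflection-extremal toPlane-linear (λ x → toPlane-combination (α x) (β x)) 1≉0
      planeReflection-isometry 2≤s 2≤Q M≡sQ (≡.trans (ℕ.≤-antisym ∣plane∣≤q² q²≤∣plane∣) (≡.sym s≡ℓ²))

    lineElement : s ≡ ℓ → Q ≡ ℓ → ExtremalElement s Q
    lineElement ≡.refl ≡.refl = reflection-extremal toLine-linear toLine-idem -1≉0
      (lineReflection-anti (plane-whole 1≤ℓ M≡sQ)) 2≤s 2≤Q M≡sQ (ℕ.≤-antisym ∣line∣≤q q≤∣line∣)

  -- From matching bounds to the invariants

  module _ {s Q} (M≡sQ : M ≡ s * Q) (extremal : ExtremalElement s Q) where
    open ExtremalElement extremal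
    open ℕ.≤-Reasoning

    πvec-invariant : ∀ {m} → m ≡ Q * (s ∸ 1) → (∀ f → ¬ f Vec.≈ Vec.ε → M ≤ vectorIndex f + vectorIndex f + Q) →
                     IsMalleInvariant (πvec V) (m / 2)
    πvec-invariant {m} m≡ vectorIndex≥ = record
      { attained = element , ≉ε , ≡.subst (HasIndex _) (ℕ.≤-antisym (≤-/2 attained) (lower element ≉ε)) (hasIndex element)
      ; minimal  = λ f f≉ε → vectorIndex f , hasIndex f , lower f f≉ε
      }
      where
      hasIndex : ∀ f → HasIndex (PermutationRepresentation.perm (πvec-action V) f) (vectorIndex f)
      hasIndex f = proj₁ (proj₂ (vector-index f))
      m≡M∸Q : m ≡ M ∸ Q
      m≡M∸Q = begin-equality
        m                ≡⟨ m≡ ⟩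
        Q * (s ∸ 1)      ≡⟨ ℕ.*-distribˡ-∸ Q s 1 ⟩
        Q * s ∸ Q * 1    ≡⟨ ≡.cong₂ _∸_ (≡.trans (ℕ.*-comm Q s) (≡.sym M≡sQ)) (ℕ.*-identityʳ Q) ⟩
        M ∸ Q            ∎
      lower : ∀ f → ¬ f Vec.≈ Vec.ε → m / 2 ≤ vectorIndex f
      lower f f≉ε = /2-≤ (begin
        m                                   ≡⟨ m≡M∸Q ⟩
        M ∸ Q                               ≤⟨ ℕ.m≤n+o⇒m∸n≤o M Q (ℕ.≤-trans (vectorIndex≥ f f≉ε) (ℕ.≤-reflexive (ℕ.+-comm _ Q))) ⟩
        vectorIndex f + vectorIndex f       ∎)
      attained : vectorIndex element + vectorIndex element ≤ m
      attained = ℕ.≤-trans (ℕ.m+n≤o⇒m≤o∸n _ vectorIndex≤) (ℕ.≤-reflexive (≡.sym m≡M∸Q))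

    -- As M = s Q, the number M + 1 - Q - s of vectors that are not eigenvectors of the extremal
    -- element is (s - 1)(Q - 1). Divided by ℓ - 1 it is `m`, the number of lines moved, which is
    -- twice the index of this involution.
    πproj-invariant : 1 ≤ s → 1 ≤ Q → ∀ {m} → p * m ≡ (s ∸ 1) * (Q ∸ 1) →
                      (∀ f → ¬ f Proj.≈ Proj.ε → M + 1 ≤ p * (lineIndex f + lineIndex f) + (Q + s)) →
                      IsMalleInvariant (πproj V) (m / 2)
    πproj-invariant 1≤s 1≤Q {m} pm≡ lineIndex≥ = record
      { attained = element , ≁ε , ≡.subst (HasIndex _) (ℕ.≤-antisym (≤-/2 attained) (lower element ≁ε)) (hasIndex element)
      ; minimal  = λ f f≉ε → lineIndex f , hasIndex f , lower f f≉ε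
      }
      where
      instance
        p-nonZero : NonZero p
        p-nonZero = >-nonZero (ℕ.∸-monoˡ-≤ 1 2≤ℓ)
      hasIndex : ∀ f → HasIndex (PermutationRepresentation.perm (πproj-action V) f) (lineIndex f)
      hasIndex f = proj₁ (proj₂ (proj₂ (line-index f)))
      pm+Q+s≡M+1 : p * m + (Q + s) ≡ M + 1
      pm+Q+s≡M+1 with ℕ.m≤n⇒∃[o]m+o≡n 1≤s | ℕ.m≤n⇒∃[o]m+o≡n 1≤Q
      ... | s′ , ≡.refl | Q′ , ≡.refl = begin-equality
        p * m + (suc Q′ + suc s′)           ≡⟨ ≡.cong (_+ (suc Q′ + suc s′)) pm≡ ⟩
        s′ * Q′ + (suc Q′ + suc s′)         ≡⟨ solve 2 (λ s Q → s :* Q :+ ((con 1 :+ Q) :+ (con 1 :+ s)) := (con 1 :+ s) :* (con 1 :+ Q) :+ con 1) ≡.refl s′ Q′ ⟩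
        suc s′ * suc Q′ + 1                 ≡⟨ ≡.cong (_+ 1) M≡sQ ⟨
        M + 1                               ∎
      lower : ∀ f → ¬ f Proj.≈ Proj.ε → m / 2 ≤ lineIndex f
      lower f f≉ε = /2-≤ (ℕ.*-cancelˡ-≤ p (ℕ.+-cancelʳ-≤ (Q + s) _ _ (ℕ.≤-trans (ℕ.≤-reflexive pm+Q+s≡M+1) (lineIndex≥ f f≉ε))))
      attained : lineIndex element + lineIndex element ≤ m
      attained = ℕ.*-cancelˡ-≤ p (ℕ.+-cancelʳ-≤ (Q + s) _ _ (ℕ.≤-trans lineIndex≤ (ℕ.≤-reflexive (≡.sym pm+Q+s≡M+1))))

proposition7p3 : ∀ {a b} (n : ℕ) → n ≥ 1 →
    ∀ {ℓ} (ℓ-prime : Prime ℓ) → ¬ (2 ∣ ℓ) →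
    (V : SymplecticSpace ℓ-prime n a b) →
    (n ≥ 2 →
    IsMalleInvariant (πvec V) ((ℓ ^ (2 * n ∸ 2) * (ℓ ^ 2 ∸ 1)) / 2) ×
    IsMalleInvariant (πproj V) (((ℓ + 1) * (ℓ ^ (2 * n ∸ 2) ∸ 1)) / 2)) ×
    (n ≡ 1 →
    IsMalleInvariant (πvec V) ((ℓ * (ℓ ∸ 1)) / 2) ×
    IsMalleInvariant (πproj V) ((ℓ ∸ 1) / 2))
proposition7p3 n n≥1 {ℓ} ℓ-prime ℓ-odd V = general , binary
  where
  open MalleInvariant ℓ-odd V
  3≤ : 3 ≤ ℓ
  3≤ = 3≤ℓ ℓ-prime ℓ-odd
  1≤ : 1 ≤ ℓ
  1≤ = ℕ.≤-trans (s≤s z≤n) 3≤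
  2≤ : 2 ≤ ℓ
  2≤ = ℕ.≤-trans (s≤s (s≤s z≤n)) 3≤
  ℓ²≡ℓℓ : ℓ ^ 2 ≡ ℓ * ℓ
  ℓ²≡ℓℓ = ≡.cong (ℓ *_) (ℕ.*-identityʳ ℓ)

  general : n ≥ 2 → IsMalleInvariant (πvec V) ((ℓ ^ (2 * n ∸ 2) * (ℓ ^ 2 ∸ 1)) / 2) ×
                    IsMalleInvariant (πproj V) (((ℓ + 1) * (ℓ ^ (2 * n ∸ 2) ∸ 1)) / 2)
  general n≥2 =
      πvec-invariant M≡ extremal (≡.cong (λ s → Q * (s ∸ 1)) ℓ²≡ℓℓ) (vectorIndex≥ M≡ 2≤Q)
    , πproj-invariant M≡ extremal (ℕ.*-mono-≤ 1≤ 1≤) (ℕ.≤-trans (s≤s z≤n) 2≤Q) factor (lineIndex≥ M≡ 2≤Q)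
    where
    Q : ℕ
    Q = ℓ ^ (2 * n ∸ 2)
    M≡ : ℓ ^ (2 * n) ≡ ℓ * ℓ * Q
    M≡ = ≡.trans (≡.cong (ℓ ^_) (≡.sym (ℕ.m+[n∸m]≡n {2} {2 * n} (ℕ.*-monoʳ-≤ 2 n≥1)))) (≡.sym (ℕ.*-assoc ℓ ℓ Q))
    2≤Q : 2 ≤ Q
    2≤Q = ℕ.≤-trans 2≤ (ℕ.≤-trans (ℕ.≤-reflexive (≡.sym (ℕ.*-identityʳ ℓ)))
      (ℕ.^-monoʳ-≤ ℓ {{>-nonZero 1≤}} {1} (ℕ.≤-trans (s≤s z≤n) (ℕ.∸-monoˡ-≤ 2 (ℕ.*-monoʳ-≤ 2 n≥2)))))
    extremal : ExtremalElement (ℓ * ℓ) Q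
    extremal = planeElement (ℕ.≤-trans 2≤ (ℕ.m≤m*n ℓ ℓ {{>-nonZero 1≤}})) 2≤Q M≡ ≡.refl
    factor : (ℓ ∸ 1) * ((ℓ + 1) * (Q ∸ 1)) ≡ (ℓ * ℓ ∸ 1) * (Q ∸ 1)
    factor with ℕ.m≤n⇒∃[o]m+o≡n 1≤
    -- For ℓ = 1 + p the term `ℓ * ℓ ∸ 1` reduces to `p + p * suc p`, a subtraction-free form that
    -- the solver accepts.
    ... | p , ≡.refl = solve 2 (λ p R → p :* ((con 1 :+ p :+ con 1) :* R) := (p :+ p :* (con 1 :+ p)) :* R) ≡.refl p (Q ∸ 1)

  binary : n ≡ 1 → IsMalleInvariant (πvec V) ((ℓ * (ℓ ∸ 1)) / 2) × IsMalleInvariant (πproj V) ((ℓ ∸ 1) / 2)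
  binary n≡1 =
      πvec-invariant M≡ extremal ≡.refl (vectorIndex≥₁ M≡)
    , πproj-invariant M≡ extremal 1≤ 1≤ ≡.refl (lineIndex≥₁ M≡)
    where
    M≡ : ℓ ^ (2 * n) ≡ ℓ * ℓ
    M≡ = ≡.trans (≡.cong (λ n → ℓ ^ (2 * n)) n≡1) ℓ²≡ℓℓ
    extremal : ExtremalElement ℓ ℓ
    extremal = lineElement 2≤ 2≤ M≡ ≡.refl ≡.refl
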